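{- Let $q,k\in\mathbb{N}$ with $q$ prime, and let $\varepsilon,\delta\in(0,1)$. There exist constants $c>0$ and $r_0$, depending only on $k,q,\delta,\varepsilon$, such that the following holds. Let $n,d,r,\Delta,e\in\mathbb{N}$ be such that $r\ge r_0$, $r=(q-1)n-d$, $q^{\varepsilon r}\le\Delta\le q^{\frac{r}{4(q-1)}-2}$, and $\delta r\le e\le\frac{r}{4k}$. Then, given any $f:\mathbb{F}_q^n\to\mathbb{F}_q$ that is $\Delta$-far from $\mathcal{P}_q(n,d)$, and for $P_1,\ldots,P_k$ chosen independently and uniformly at random from $\mathcal{P}_q(n,e)$, we have \[ \Pr_{P_1,\ldots,P_k}\left[fP_1P_2\cdots P_k\in\mathcal{P}_q(n,d+ek)\right]\le \frac{1}{q^{q^{cr}}}. \]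
   Context: $\mathbb{N}=\{1,2,3,\ldots\}$. $\mathbb{F}_q$ is the finite field with $q$ elements. $\mathcal{P}_q(n,d)$ (the Reed-Muller code) is the set of functions $\mathbb{F}_q^n\to\mathbb{F}_q$ that are evaluations of polynomials in $n$ variables over $\mathbb{F}_q$ of total degree at most $d$. Products of functions are pointwise. For $f,g:\mathbb{F}_q^n\to\mathbb{F}_q$ the (absolute) Hamming distance is $\Delta(f,g)=\#\{x\in\mathbb{F}_q^n: f(x)\ne g(x)\}$, and for a set $\mathcal{G}$ of functions $\Delta(f,\mathcal{G})=\min_{g\in\mathcal{G}}\Delta(f,g)$. For a number $\Delta$, $f$ is $\Delta$-far from $\mathcal{G}$ if $\Delta(f,\mathcal{G})>\Delta$. -}

module Defs where

open import Data.Fin.Base using (Fin; toℕ)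
import Data.Fin.Properties as Fin
open import Data.Integer.Base as ℤ using (ℤ; +_; -[1+_])
import Data.Integer.Properties as ℤ
open import Data.List.Base as List
  using (List; []; _∷_; length; filter; map; upTo; allFin; deduplicate; cartesianProductWith)
open import Data.List.Extrema.Nat using (min)
import Data.List.Membership.DecSetoid as DecMembership
open import Data.List.Membership.Propositional using (_∈_)
open import Data.List.Membership.Propositional.Properties using (∈-allFin; ∈-cartesianProductWith⁺)
open import Data.List.Relation.Unary.All as All using (All)
open import Data.List.Relation.Unary.Any using (here)
open import Data.Nat.Base as ℕ using (ℕ; zero; suc; NonZero; s≤s; z≤n)
open import Data.Nat.DivMod using (_mod_)
open import Data.Nat.Primality using (Prime; prime)
import Data.Nat.Properties as ℕ
open import Data.Nat.Coprimality as Coprime using (1-coprimeTo)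
open import Data.Product.Base using (∃; ∃-syntax; _×_; _,_)
open import Data.Rational.Base as ℚ using (ℚ; 0ℚ; 1ℚ; ↥_; ↧ₙ_; _/_)
import Data.Rational.Properties as ℚ
import Data.Rational.Unnormalised.Base as ℚᵘ
import Data.Rational.Unnormalised.Properties as ℚᵘ
open import Data.Vec.Base as Vec using (Vec; []; _∷_; zipWith; foldr′; fromList)
open import Level using (0ℓ)
open import Relation.Binary.Bundles using (DecSetoid)
open import Relation.Binary.PropositionalEquality
  using (_≡_; _≗_; refl; sym; trans; cong; subst; subst₂)
open import Relation.Nullary using (¬_)
open import Relation.Nullary.Decidable using (¬?; map′)
open import Relation.Unary using (Pred; Decidable)
open import Algebra.Definitions.RawSemiring ℚ.+-*-rawSemiring using () renaming (_^_ to _^ℚ_)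

------------------------------------------------------------------------
-- Real numbers, as Dedekind cuts: a real x is given by the set
-- { a ∈ ℚ : a < x }, which is nonempty, bounded above, downward closed
-- and has no greatest element.

record ℝ : Set₁ where
  field
    _∋_       : ℚ → Set
    inhabited : ∃[ a ] _∋_ a
    bounded   : ∃[ u ] ¬ _∋_ u
    downward  : ∀ {a b} → a ℚ.< b → _∋_ b → _∋_ a
    rounded   : ∀ {a} → _∋_ a → ∃[ b ] a ℚ.< b × _∋_ b

open ℝ using (_∋_)

infix 4 _≤ᴿ_ _<ᴿ_
infix  8 -ᴿ_
infixl 7 _*ᴿ_
infixr 8 _^ᴿ_

_≤ᴿ_ : ℝ → ℝ → Set
x ≤ᴿ y = ∀ a → x ∋ a → y ∋ a

_<ᴿ_ : ℝ → ℝ → Set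
x <ᴿ y = ∃[ a ] ¬ (x ∋ a) × y ∋ a

private
  p-1<p : ∀ p → p ℚ.- 1ℚ ℚ.< p
  p-1<p p = subst (p ℚ.- 1ℚ ℚ.<_) (ℚ.+-identityʳ p)
              (ℚ.+-monoʳ-< p (ℚ.negative⁻¹ (ℚ.- 1ℚ)))

  neg-involutive : ∀ p → ℚ.- (ℚ.- p) ≡ p
  neg-involutive p = GroupProperties.⁻¹-involutive p
    where import Algebra.Properties.Group ℚ.+-0-group as GroupProperties

  below-bound : ∀ (x : ℝ) {a u} → ¬ (x ∋ u) → x ∋ a → a ℚ.≤ u
  below-bound x ¬u a∈ = ℚ.≮⇒≥ λ u<a → ¬u (ℝ.downward x u<a a∈)

fromℚ : ℚ → ℝ
fromℚ p = record
  { _∋_       = λ a → a ℚ.< p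
  ; inhabited = p ℚ.- 1ℚ , p-1<p p
  ; bounded   = p , ℚ.<-irrefl refl
  ; downward  = ℚ.<-trans
  ; rounded   = λ a<p → let m , a<m , m<p = ℚ.<-dense a<p in m , a<m , m<p
  }

fromℕ : ℕ → ℝ
fromℕ n = fromℚ (+ n / 1)

_*ᴿ_ : ℝ → ℕ → ℝ
x *ᴿ r = record
  { _∋_       = λ a → ∃[ b ] x ∋ b × a ℚ.< b ℚ.* R
  ; inhabited = let b , b∈ = inhabited in b ℚ.* R ℚ.- 1ℚ , b , b∈ , p-1<p (b ℚ.* R)
  ; bounded   = let u , ¬u = bounded in
                u ℚ.* R , λ (b , b∈ , uR<bR) → ℚ.<-irrefl refl (ℚ.<-≤-trans uR<bR
                  (ℚ.*-monoʳ-≤-nonNeg R {{ℚ.normalize-nonNeg r 1}} (below-bound x ¬u b∈)))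
  ; downward  = λ a<a′ (b , b∈ , a′<bR) → b , b∈ , ℚ.<-trans a<a′ a′<bR
  ; rounded   = λ (b , b∈ , a<bR) → let m , a<m , m<bR = ℚ.<-dense a<bR in
                m , a<m , b , b∈ , m<bR
  }
  where
  open ℝ x using (inhabited; bounded)
  R = + r / 1

-- a < -x iff x ≤ -b for some b > a.
-ᴿ_ : ℝ → ℝ
-ᴿ x = record
  { _∋_       = λ a → ∃[ b ] a ℚ.< b × ¬ (x ∋ (ℚ.- b))
  ; inhabited = let u , ¬u = bounded in
                ℚ.- u ℚ.- 1ℚ , ℚ.- u , p-1<p (ℚ.- u) ,
                λ u∈ → ¬u (subst (x ∋_) (neg-involutive u) u∈)
  ; bounded   = let a , a∈ = inhabited in
                ℚ.- a , λ (b , -a<b , ¬-b) → ¬-b (downward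
                  (subst (ℚ.- b ℚ.<_) (neg-involutive a) (ℚ.neg-antimono-< -a<b)) a∈)
  ; downward  = λ a<a′ (b , a′<b , ¬-b) → b , ℚ.<-trans a<a′ a′<b , ¬-b
  ; rounded   = λ (b , a<b , ¬-b) → let m , a<m , m<b = ℚ.<-dense a<b in
                m , a<m , b , m<b , ¬-b
  }
  where open ℝ x using (inhabited; bounded; downward)

_^ℤ_ : (b : ℕ) → ℤ → .{{NonZero b}} → ℚ
b ^ℤ (+ n)    = + (b ℕ.^ n) / 1
b ^ℤ -[1+ n ] = _/_ (+ 1) (b ℕ.^ suc n) {{ℕ.m^n≢0 b (suc n)}}

private
  /1-mkℚ : ∀ n → + n / 1 ≡ ℚ.mkℚ (+ n) 0 (Coprime.sym (1-coprimeTo n))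
  /1-mkℚ n = ℚ.↥p/↧p≡p (ℚ.mkℚ (+ n) 0 (Coprime.sym (1-coprimeTo n)))

  /1-mono-≤ : ∀ {m n} → m ℕ.≤ n → + m / 1 ℚ.≤ + n / 1
  /1-mono-≤ {m} {n} m≤n rewrite /1-mkℚ m | /1-mkℚ n =
    ℚ.*≤* (ℤ.*-monoʳ-≤-nonNeg (+ 1) (ℤ.+≤+ m≤n))

  /1-homo-* : ∀ m n → (+ m / 1) ℚ.* (+ n / 1) ≡ + (m ℕ.* n) / 1
  /1-homo-* m n rewrite /1-mkℚ m | /1-mkℚ n = cong (_/ 1) (sym (ℤ.pos-* m n))

  1/n≤1 : ∀ n .{{_ : NonZero n}} → + 1 / n ℚ.≤ 1ℚ
  1/n≤1 (suc n) = ℚ.toℚᵘ-cancel-≤ (ℚᵘ.≤-trans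
    (ℚᵘ.≤-reflexive (ℚ.toℚᵘ-fromℚᵘ (ℚᵘ.mkℚᵘ (+ 1) n)))
    (ℚᵘ.*≤* (ℤ.+≤+ (s≤s z≤n))))

  ^ℤ-bound : ∀ b .{{_ : NonZero b}} (a u : ℚ) → a ℚ.≤ u →
             b ^ℤ (↥ a) ℚ.≤ + (b ℕ.^ (ℤ.∣ ↥ u ∣ ℕ.* ↧ₙ a)) / 1
  ^ℤ-bound b (ℚ.mkℚ -[1+ n ] s _) u _ =
    ℚ.≤-trans (1/n≤1 (b ℕ.^ suc n) {{ℕ.m^n≢0 b (suc n)}})
              (/1-mono-≤ (ℕ.m^n>0 b (ℤ.∣ ↥ u ∣ ℕ.* suc s)))
  ^ℤ-bound b (ℚ.mkℚ (+ n) s _) (ℚ.mkℚ (+ k) d _) (ℚ.*≤* nd≤ks) =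
    /1-mono-≤ (ℕ.^-monoʳ-≤ b (ℕ.≤-trans (ℕ.m≤m*n n (suc d))
      (ℤ.drop‿+≤+ (subst₂ ℤ._≤_ (sym (ℤ.pos-* n (suc d))) (sym (ℤ.pos-* k (suc s))) nd≤ks))))
  ^ℤ-bound b (ℚ.mkℚ (+ n) s _) (ℚ.mkℚ -[1+ k ] d _) (ℚ.*≤* nd≤ks)
    with () ← subst (ℤ._≤ _) (sym (ℤ.pos-* n (suc d))) nd≤ks

  ^-lower : ∀ m {y} → + m / 1 ℚ.≤ y → ∀ t → + (m ℕ.^ t) / 1 ℚ.≤ y ^ℚ t
  ^-lower m m≤y zero        = ℚ.≤-refl
  ^-lower m {y} m≤y (suc t) = begin
    + (m ℕ.* m ℕ.^ t) / 1            ≡⟨ /1-homo-* m (m ℕ.^ t) ⟨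
    (+ m / 1) ℚ.* (+ (m ℕ.^ t) / 1)  ≤⟨ ℚ.*-monoˡ-≤-nonNeg (+ m / 1)
                                          {{ℚ.normalize-nonNeg m 1}} (^-lower m m≤y t) ⟩
    (+ m / 1) ℚ.* y ^ℚ t             ≤⟨ ℚ.*-monoʳ-≤-nonNeg (y ^ℚ t) {{y^t≥0}} m≤y ⟩
    y ℚ.* y ^ℚ t                     ∎
    where
    open ℚ.≤-Reasoning
    y^t≥0 : ℚ.NonNegative (y ^ℚ t)
    y^t≥0 = ℚ.nonNegative (ℚ.≤-trans
      (ℚ.nonNegative⁻¹ (+ (m ℕ.^ t) / 1) {{ℚ.normalize-nonNeg (m ℕ.^ t) 1}})
      (^-lower m m≤y t))

  ^-lower-< : ∀ m .{{_ : NonZero m}} {y} → + m / 1 ℚ.< y →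
              ∀ t .{{_ : NonZero t}} → + (m ℕ.^ t) / 1 ℚ.< y ^ℚ t
  ^-lower-< m {y} m<y (suc t) = begin-strict
    + (m ℕ.* m ℕ.^ t) / 1            ≡⟨ /1-homo-* m (m ℕ.^ t) ⟨
    (+ m / 1) ℚ.* (+ (m ℕ.^ t) / 1)  <⟨ ℚ.*-monoˡ-<-pos (+ (m ℕ.^ t) / 1)
                                          {{ℚ.normalize-pos (m ℕ.^ t) 1 {{_}} {{ℕ.m^n≢0 m t}}}} m<y ⟩
    y ℚ.* (+ (m ℕ.^ t) / 1)          ≤⟨ ℚ.*-monoˡ-≤-nonNeg y {{y≥0}} (^-lower m (ℚ.<⇒≤ m<y) t) ⟩
    y ℚ.* y ^ℚ t                     ∎
    where
    open ℚ.≤-Reasoning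
    y≥0 : ℚ.NonNegative y
    y≥0 = ℚ.nonNegative (ℚ.≤-trans
      (ℚ.nonNegative⁻¹ (+ m / 1) {{ℚ.normalize-nonNeg m 1}}) (ℚ.<⇒≤ m<y))

-- b^x = sup { b^a : a ∈ ℚ, a < x }.  For a = s/t in lowest terms with t > 0,
-- a rational y ≥ 0 satisfies y ≤ b^a iff y^t ≤ b^s.
_^ᴿ_ : (b : ℕ) .{{_ : NonZero b}} → ℝ → ℝ
b ^ᴿ x = record
  { _∋_       = λ z → ∃[ a ] ∃[ y ]
                  x ∋ a × z ℚ.< y × 0ℚ ℚ.≤ y × y ^ℚ (↧ₙ a) ℚ.≤ b ^ℤ (↥ a)
  ; inhabited = let a , a∈ = inhabited in
                0ℚ ℚ.- 1ℚ , a , 0ℚ , a∈ , p-1<p 0ℚ , ℚ.≤-refl , 0^t≤ a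
  ; bounded   = let u , ¬u = bounded in
                + (b ℕ.^ ℤ.∣ ↥ u ∣) / 1 , λ (a , y , a∈ , M<y , _ , y^t≤b^s) →
                too-big a u (below-bound x ¬u a∈) M<y y^t≤b^s
  ; downward  = λ z<z′ (a , y , a∈ , z′<y , rest) → a , y , a∈ , ℚ.<-trans z<z′ z′<y , rest
  ; rounded   = λ (a , y , a∈ , z<y , rest) → let m , z<m , m<y = ℚ.<-dense z<y in
                m , z<m , a , y , a∈ , m<y , rest
  }
  where
  open ℝ x using (inhabited; bounded)

  ^ℤ≥0 : ∀ i → 0ℚ ℚ.≤ b ^ℤ i
  ^ℤ≥0 (+ n)    = ℚ.nonNegative⁻¹ _ {{ℚ.normalize-nonNeg (b ℕ.^ n) 1}}
  ^ℤ≥0 -[1+ n ] = ℚ.nonNegative⁻¹ _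
    {{ℚ.normalize-nonNeg 1 (b ℕ.^ suc n) {{ℕ.m^n≢0 b (suc n)}}}}

  0^t≤ : ∀ a → 0ℚ ^ℚ (↧ₙ a) ℚ.≤ b ^ℤ (↥ a)
  0^t≤ a@(ℚ.mkℚ _ t _) =
    subst (ℚ._≤ b ^ℤ (↥ a)) (sym (ℚ.*-zeroˡ (0ℚ ^ℚ t))) (^ℤ≥0 (↥ a))

  too-big : ∀ a u {y} → a ℚ.≤ u → + (b ℕ.^ ℤ.∣ ↥ u ∣) / 1 ℚ.< y →
            ¬ (y ^ℚ (↧ₙ a) ℚ.≤ b ^ℤ (↥ a))
  too-big a@(ℚ.mkℚ _ t _) u a≤u M<y y^t≤b^s = ℚ.<-irrefl refl (ℚ.<-≤-trans
    (^-lower-< (b ℕ.^ N) {{ℕ.m^n≢0 b N}} M<y (suc t))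
    (ℚ.≤-trans y^t≤b^s (subst (λ k → b ^ℤ (↥ a) ℚ.≤ + k / 1)
      (sym (ℕ.^-*-assoc b N (suc t))) (^ℤ-bound b a u a≤u))))
    where N = ℤ.∣ ↥ u ∣

------------------------------------------------------------------------
-- Finite uniform probability

tuples : ∀ {A : Set} → List A → (m : ℕ) → List (Vec A m)
tuples xs zero    = [] ∷ []
tuples xs (suc m) = cartesianProductWith _∷_ xs (tuples xs m)

∈-tuples : ∀ {A : Set} {xs : List A} → (∀ x → x ∈ xs) →
           ∀ {m} (v : Vec A m) → v ∈ tuples xs m
∈-tuples all []      = here refl
∈-tuples all (x ∷ v) = ∈-cartesianProductWith⁺ _∷_ (all x) (∈-tuples all v)

-- Probability that P holds at a uniformly random entry of a list; the value
-- on the empty list is a convention (the sample spaces used are nonempty).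
Pr : ∀ {A : Set} {P : Pred A 0ℓ} → List A → Decidable P → ℚ
Pr []         P? = 0ℚ
Pr xs@(_ ∷ _) P? = + length (filter P? xs) / length xs

------------------------------------------------------------------------
-- Reed-Muller codes over 𝔽_q = ℤ/q, q prime

module ReedMuller (q : ℕ) .{{_ : NonZero q}} where

  𝔽 : Set
  𝔽 = Fin q

  infixl 6 _⊕_
  infixl 7 _⊗_ _·_
  infixr 8 _^𝔽_

  0𝔽 1𝔽 : 𝔽
  0𝔽 = 0 mod q
  1𝔽 = 1 mod q

  _⊕_ _⊗_ : 𝔽 → 𝔽 → 𝔽
  a ⊕ b = (toℕ a ℕ.+ toℕ b) mod q
  a ⊗ b = (toℕ a ℕ.* toℕ b) mod q

  _^𝔽_ : 𝔽 → ℕ → 𝔽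
  a ^𝔽 zero  = 1𝔽
  a ^𝔽 suc i = a ⊗ a ^𝔽 i

  points : (n : ℕ) → List (Vec 𝔽 n)
  points n = tuples (allFin q) n

  Func : ℕ → Set
  Func n = Vec 𝔽 n → 𝔽

  funcDecSetoid : ℕ → DecSetoid 0ℓ 0ℓ
  funcDecSetoid n = record
    { Carrier          = Func n
    ; _≈_              = _≗_
    ; isDecEquivalence = record
      { isEquivalence = record
        { refl  = λ _ → refl
        ; sym   = λ f≗g x → sym (f≗g x)
        ; trans = λ f≗g g≗h x → trans (f≗g x) (g≗h x)
        }
      ; _≟_ = λ f g → map′ (λ all x → All.lookup all (∈-tuples ∈-allFin x))
                           (λ f≗g → All.universal f≗g (points n))
                           (All.all? (λ x → f x Fin.≟ g x) (points n))
      }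
    }

  module _ {n : ℕ} where
    open DecSetoid (funcDecSetoid n) public using () renaming (_≟_ to _≗?_)
    open DecMembership (funcDecSetoid n) public
      using () renaming (_∈_ to _∈F_; _∈?_ to _∈F?_)

  _·_ : ∀ {n} → Func n → Func n → Func n
  (f · g) x = f x ⊗ g x

  ∏ : ∀ {n k} → Vec (Func n) k → Func n
  ∏ = foldr′ _·_ (λ _ → 1𝔽)

  -- The exponent vectors α ∈ ℕⁿ with |α| = α₁ + ⋯ + αₙ ≤ d.
  exponents : (n d : ℕ) → List (Vec ℕ n)
  exponents n d = filter (λ α → Vec.sum α ℕ.≤? d) (tuples (upTo (suc d)) n)

  -- A polynomial of total degree at most d, by its coefficients.
  Poly≤ : (n d : ℕ) → Set
  Poly≤ n d = Vec 𝔽 (length (exponents n d))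

  monomial : ∀ {n} → Vec ℕ n → Func n
  monomial α x = foldr′ _⊗_ 1𝔽 (zipWith _^𝔽_ x α)

  eval : ∀ {n d} → Poly≤ n d → Func n
  eval {n} {d} p x =
    foldr′ _⊕_ 0𝔽 (zipWith (λ c α → c ⊗ monomial α x) p (fromList (exponents n d)))

  -- The finite set 𝒫_q(n,d), as a list containing each of its functions exactly
  -- once up to pointwise equality (distinct polynomials may define the same
  -- function).
  𝒫 : (n d : ℕ) → List (Func n)
  𝒫 n d = deduplicate _≗?_ (map eval (tuples (allFin q) (length (exponents n d))))

  hamming : ∀ {n} → Func n → Func n → ℕ
  hamming {n} f g = length (filter (λ x → ¬? (f x Fin.≟ g x)) (points n))

  -- min over g ∈ G; no distance exceeds the default value qⁿ, which is
  -- therefore attained only as a genuine minimum when G is nonempty.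
  distance : ∀ {n} → Func n → List (Func n) → ℕ
  distance {n} f G = min (q ℕ.^ n) (map (hamming f) G)

  Far : ∀ {n} → ℕ → Func n → List (Func n) → Set
  Far Δ f G = distance f G ℕ.> Δ

4[q-1]-nonZero : ∀ {q} → Prime q → NonZero (4 ℕ.* (q ℕ.∸ 1))
4[q-1]-nonZero {suc (suc _)} _ = _
4[q-1]-nonZero {suc zero} (prime {{()}} _)

{-# OPTIONS --safe #-}

-- Write s = r - 1 and E g for the sum of g over 𝔽ⁿ. A function f is a polynomial of
-- degree at most d iff E (f Q) = 0 for all Q of degree at most s, so f matters only
-- as the functional E (f ·) on polynomials of degree at most s. Let A = ke + ⌊e/4⌋.
-- By the Fredholm alternative, either some h = f Q with deg Q ≤ s - A has degree
-- exactly (q - 1) n - A, or every polynomial of degree A is congruent, for the form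
-- E (f · ·), to one of smaller degree.
--
-- In the first case acceptance forces one of the products h P₁ ⋯ P_i to have smaller
-- degree than it should; this has probability at most q^(-2^t) for each i, since there
-- are q^(2^t) polynomials of degree e no two of which differ by one that lowers the
-- degree, with t proportional to e.
--
-- In the second case multiplication by the coordinates acts on polynomials modulo the
-- radical of the form by commuting diagonalisable operators, and a simultaneous
-- diagonalisation (flat extension) makes E (f ·) a combination of evaluations at the
-- points of a set Z that polynomials of degree less than A separate. As f is Δ-far,
-- |Z| > Δ, and acceptance forces P₁ ⋯ P_k to vanish on Z. Products of k + 1
-- polynomials of degree e span the functions on Z, so polynomials of degree e take
-- independent values at |Z|^(1/(k+1)) points of Z, at each of which the product
-- vanishes with probability at most 1 - q^-k.

module Submission where

open import Defs
open import Data.Integer.Base using (+_)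
open import Data.Nat.Base using (ℕ; NonZero; _+_; _*_; _∸_; _≥_)
open import Data.Nat.Primality using (Prime)
open import Data.Nat.Properties using (m*n≢0)
open import Data.Product.Base using (∃-syntax; _×_)
open import Data.Rational.Base as ℚ using (_/_)
open import Relation.Binary.PropositionalEquality using (_≡_)

open import Algebra.Bundles using (CommutativeRing; CommutativeSemiring)
open import Algebra.Definitions.RawSemiring ℚ.+-*-rawSemiring using () renaming (_^_ to _^ℚ_)
import Algebra.Properties.Group
import Algebra.Properties.Ring
import Algebra.Properties.Semiring.Sum
import Algebra.Solver.Ring.NaturalCoefficients.Default
open import Algebra.Structures using (IsCommutativeRing)
open import Data.Empty using (⊥-elim)
open import Data.Fin.Base using (Fin; toℕ; zero; suc; combine; remQuot; finToFun; funToFin)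
open import Data.Fin.Permutation using (permutation)
import Data.Fin.Properties as Fin
open import Data.Integer.Base as ℤ using (-[1+_])
import Data.Integer.Properties as ℤ
open import Data.List.Base as List
  using (List; []; _∷_; allFin; cartesianProductWith; concatMap; filter; length; map; upTo)
import Data.List.Extrema.Nat as Extrema
open import Data.List.Membership.Propositional using (_∈_; find)
open import Data.List.Membership.Propositional.Properties
  using (∈-allFin; ∈-cartesianProductWith⁺; ∈-cartesianProductWith⁻; ∈-concatMap⁺; ∈-filter⁺; ∈-filter⁻
        ; ∈-lookup; ∈-map⁺; ∈-map⁻; ∈-upTo⁺)
import Data.List.Membership.Setoid.Properties as SetoidMembership
import Data.List.Properties as List
open import Data.List.Relation.Unary.All as All using (All; []; _∷_)
import Data.List.Relation.Unary.All.Properties as All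
open import Data.List.Relation.Unary.AllPairs using (AllPairs; []; _∷_)
open import Data.List.Relation.Unary.Any as Any using (Any; here; there)
import Data.List.Relation.Unary.Any.Properties as Any
import Data.List.Relation.Unary.Unique.DecSetoid.Properties as DecUnique
open import Data.List.Relation.Unary.Unique.Propositional using (Unique)
import Data.List.Relation.Unary.Unique.Propositional.Properties as Unique
open import Data.Nat.Base as ℕ using (zero; suc; pred; _<_; _≤_; _^_; _%_; s≤s; z≤n)
open import Data.Nat.Coprimality as Coprime using (1-coprimeTo; coprime-Bézout; prime⇒coprime)
open import Data.Nat.DivMod
  using (_mod_; /-monoˡ-≤; %-distribˡ-+; %-distribˡ-*; m%n<n; m*n%n≡0; m*n/n≡m; m/n*n≤m; m<n⇒m%n≡m; m≡m%n+[m/n]*n)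
open import Data.Nat.GCD using (module Bézout)
open import Data.Nat.GeneralisedArithmetic using (fold)
open import Data.Nat.Primality using (prime⇒nonTrivial)
import Data.Nat.Properties as ℕ
open import Data.Nat.Solver using (module +-*-Solver)
open import Data.Product.Base using (Σ-syntax; _,_; proj₁; proj₂)
open import Data.Rational.Base using (ℚ; 0ℚ; ↥_; ↧ₙ_; mkℚ)
import Data.Rational.Properties as ℚ
import Data.Rational.Unnormalised.Base as ℚᵘ
import Data.Rational.Unnormalised.Properties as ℚᵘ
open import Data.Sum.Base using (_⊎_; inj₁; inj₂)
open import Data.Vec.Base as Vec
  using (Vec; []; _∷_; _++_; foldr′; fromList; head; lookup; tabulate; tail; updateAt; zipWith)
import Data.Vec.Properties as Vec
open import Data.Vec.Relation.Binary.Pointwise.Inductive using (Pointwise; []; _∷_)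
open import Function.Base using (_∘_)
open import Level using (0ℓ)
open import Relation.Binary.Bundles using (DecSetoid)
open import Relation.Binary.PropositionalEquality
open import Relation.Binary.PropositionalEquality.Algebra using (isMagma)
open import Relation.Nullary using (¬_; Dec; yes; no; contradiction)
open import Relation.Nullary.Decidable using (¬?)
open import Relation.Unary using (Pred; Decidable)

open ℝ using (_∋_)

-- The excess ⌊e/4⌋ of A over ke is the degree of the test functions that remain once all k factors
-- are multiplied in; each of the t doublings behind q^(2^t) consumes up to q - 1 of such a degree.
-- The excess stays below e so that A ≤ (k + 1) e, and is small enough that e ≤ r/(4k) gives 3A + q
-- ≤ r. The flat case needs this room: test functions of degree s - A must accommodate products of
-- two polynomials of degree below A, and projections onto the eigenspaces of a coordinate. These
-- projections are the Lagrange indicators of the values of the coordinate, of degree q - 1; as x^q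
-- = x on the field, all eigenvalues lie in it. The obstacle is the range of degrees:
-- diagonalisation represents E (f ·) by some h only up to degree s - A + 1, while f - h has degree
-- at most d only if the agreement reaches s. The gap is closed by reducing polynomials below degree
-- A without changing their values on Z, which is possible because evaluation at a point of Z is
-- itself the pairing with f w for some w of degree below A.

record PrimeField (q : ℕ) : Set where
  infixl 6 _⊕_
  infixl 7 _⊗_
  field
    _⊕_ _⊗_           : Fin q → Fin q → Fin q
    ⊖_                : Fin q → Fin q
    0𝔽 1𝔽             : Fin q
    isCommutativeRing : IsCommutativeRing _≡_ _⊕_ _⊗_ ⊖_ 0𝔽 1𝔽
    inverse           : ∀ a → a ≢ 0𝔽 → ∃[ b ] a ⊗ b ≡ 1𝔽

  ι : ℕ → Fin q
  ι = fold 0𝔽 (1𝔽 ⊕_)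

  field
    ι≢0          : ∀ {j} → 0 < j → j < q → ι j ≢ 0𝔽
    ι-surjective : ∀ a → ∃[ j ] j < q × ι j ≡ a
    1<q          : 1 < q

  ring : CommutativeRing 0ℓ 0ℓ
  ring = record { isCommutativeRing = isCommutativeRing }

  semiring : CommutativeSemiring 0ℓ 0ℓ
  semiring = CommutativeRing.commutativeSemiring ring

  open CommutativeRing ring public using () renaming
    ( +-identityˡ to ⊕-identityˡ; +-identityʳ to ⊕-identityʳ; +-comm to ⊕-comm; +-assoc to ⊕-assoc
    ; *-identityˡ to ⊗-identityˡ; *-identityʳ to ⊗-identityʳ; *-comm to ⊗-comm; *-assoc to ⊗-assoc
    ; zeroˡ to ⊗-zeroˡ; zeroʳ to ⊗-zeroʳ; distribˡ to ⊗-distribˡ-⊕; distribʳ to ⊗-distribʳ-⊕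
    ; -‿inverseˡ to ⊖-inverseˡ; -‿inverseʳ to ⊖-inverseʳ)
  open Algebra.Properties.Ring (CommutativeRing.ring ring) public using () renaming
    (-‿distribˡ-* to ⊖-distribˡ-⊗; -‿distribʳ-* to ⊖-distribʳ-⊗; -1*x≈-x to -1⊗x≡⊖x; -‿+-comm to ⊖-⊕-comm)
  open Algebra.Properties.Group (CommutativeRing.+-group ring) public using () renaming
    (∙-cancelˡ to ⊕-cancelˡ; ∙-cancelʳ to ⊕-cancelʳ; ε⁻¹≈ε to ⊖0≡0)
  open Algebra.Properties.Semiring.Sum (CommutativeSemiring.semiring semiring) public
    using (sum; sum-cong-≗; ∑-distrib-+; ∑-comm; sum-permute; sum-replicate-zero)
    renaming (*-distribˡ-sum to ⊗-distribˡ-sum; *-distribʳ-sum to ⊗-distribʳ-sum)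

  module Solver = Algebra.Solver.Ring.NaturalCoefficients.Default semiring

  ⊗-cancelˡ : ∀ a → a ≢ 0𝔽 → ∀ {b c} → a ⊗ b ≡ a ⊗ c → b ≡ c
  ⊗-cancelˡ a a≢0 {b} {c} ab≡ac with a′ , aa′≡1 ← inverse a a≢0 =
    trans (sym (undo b)) (trans (cong (a′ ⊗_) ab≡ac) (undo c))
    where
    undo : ∀ d → a′ ⊗ (a ⊗ d) ≡ d
    undo d = trans (sym (⊗-assoc a′ a d))
      (trans (cong (_⊗ d) (trans (⊗-comm a′ a) aa′≡1)) (⊗-identityˡ d))

  ⊗-≢0 : ∀ {a b} → a ≢ 0𝔽 → b ≢ 0𝔽 → a ⊗ b ≢ 0𝔽
  ⊗-≢0 {a} a≢0 b≢0 ab≡0 = b≢0 (⊗-cancelˡ a a≢0 (trans ab≡0 (sym (⊗-zeroʳ a))))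

  1≢0 : 1𝔽 ≢ 0𝔽
  1≢0 eq = ι≢0 (s≤s z≤n) 1<q (trans (⊕-identityʳ 1𝔽) eq)

  sum-zero : ∀ {m} {u : Fin m → Fin q} → (∀ i → u i ≡ 0𝔽) → sum u ≡ 0𝔽
  sum-zero {m} u≡0 = trans (sum-cong-≗ u≡0) (sum-replicate-zero m)

  sum-single : ∀ {m} {u : Fin m → Fin q} i → (∀ j → j ≢ i → u j ≡ 0𝔽) → sum u ≡ u i
  sum-single {suc m} {u} zero    u≡0 =
    trans (cong (u zero ⊕_) (sum-zero λ j → u≡0 (suc j) λ ())) (⊕-identityʳ (u zero))
  sum-single {suc m} {u} (suc i) u≡0 = trans
    (cong₂ _⊕_ (u≡0 zero λ ()) (sum-single i λ j j≢i → u≡0 (suc j) (j≢i ∘ Fin.suc-injective)))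
    (⊕-identityˡ (u (suc i)))

  ⊖-≡ : ∀ {a b} → a ⊕ ⊖ b ≡ 0𝔽 → a ≡ b
  ⊖-≡ {a} {b} eq = ⊕-cancelʳ (⊖ b) a b (trans eq (sym (⊖-inverseʳ b)))

-- Degree of functions, and vanishing of sums of low degree.

module Degree {q : ℕ} (𝔽 : PrimeField q) where
  open PrimeField 𝔽
  open Solver using (solve; con; _:+_; _:*_; _:=_)
  open ≡-Reasoning

  K : Set
  K = Fin q

  Func : ℕ → Set
  Func n = Vec K n → K

  E : ∀ {n} → Func n → K
  E {zero}  f = f []
  E {suc n} f = sum λ a → E λ x → f (a ∷ x)

  E-cong : ∀ {n} {f g : Func n} → f ≗ g → E f ≡ E g
  E-cong {zero}  f≗g = f≗g []
  E-cong {suc n} f≗g = sum-cong-≗ λ a → E-cong λ x → f≗g (a ∷ x)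

  E-⊕ : ∀ {n} (f g : Func n) → E (λ x → f x ⊕ g x) ≡ E f ⊕ E g
  E-⊕ {zero}  f g = refl
  E-⊕ {suc n} f g = trans (sum-cong-≗ λ a → E-⊕ (λ x → f (a ∷ x)) (λ x → g (a ∷ x)))
    (∑-distrib-+ (λ a → E λ x → f (a ∷ x)) (λ a → E λ x → g (a ∷ x)))

  E-⊗ : ∀ {n} c (f : Func n) → E (λ x → c ⊗ f x) ≡ c ⊗ E f
  E-⊗ {zero}  c f = refl
  E-⊗ {suc n} c f = trans (sum-cong-≗ λ a → E-⊗ c (λ x → f (a ∷ x)))
    (sym (⊗-distribˡ-sum c (λ a → E λ x → f (a ∷ x))))

  E-0 : ∀ {n} {f : Func n} → (∀ x → f x ≡ 0𝔽) → E f ≡ 0𝔽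
  E-0 {zero}  f≡0 = f≡0 []
  E-0 {suc n} f≡0 = sum-zero λ a → E-0 λ x → f≡0 (a ∷ x)

  E-head-tail : ∀ {n} (u : K → K) (g : Func n) → E (λ x → u (head x) ⊗ g (tail x)) ≡ sum u ⊗ E g
  E-head-tail u g = trans (sum-cong-≗ λ a → E-⊗ (u a) g) (sym (⊗-distribʳ-sum (E g) u))

  -- A derivation is a polynomial expression of degree at most d, and `resp≗` identifies expressions
  -- with the same values. This is therefore the degree of a function, the least one among the
  -- polynomials representing it, and x^q = x requires no normal form.
  data Deg {n : ℕ} : ℕ → Func n → Set where
    const : ∀ {d} c → Deg d (λ _ → c)
    add   : ∀ {d f g} → Deg d f → Deg d g → Deg d (λ x → f x ⊕ g x)
    var   : ∀ {d f} i → Deg d f → Deg (suc d) (λ x → lookup x i ⊗ f x)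
    resp≗  : ∀ {d f g} → f ≗ g → Deg d f → Deg d g

  Deg-≤ : ∀ {n d d′} {f : Func n} → d ≤ d′ → Deg d f → Deg d′ f
  Deg-≤ d≤d′       (const c)    = const c
  Deg-≤ d≤d′       (add f g)    = add (Deg-≤ d≤d′ f) (Deg-≤ d≤d′ g)
  Deg-≤ (s≤s d≤d′) (var i f)    = var i (Deg-≤ d≤d′ f)
  Deg-≤ d≤d′       (resp≗ f≗g f) = resp≗ f≗g (Deg-≤ d≤d′ f)

  Deg-scale : ∀ {n d} {f : Func n} c → Deg d f → Deg d (λ x → c ⊗ f x)
  Deg-scale c (const c′)       = const (c ⊗ c′)
  Deg-scale c (add {f = f} {g} df dg) =
      resp≗ (λ x → sym (⊗-distribˡ-⊕ c (f x) (g x))) (add (Deg-scale c df) (Deg-scale c dg))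
  Deg-scale c (var {f = f} i df)    =
    resp≗ (λ x → solve 3 (λ a b c → a :* (b :* c) := b :* (a :* c)) refl (lookup x i) c (f x))
        (var i (Deg-scale c df))
  Deg-scale c (resp≗ f≗g df)     = resp≗ (λ x → cong (c ⊗_) (f≗g x)) (Deg-scale c df)

  Deg-⊗ : ∀ {n a b} {f g : Func n} → Deg a f → Deg b g → Deg (a + b) (λ x → f x ⊗ g x)
  Deg-⊗ {a = a} {b} (const c) dg = Deg-scale c (Deg-≤ (ℕ.m≤n+m b a) dg)
  Deg-⊗ {g = g} (add {f = f} {f′} df df′) dg =
    resp≗ (λ x → sym (⊗-distribʳ-⊕ (g x) (f x) (f′ x))) (add (Deg-⊗ df dg) (Deg-⊗ df′ dg))
  Deg-⊗ {g = g} (var {f = f} i df) dg =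
      resp≗ (λ x → sym (⊗-assoc (lookup x i) (f x) (g x))) (var i (Deg-⊗ df dg))
  Deg-⊗ {g = g} (resp≗ f≗f′ df) dg = resp≗ (λ x → cong (_⊗ g x) (f≗f′ x)) (Deg-⊗ df dg)

  Deg-⊖ : ∀ {n d} {f g : Func n} → Deg d f → Deg d g → Deg d (λ x → f x ⊕ ⊖ g x)
  Deg-⊖ {g = g} df dg = add df (resp≗ (λ x → -1⊗x≡⊖x (g x)) (Deg-scale (⊖ 1𝔽) dg))

  Deg-var : ∀ {n} i → Deg {n} 1 (λ x → lookup x i)
  Deg-var i = resp≗ (λ x → ⊗-identityʳ (lookup x i)) (var i (const 1𝔽))

  Deg-tail : ∀ {n d} {f : Func n} → Deg d f → Deg d (λ x → f (tail x))
  Deg-tail (const c)    = const c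
  Deg-tail (add f g)    = add (Deg-tail f) (Deg-tail g)
  Deg-tail (var {f = f} i df) = resp≗ (λ { (_ ∷ x) → refl }) (var (suc i) (Deg-tail df))
  Deg-tail (resp≗ f≗g f) = resp≗ (λ x → f≗g (tail x)) (Deg-tail f)

  record Additive {n : ℕ} (Φ : Func n → Set) : Set where
    field
      Φ-⊕ : ∀ {f g} → Φ f → Φ g → Φ (λ x → f x ⊕ g x)
      Φ-≗ : ∀ {f g} → f ≗ g → Φ f → Φ g

  open Additive

  -- An induction on `Deg` meets a coordinate factor in front of f. Moving the factor into the
  -- predicate keeps it additive, so the recursion continues at f itself.
  Additive-⊗ : ∀ {n} {Φ : Func n → Set} → Additive Φ → (w : Func n) → Additive (λ f → Φ (λ x → w x ⊗ f x))
  Additive-⊗ ad w .Φ-⊕ {f} {g} p r = ad .Φ-≗ (λ x → sym (⊗-distribˡ-⊕ (w x) (f x) (g x))) (ad .Φ-⊕ p r)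
  Additive-⊗ ad w .Φ-≗ f≗g p = ad .Φ-≗ (λ x → cong (w x ⊗_) (f≗g x)) p

  -- Coordinate factors are shifted one by one into u until its degree a is used up; what remains
  -- has degree b.
  Deg-product : ∀ {n} a {b} {Φ : Func n → Set} → Additive Φ →
    (∀ {u w} → Deg a u → Deg b w → Φ (λ x → u x ⊗ w x)) →
    ∀ {f} → Deg (a + b) f → Φ f
  Deg-product zero    ad prod {f} df = ad .Φ-≗ (λ x → ⊗-identityˡ (f x)) (prod (const 1𝔽) df)
  Deg-product (suc a) ad prod (const c) = ad .Φ-≗ (λ x → ⊗-identityʳ c) (prod (const c) (const 1𝔽))
  Deg-product (suc a) ad prod (add df dg) =
      ad .Φ-⊕ (Deg-product (suc a) ad prod df) (Deg-product (suc a) ad prod dg)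
  Deg-product (suc a) ad prod (var i df) = Deg-product a (Additive-⊗ ad (λ x → lookup x i))
    (λ {u} {w} du dw → ad .Φ-≗ (λ x → ⊗-assoc (lookup x i) (u x) (w x)) (prod (var i du) dw)) df
  Deg-product (suc a) ad prod (resp≗ f≗g df) = ad .Φ-≗ f≗g (Deg-product (suc a) ad prod df)

  -- Sums of Newton polynomials over the field vanish because each one, up to an
  -- invertible factor, is a difference of the next one.
  newton : ℕ → K → K
  newton zero    x = 1𝔽
  newton (suc j) x = newton j x ⊗ (x ⊕ ⊖ ι j)

  newton-var : ∀ j x → newton (suc j) x ⊕ ι j ⊗ newton j x ≡ x ⊗ newton j x
  newton-var j x = begin
    newton j x ⊗ (x ⊕ ⊖ ι j) ⊕ ι j ⊗ newton j x
      ≡⟨ solve 4 (λ b x m i → b :* (x :+ m) :+ i :* b := b :* (x :+ (m :+ i))) refl (newton j x) x (⊖ ι j)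
          (ι j) ⟩
    newton j x ⊗ (x ⊕ (⊖ ι j ⊕ ι j))  ≡⟨ cong (λ z → newton j x ⊗ (x ⊕ z)) (⊖-inverseˡ (ι j)) ⟩
    newton j x ⊗ (x ⊕ 0𝔽)  ≡⟨ cong (newton j x ⊗_) (⊕-identityʳ x) ⟩
    newton j x ⊗ x  ≡⟨ ⊗-comm (newton j x) x ⟩
    x ⊗ newton j x  ∎

  1⊕-shift : ∀ x i → (1𝔽 ⊕ x) ⊕ ⊖ (1𝔽 ⊕ i) ≡ x ⊕ ⊖ i
  1⊕-shift x i = ⊕-cancelʳ (1𝔽 ⊕ i) _ _ (begin
    ((1𝔽 ⊕ x) ⊕ ⊖ (1𝔽 ⊕ i)) ⊕ (1𝔽 ⊕ i)  ≡⟨ ⊕-assoc _ _ _ ⟩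
    (1𝔽 ⊕ x) ⊕ (⊖ (1𝔽 ⊕ i) ⊕ (1𝔽 ⊕ i))  ≡⟨ cong ((1𝔽 ⊕ x) ⊕_) (⊖-inverseˡ (1𝔽 ⊕ i)) ⟩
    (1𝔽 ⊕ x) ⊕ 0𝔽  ≡⟨ cong ((1𝔽 ⊕ x) ⊕_) (⊖-inverseˡ i) ⟨
    (1𝔽 ⊕ x) ⊕ (⊖ i ⊕ i)
      ≡⟨ solve 4 (λ o x m i → (o :+ x) :+ (m :+ i) := (x :+ m) :+ (o :+ i)) refl 1𝔽 x (⊖ i) i ⟩
    (x ⊕ ⊖ i) ⊕ (1𝔽 ⊕ i)  ∎)

  newton-1⊕ : ∀ j x → newton (suc j) (1𝔽 ⊕ x) ≡ (1𝔽 ⊕ x) ⊗ newton j x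
  newton-1⊕ zero x = begin
    1𝔽 ⊗ (1𝔽 ⊕ x ⊕ ⊖ 0𝔽) ≡⟨ cong (λ z → 1𝔽 ⊗ (1𝔽 ⊕ x ⊕ z)) ⊖0≡0 ⟩
    1𝔽 ⊗ (1𝔽 ⊕ x ⊕ 0𝔽)  ≡⟨ cong (1𝔽 ⊗_) (⊕-identityʳ _) ⟩
    1𝔽 ⊗ (1𝔽 ⊕ x)  ≡⟨ ⊗-comm _ _ ⟩
    (1𝔽 ⊕ x) ⊗ 1𝔽  ∎
  newton-1⊕ (suc j) x = begin
    newton (suc j) (1𝔽 ⊕ x) ⊗ (1𝔽 ⊕ x ⊕ ⊖ (1𝔽 ⊕ ι j))  ≡⟨ cong₂ _⊗_ (newton-1⊕ j x) (1⊕-shift x (ι j)) ⟩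
    (1𝔽 ⊕ x) ⊗ newton j x ⊗ (x ⊕ ⊖ ι j)  ≡⟨ ⊗-assoc _ _ _ ⟩
    (1𝔽 ⊕ x) ⊗ (newton j x ⊗ (x ⊕ ⊖ ι j))  ∎

  newton-difference : ∀ j x → newton (suc j) (1𝔽 ⊕ x) ≡ newton (suc j) x ⊕ ι (suc j) ⊗ newton j x
  newton-difference j x = begin
    newton (suc j) (1𝔽 ⊕ x)  ≡⟨ newton-1⊕ j x ⟩
    (1𝔽 ⊕ x) ⊗ newton j x
      ≡⟨ solve 3 (λ o x b → (o :+ x) :* b := x :* b :+ o :* b) refl 1𝔽 x (newton j x) ⟩
    x ⊗ newton j x ⊕ 1𝔽 ⊗ newton j x
      ≡⟨ cong (_⊕ 1𝔽 ⊗ newton j x) (newton-var j x) ⟨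
    newton (suc j) x ⊕ ι j ⊗ newton j x ⊕ 1𝔽 ⊗ newton j x
      ≡⟨ solve 4 (λ c i b o → c :+ i :* b :+ o :* b := c :+ (o :+ i) :* b) refl (newton (suc j) x) (ι j)
          (newton j x) 1𝔽 ⟩
    newton (suc j) x ⊕ ι (suc j) ⊗ newton j x  ∎

  sum-newton : ∀ {j} → suc j < q → sum (newton j) ≡ 0𝔽
  sum-newton {j} j+1<q = ⊗-cancelˡ (ι (suc j)) (ι≢0 (s≤s z≤n) j+1<q)
      (⊕-cancelˡ (sum (newton (suc j))) _ _ (begin
    sum (newton (suc j)) ⊕ ι (suc j) ⊗ sum (newton j)
      ≡⟨ cong (sum (newton (suc j)) ⊕_) (⊗-distribˡ-sum (ι (suc j)) (newton j)) ⟩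
    sum (newton (suc j)) ⊕ sum (λ x → ι (suc j) ⊗ newton j x)  ≡⟨ ∑-distrib-+ (newton (suc j)) _ ⟨
    sum (λ x → newton (suc j) x ⊕ ι (suc j) ⊗ newton j x)  ≡⟨ sum-cong-≗ (newton-difference j) ⟨
    sum (λ x → newton (suc j) (1𝔽 ⊕ x))  ≡⟨ sum-permute (newton (suc j)) shift ⟨
    sum (newton (suc j))  ≡⟨ ⊕-identityʳ _ ⟨
    sum (newton (suc j)) ⊕ 0𝔽
      ≡⟨ cong (sum (newton (suc j)) ⊕_) (⊗-zeroʳ (ι (suc j))) ⟨
    sum (newton (suc j)) ⊕ ι (suc j) ⊗ 0𝔽  ∎))
    where
    shift = permutation (1𝔽 ⊕_) (⊖ 1𝔽 ⊕_)
      (λ x → trans (sym (⊕-assoc _ _ x)) (trans (cong (_⊕ x) (⊖-inverseʳ 1𝔽)) (⊕-identityˡ x)))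
      (λ x → trans (sym (⊕-assoc _ _ x)) (trans (cong (_⊕ x) (⊖-inverseˡ 1𝔽)) (⊕-identityˡ x)))

  Deg-newton : ∀ {n} j → Deg {suc n} j (λ x → newton j (head x))
  Deg-newton zero    = const 1𝔽
  Deg-newton {n} (suc j) = subst (λ d → Deg {suc n} d (λ x → newton (suc j) (head x))) (ℕ.+-comm j 1)
    (resp≗ (λ { (a ∷ x) → refl }) (Deg-⊗ (Deg-newton j) (add (Deg-var zero) (const (⊖ ι j)))))

  -- Expansion in the first coordinate by Newton polynomials instead of powers. Multiplying a term
  -- by the first coordinate gives two such terms by `newton-var`; any other coordinate is absorbed
  -- by g.
  Deg-split : ∀ {n t} {Φ : Func (suc n) → Set} → Additive Φ →
    (∀ j {i g} → j + i ≤ t → Deg i g → Φ (λ x → newton j (head x) ⊗ g (tail x))) →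
    ∀ {f} → Deg t f → Φ f
  Deg-split ad gen (const c) = ad .Φ-≗ (λ x → ⊗-identityˡ c) (gen 0 {0} z≤n (const c))
  Deg-split ad gen (add df dg) = ad .Φ-⊕ (Deg-split ad gen df) (Deg-split ad gen dg)
  Deg-split ad gen (var zero df) = Deg-split (Additive-⊗ ad (λ x → lookup x zero))
    (λ j {i} {g} j+i≤t dg → ad .Φ-≗
      (λ { (a ∷ x) → begin
          newton (suc j) a ⊗ g x ⊕ newton j a ⊗ (ι j ⊗ g x)
            ≡⟨ solve 4 (λ c b i g → c :* g :+ b :* (i :* g) := (c :+ i :* b) :* g) refl (newton (suc j) a)
                (newton j a) (ι j) (g x) ⟩
          (newton (suc j) a ⊕ ι j ⊗ newton j a) ⊗ g x  ≡⟨ cong (_⊗ g x) (newton-var j a) ⟩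
          a ⊗ newton j a ⊗ g x  ≡⟨ ⊗-assoc a (newton j a) (g x) ⟩
          a ⊗ (newton j a ⊗ g x)  ∎ })
      (ad .Φ-⊕ (gen (suc j) (s≤s j+i≤t) dg) (gen j (ℕ.≤-trans j+i≤t (ℕ.n≤1+n _)) (Deg-scale (ι j) dg)))) df
  Deg-split {t = suc t} ad gen (var (suc i) df) = Deg-split (Additive-⊗ ad (λ x → lookup x (suc i)))
    (λ j {i′} {g} j+i≤t dg → ad .Φ-≗
      (λ { (a ∷ x) → solve 3 (λ b y g → b :* (y :* g) := y :* (b :* g)) refl (newton j a) (lookup x i)
          (g x) })
      (gen j (subst (_≤ suc t) (sym (ℕ.+-suc j i′)) (s≤s j+i≤t)) (var i dg))) df
  Deg-split ad gen (resp≗ f≗g df) = ad .Φ-≗ f≗g (Deg-split ad gen df)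

  Additive-E : ∀ {n} (w : Func n) → Additive (λ f → E (λ x → w x ⊗ f x) ≡ 0𝔽)
  Additive-E w .Φ-⊕ {f} {g} p r = begin
    E (λ x → w x ⊗ (f x ⊕ g x))  ≡⟨ E-cong (λ x → ⊗-distribˡ-⊕ (w x) (f x) (g x)) ⟩
    E (λ x → w x ⊗ f x ⊕ w x ⊗ g x)  ≡⟨ E-⊕ (λ x → w x ⊗ f x) (λ x → w x ⊗ g x) ⟩
    E (λ x → w x ⊗ f x) ⊕ E (λ x → w x ⊗ g x) ≡⟨ cong₂ _⊕_ p r ⟩
    0𝔽 ⊕ 0𝔽  ≡⟨ ⊕-identityˡ 0𝔽 ⟩
    0𝔽  ∎
  Additive-E w .Φ-≗ f≗g p = trans (E-cong (λ x → cong (w x ⊗_) (sym (f≗g x)))) p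

  -- In each term of `Deg-split`, either j < q - 1 and the sum over the first coordinate vanishes,
  -- or j ≥ q - 1 and g has low degree in the remaining coordinates, so that induction applies.
  E-low-degree : ∀ {n t} {f : Func n} → t < (q ∸ 1) * n → Deg t f → E f ≡ 0𝔽
  E-low-degree {zero} {t} t<0 df = contradiction (subst (t <_) (ℕ.*-zeroʳ (q ∸ 1)) t<0) λ ()
  E-low-degree {suc n} {t} {f} t< df = trans (E-cong {suc n} (λ x → sym (⊗-identityˡ (f x))))
    (Deg-split (Additive-E (λ _ → 1𝔽)) (λ j {i} {g} j+i≤t dg → begin
      E (λ x → 1𝔽 ⊗ (newton j (head x) ⊗ g (tail x)))
        ≡⟨ E-cong {suc n} (λ x → ⊗-identityˡ (newton j (head x) ⊗ g (tail x))) ⟩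
      E (λ x → newton j (head x) ⊗ g (tail x))  ≡⟨ E-head-tail (newton j) g ⟩
      sum (newton j) ⊗ E g  ≡⟨ zero-factor j i g j+i≤t dg ⟩
      0𝔽  ∎) df)
    where
    zero-factor : ∀ j i g → j + i ≤ t → Deg i g → sum (newton j) ⊗ E g ≡ 0𝔽
    zero-factor j i g j+i≤t dg with suc j ℕ.<? q
    ... | yes j+1<q = trans (cong (_⊗ E g) (sum-newton j+1<q)) (⊗-zeroˡ (E g))
    ... | no  j+1≮q = trans (cong (sum (newton j) ⊗_) (E-low-degree i< dg)) (⊗-zeroʳ _)
      where
      q-1≤j : q ∸ 1 ≤ j
      q-1≤j = ℕ.∸-monoˡ-≤ 1 (ℕ.≮⇒≥ j+1≮q)
      i< : i < (q ∸ 1) * n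
      i< = ℕ.+-cancelˡ-< (q ∸ 1) i _ (ℕ.<-≤-trans
        (ℕ.≤-<-trans (ℕ.≤-trans (ℕ.+-monoˡ-≤ i q-1≤j) j+i≤t) t<)
        (ℕ.≤-reflexive (ℕ.*-suc (q ∸ 1) n)))

-- Duality of Reed-Muller codes.

module Duality {q : ℕ} (𝔽 : PrimeField q) where
  open PrimeField 𝔽
  open Degree 𝔽
  open Solver using (solve; con; _:+_; _:*_; _:=_)
  open ≡-Reasoning

  infix 4 _⊥_
  _⊥_ : ∀ {n} → Func n → ℕ → Set
  f ⊥ t = ∀ {Q} → Deg t Q → E (λ x → f x ⊗ Q x) ≡ 0𝔽

  ⊥-≤ : ∀ {n t t′} {f : Func n} → t ≤ t′ → f ⊥ t′ → f ⊥ t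
  ⊥-≤ t≤t′ f⊥ dQ = f⊥ (Deg-≤ t≤t′ dQ)

  Deg⇒⊥ : ∀ {n d t} {f : Func n} → d + t < (q ∸ 1) * n → Deg d f → f ⊥ t
  Deg⇒⊥ d+t< df dQ = E-low-degree d+t< (Deg-⊗ df dQ)

  -- The product of z - i for 1 ≤ i ≤ m. For m = q - 1 it vanishes at all nonzero elements, so its
  -- multiple `spike` is the function 1 - z^(q - 1).
  deleted : ℕ → K → K
  deleted zero    z = 1𝔽
  deleted (suc m) z = deleted m z ⊗ (z ⊕ ⊖ ι (suc m))

  deleted-0 : ∀ m → m < q → deleted m 0𝔽 ≢ 0𝔽
  deleted-0 zero    _    = 1≢0
  deleted-0 (suc m) m+1<q = ⊗-≢0 (deleted-0 m (ℕ.<-trans (ℕ.n<1+n m) m+1<q))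
    (λ eq → ι≢0 (s≤s z≤n) m+1<q (sym (⊖-≡ eq)))

  deleted-ι : ∀ m {j} → 0 < j → j ≤ m → deleted m (ι j) ≡ 0𝔽
  deleted-ι zero    0<j j≤0 = contradiction (ℕ.<-≤-trans 0<j j≤0) λ ()
  deleted-ι (suc m) {j} 0<j j≤1+m with j ℕ.≟ suc m
  ... | yes refl = trans (cong (deleted m (ι j) ⊗_) (⊖-inverseʳ (ι j))) (⊗-zeroʳ _)
  ... | no  j≢   = trans (cong (_⊗ (ι j ⊕ ⊖ ι (suc m))) (deleted-ι m 0<j (ℕ.≤-pred (ℕ.≤∧≢⇒< j≤1+m j≢))))
      (⊗-zeroˡ _)

  q-1<q : q ∸ 1 < q
  q-1<q = ℕ.≤-reflexive (ℕ.suc-pred q {{ℕ.>-nonZero (ℕ.<-trans (s≤s z≤n) 1<q)}})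

  spike : K → K
  spike z = proj₁ (inverse _ (deleted-0 (q ∸ 1) q-1<q)) ⊗ deleted (q ∸ 1) z

  spike-0 : spike 0𝔽 ≡ 1𝔽
  spike-0 = trans (⊗-comm _ _) (proj₂ (inverse _ (deleted-0 (q ∸ 1) q-1<q)))

  spike-≢0 : ∀ {z} → z ≢ 0𝔽 → spike z ≡ 0𝔽
  spike-≢0 {z} z≢0 with ι-surjective z
  ... | zero  , _     , refl = contradiction refl z≢0
  ... | suc j , j+1<q , refl = trans
    (cong (_ ⊗_) (deleted-ι (q ∸ 1) (s≤s z≤n) (ℕ.∸-monoˡ-≤ 1 j+1<q))) (⊗-zeroʳ _)

  -- Joint degree of a kernel in x and y, kept as a sum of tensors so that each term can be judged
  -- by its degree in y alone.
  data BiDeg {n : ℕ} : ℕ → (Vec K n → Vec K n → K) → Set where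
    tensor : ∀ {D a b u w} → a + b ≤ D → Deg a u → Deg b w → BiDeg D (λ x y → u x ⊗ w y)
    add    : ∀ {D k l} → BiDeg D k → BiDeg D l → BiDeg D (λ x y → k x y ⊕ l x y)
    resp≗  : ∀ {D k l} → (∀ x y → k x y ≡ l x y) → BiDeg D k → BiDeg D l

  BiDeg-≤ : ∀ {n D D′} {k : Vec K n → Vec K n → K} → D ≤ D′ → BiDeg D k → BiDeg D′ k
  BiDeg-≤ D≤D′ (tensor a+b≤D du dw) = tensor (ℕ.≤-trans a+b≤D D≤D′) du dw
  BiDeg-≤ D≤D′ (add bk bl)          = add (BiDeg-≤ D≤D′ bk) (BiDeg-≤ D≤D′ bl)
  BiDeg-≤ D≤D′ (resp≗ k≗l bk)       = resp≗ k≗l (BiDeg-≤ D≤D′ bk)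

  BiDeg-⊗ : ∀ {n C D} {k l : Vec K n → Vec K n → K} →
    BiDeg C k → BiDeg D l → BiDeg (C + D) (λ x y → k x y ⊗ l x y)
  BiDeg-⊗ {l = l} (add {k = k} {k′} bk bk′) bl =
    resp≗ (λ x y → sym (⊗-distribʳ-⊕ (l x y) (k x y) (k′ x y))) (add (BiDeg-⊗ bk bl) (BiDeg-⊗ bk′ bl))
  BiDeg-⊗ {l = l} (resp≗ k≗k′ bk) bl = resp≗ (λ x y → cong (_⊗ l x y) (k≗k′ x y)) (BiDeg-⊗ bk bl)
  BiDeg-⊗ {k = k} bk@(tensor _ _ _) (add {k = l} {l′} bl bl′) =
    resp≗ (λ x y → sym (⊗-distribˡ-⊕ (k x y) (l x y) (l′ x y))) (add (BiDeg-⊗ bk bl) (BiDeg-⊗ bk bl′))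
  BiDeg-⊗ {k = k} bk@(tensor _ _ _) (resp≗ l≗l′ bl) =
    resp≗ (λ x y → cong (k x y ⊗_) (l≗l′ x y)) (BiDeg-⊗ bk bl)
  BiDeg-⊗ {C = C} {D} (tensor {a = a} {b} {u} {w} a+b≤C du dw)
      (tensor {a = a′} {b′} {u′} {w′} a′+b′≤D du′ dw′) =
    resp≗ (λ x y → solve 4 (λ u u′ w w′ → (u :* u′) :* (w :* w′) := (u :* w) :* (u′ :* w′)) refl (u x)
        (u′ x) (w y) (w′ y))
      (tensor (subst (_≤ C + D) (eq a b a′ b′) (ℕ.+-mono-≤ a+b≤C a′+b′≤D)) (Deg-⊗ du du′) (Deg-⊗ dw dw′))
    where
    eq : ∀ a b a′ b′ → (a + b) + (a′ + b′) ≡ (a + a′) + (b + b′)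
    eq = +-*-Solver.solve 4 (λ a b a′ b′ → (a ⊞ b) ⊞ (a′ ⊞ b′) +-*-Solver.:= (a ⊞ a′) ⊞ (b ⊞ b′)) refl
      where _⊞_ = +-*-Solver._:+_

  BiDeg-const : ∀ {n D} c → BiDeg {n} D (λ _ _ → c)
  BiDeg-const c = resp≗ (λ _ _ → ⊗-identityʳ c) (tensor {a = 0} {0} z≤n (const c) (const 1𝔽))

  BiDeg-deleted : ∀ {n} m i → BiDeg {n} m (λ x y → deleted m (lookup x i ⊕ ⊖ lookup y i))
  BiDeg-deleted     zero    i = BiDeg-const 1𝔽
  BiDeg-deleted {n} (suc m) i = BiDeg-≤ (ℕ.≤-reflexive (ℕ.+-comm m 1)) (BiDeg-⊗ (BiDeg-deleted m i)
    (add (add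
      (resp≗ (λ x y → ⊗-identityʳ (lookup x i)) (tensor ℕ.≤-refl (Deg-var i) (const {d = 0} 1𝔽)))
      (resp≗ (λ x y → -1⊗x≡⊖x (lookup y i)) (tensor ℕ.≤-refl (const {d = 0} (⊖ 1𝔽)) (Deg-var i))))
      (BiDeg-const (⊖ ι (suc m)))))

  BiDeg-spike : ∀ {n} i → BiDeg {n} (q ∸ 1) (λ x y → spike (lookup x i ⊕ ⊖ lookup y i))
  BiDeg-spike i = BiDeg-⊗ (BiDeg-const {D = 0} _) (BiDeg-deleted (q ∸ 1) i)

  BiDeg-tail : ∀ {n D} {k : Vec K n → Vec K n → K} →
    BiDeg D k → BiDeg D (λ x y → k (tail x) (tail y))
  BiDeg-tail (tensor a+b≤D du dw) = tensor a+b≤D (Deg-tail du) (Deg-tail dw)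
  BiDeg-tail (add bk bl)          = add (BiDeg-tail bk) (BiDeg-tail bl)
  BiDeg-tail (resp≗ k≗l bk)       = resp≗ (λ x y → k≗l (tail x) (tail y)) (BiDeg-tail bk)

  δ : ∀ {n} → Vec K n → Vec K n → K
  δ []      []      = 1𝔽
  δ (a ∷ x) (b ∷ y) = spike (a ⊕ ⊖ b) ⊗ δ x y

  -- The delta depends only on x - y, through one `spike` per coordinate, so its joint degree is (q
  -- - 1) n and not twice that. The exact complementarity of degrees in the duality rests on this.
  BiDeg-δ : ∀ n → BiDeg {n} ((q ∸ 1) * n) δ
  BiDeg-δ zero    = resp≗ (λ { [] [] → refl }) (BiDeg-const 1𝔽)
  BiDeg-δ (suc n) = subst (λ D → BiDeg {suc n} D δ) (sym (ℕ.*-suc (q ∸ 1) n))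
    (resp≗ (λ { (a ∷ x) (b ∷ y) → refl }) (BiDeg-⊗ (BiDeg-spike zero) (BiDeg-tail (BiDeg-δ n))))

  δ≢0⇒≡ : ∀ {n} (x y : Vec K n) → δ x y ≢ 0𝔽 → x ≡ y
  δ≢0⇒≡ []      []      _   = refl
  δ≢0⇒≡ (a ∷ x) (b ∷ y) δ≢0 with a Fin.≟ b
  ... | yes a≡b = cong₂ _∷_ a≡b (δ≢0⇒≡ x y λ eq → δ≢0 (trans (cong (_ ⊗_) eq) (⊗-zeroʳ _)))
  ... | no  a≢b = contradiction (trans (cong (_⊗ δ x y) (spike-≢0 (a≢b ∘ ⊖-≡))) (⊗-zeroˡ _)) δ≢0

  E-δ : ∀ {n} (g : Func n) x → E (λ y → g y ⊗ δ x y) ≡ g x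
  E-δ g []      = ⊗-identityʳ (g [])
  E-δ g (a ∷ x) = begin
    sum (λ b → E (λ y → g (b ∷ y) ⊗ (spike (a ⊕ ⊖ b) ⊗ δ x y)))  ≡⟨ sum-cong-≗ inner ⟩
    sum (λ b → spike (a ⊕ ⊖ b) ⊗ g (b ∷ x))  ≡⟨ sum-single a off-diagonal ⟩
    spike (a ⊕ ⊖ a) ⊗ g (a ∷ x)
      ≡⟨ cong (λ z → spike z ⊗ g (a ∷ x)) (⊖-inverseʳ a) ⟩
    spike 0𝔽 ⊗ g (a ∷ x)  ≡⟨ cong (_⊗ g (a ∷ x)) spike-0 ⟩
    1𝔽 ⊗ g (a ∷ x)  ≡⟨ ⊗-identityˡ _ ⟩
    g (a ∷ x)  ∎
    where
    inner : ∀ b → E (λ y → g (b ∷ y) ⊗ (spike (a ⊕ ⊖ b) ⊗ δ x y)) ≡ spike (a ⊕ ⊖ b) ⊗ g (b ∷ x)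
    inner b = begin
      E (λ y → g (b ∷ y) ⊗ (spike (a ⊕ ⊖ b) ⊗ δ x y))
        ≡⟨ E-cong (λ y → solve 3 (λ g s d → g :* (s :* d) := s :* (g :* d)) refl (g (b ∷ y))
            (spike (a ⊕ ⊖ b)) (δ x y)) ⟩
      E (λ y → spike (a ⊕ ⊖ b) ⊗ (g (b ∷ y) ⊗ δ x y))  ≡⟨ E-⊗ (spike (a ⊕ ⊖ b)) (λ y → g (b ∷ y) ⊗ δ x y) ⟩
      spike (a ⊕ ⊖ b) ⊗ E (λ y → g (b ∷ y) ⊗ δ x y)  ≡⟨ cong (spike (a ⊕ ⊖ b) ⊗_)
          (E-δ (λ y → g (b ∷ y)) x) ⟩
      spike (a ⊕ ⊖ b) ⊗ g (b ∷ x)  ∎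
    off-diagonal : ∀ b → b ≢ a → spike (a ⊕ ⊖ b) ⊗ g (b ∷ x) ≡ 0𝔽
    off-diagonal b b≢a = trans (cong (_⊗ g (b ∷ x)) (spike-≢0 λ eq → b≢a (sym (⊖-≡ eq)))) (⊗-zeroˡ _)

  -- A term u(x) w(y) contributes nothing if deg w ≤ s, and otherwise deg u ≤ d.
  ⊥⇒Deg-kernel : ∀ {n s d D} {k : Vec K n → Vec K n → K} {g : Func n} → D ≤ suc (s + d) → BiDeg D k →
    g ⊥ s → Deg d (λ x → E (λ y → g y ⊗ k x y))
  ⊥⇒Deg-kernel {s = s} {d} {g = g} D≤ (tensor {a = a} {b} {u} {w} a+b≤D du dw) g⊥ with b ℕ.≤? s
  ... | yes b≤s = resp≗ (λ x → sym (begin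
    E (λ y → g y ⊗ (u x ⊗ w y))
      ≡⟨ E-cong (λ y → solve 3 (λ g u w → g :* (u :* w) := u :* (g :* w)) refl (g y) (u x) (w y)) ⟩
    E (λ y → u x ⊗ (g y ⊗ w y))  ≡⟨ E-⊗ (u x) (λ y → g y ⊗ w y) ⟩
    u x ⊗ E (λ y → g y ⊗ w y)  ≡⟨ cong (u x ⊗_) (g⊥ (Deg-≤ b≤s dw)) ⟩
    u x ⊗ 0𝔽  ≡⟨ ⊗-zeroʳ (u x) ⟩
    0𝔽  ∎)) (const 0𝔽)
  ... | no b≰s = resp≗ (λ x → sym (begin
    E (λ y → g y ⊗ (u x ⊗ w y))
      ≡⟨ E-cong (λ y → solve 3 (λ g u w → g :* (u :* w) := u :* (g :* w)) refl (g y) (u x) (w y)) ⟩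
    E (λ y → u x ⊗ (g y ⊗ w y))  ≡⟨ E-⊗ (u x) (λ y → g y ⊗ w y) ⟩
    u x ⊗ E (λ y → g y ⊗ w y)  ≡⟨ ⊗-comm _ _ ⟩
    E (λ y → g y ⊗ w y) ⊗ u x  ∎)) (Deg-scale _ (Deg-≤ a≤d du))
    where
    a≤d : a ≤ d
    a≤d = ℕ.+-cancelʳ-≤ (suc s) a d (ℕ.≤-trans (ℕ.+-monoʳ-≤ a (ℕ.≰⇒> b≰s))
      (ℕ.≤-trans a+b≤D (ℕ.≤-trans D≤ (ℕ.≤-reflexive (ℕ.+-comm (suc s) d)))))
  ⊥⇒Deg-kernel {g = g} D≤ (add {k = k} {l} bk bl) g⊥ = resp≗
    (λ x → sym (trans (E-cong (λ y → ⊗-distribˡ-⊕ (g y) (k x y) (l x y)))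
        (E-⊕ (λ y → g y ⊗ k x y) (λ y → g y ⊗ l x y))))
    (add (⊥⇒Deg-kernel D≤ bk g⊥) (⊥⇒Deg-kernel D≤ bl g⊥))
  ⊥⇒Deg-kernel {g = g} D≤ (resp≗ k≗l bk) g⊥ =
    resp≗ (λ x → E-cong (λ y → cong (g y ⊗_) (k≗l x y))) (⊥⇒Deg-kernel D≤ bk g⊥)

  -- By `E-δ`, pairing with `δ` reproduces g; its joint degree leaves degree at most d in x to every
  -- term that g does not annihilate in y.
  ⊥⇒Deg : ∀ {n s d} {g : Func n} → (q ∸ 1) * n ≤ suc (s + d) → g ⊥ s → Deg d g
  ⊥⇒Deg {n} {g = g} D≤ g⊥ = resp≗ (E-δ g) (⊥⇒Deg-kernel D≤ (BiDeg-δ n) g⊥)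

  Deg-spike : ∀ {n} i b → Deg {n} (q ∸ 1) (λ x → spike (lookup x i ⊕ ⊖ b))
  Deg-spike i b = Deg-scale _ (go (q ∸ 1))
    where
    go : ∀ m → Deg m (λ x → deleted m (lookup x i ⊕ ⊖ b))
    go zero    = const 1𝔽
    go (suc m) = Deg-≤ (ℕ.≤-reflexive (ℕ.+-comm m 1))
      (Deg-⊗ (go m) (add (add (Deg-var i) (const (⊖ b))) (const (⊖ ι (suc m)))))

-- Finite generation and the Fredholm alternative.

all-or : ∀ {A C : Set} {P : A → Set} xs → (∀ {x} → x ∈ xs → P x ⊎ C) → All P xs ⊎ C
all-or []       dec = inj₁ []
all-or (x ∷ xs) dec with dec (here refl) | all-or xs (dec ∘ there)
... | inj₁ p | inj₁ ps = inj₁ (p ∷ ps)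
... | inj₂ c | _       = inj₂ c
... | inj₁ _ | inj₂ c  = inj₂ c

module Alternative {q : ℕ} (𝔽 : PrimeField q) where
  open PrimeField 𝔽
  open Degree 𝔽
  open Additive
  open Duality 𝔽
  open Solver using (solve; con; _:+_; _:*_; _:=_)
  open ≡-Reasoning

  -- Words in the coordinates, repetitions allowed. The list only has to be finite and spanning:
  -- statements about all polynomials of bounded degree then become decidable.
  generators : ∀ n → ℕ → List (Func n)
  generators n zero    = (λ _ → 1𝔽) ∷ []
  generators n (suc d) = (λ _ → 1𝔽) ∷ concatMap (λ i → map (λ g x → lookup x i ⊗ g x) (generators n d))
      (allFin n)

  1∈generators : ∀ {n} d → (λ _ → 1𝔽) ∈ generators n d
  1∈generators zero    = here refl
  1∈generators (suc d) = here refl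

  var∈generators : ∀ {n d g} i → g ∈ generators n d → (λ x → lookup x i ⊗ g x) ∈ generators n (suc d)
  var∈generators i g∈ = there (∈-concatMap⁺ _ (Any.map (λ { refl → ∈-map⁺ _ g∈ }) (∈-allFin i)))

  Deg-generators : ∀ n d → All (Deg d) (generators n d)
  Deg-generators n zero    = const 1𝔽 ∷ []
  Deg-generators n (suc d) = const 1𝔽 ∷
    All.concat⁺ (All.map⁺ (All.universal (λ i → All.map⁺ (All.map (var i) (Deg-generators n d)))
        (allFin n)))

  Deg-span : ∀ {n d} {Φ : Func n → Set} → Additive Φ →
    (∀ c {g} → g ∈ generators n d → Φ (λ x → c ⊗ g x)) → ∀ {f} → Deg d f → Φ f
  Deg-span {d = d} ad gen (const c) = ad .Φ-≗ (λ _ → ⊗-identityʳ c) (gen c (1∈generators d))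
  Deg-span ad gen (add df dg)   = ad .Φ-⊕ (Deg-span ad gen df) (Deg-span ad gen dg)
  Deg-span ad gen (var i df)    = Deg-span (Additive-⊗ ad (λ x → lookup x i))
    (λ c {g} g∈ → ad .Φ-≗ (λ x → solve 3 (λ c y g → c :* (y :* g) := y :* (c :* g)) refl c (lookup x i)
        (g x))
      (gen c (var∈generators i g∈))) df
  Deg-span ad gen (resp≗ f≗g df) = ad .Φ-≗ f≗g (Deg-span ad gen df)

  E-⊗ʳ : ∀ {n} c (f g : Func n) → E (λ x → f x ⊗ (c ⊗ g x)) ≡ c ⊗ E (λ x → f x ⊗ g x)
  E-⊗ʳ c f g = trans (E-cong λ x → solve 3 (λ f c g → f :* (c :* g) := c :* (f :* g)) refl (f x) c (g x))
    (E-⊗ c (λ x → f x ⊗ g x))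

  _⊥̸_ : ∀ {n} → Func n → ℕ → Set
  f ⊥̸ t = ∃[ Q ] Deg t Q × E (λ x → f x ⊗ Q x) ≢ 0𝔽

  generators⇒⊥ : ∀ {n t} {f : Func n} → All (λ g → E (λ x → f x ⊗ g x) ≡ 0𝔽) (generators n t) → f ⊥ t
  generators⇒⊥ {f = f} f⊥ = Deg-span (Additive-E f) λ c {g} g∈ →
    trans (E-⊗ʳ c f g) (trans (cong (c ⊗_) (All.lookup f⊥ g∈)) (⊗-zeroʳ c))

  ⊥? : ∀ {n} (f : Func n) t → f ⊥ t ⊎ f ⊥̸ t
  ⊥? {n} f t with all-or (generators n t) test
    where
    test : ∀ {g} → g ∈ generators n t → E (λ x → f x ⊗ g x) ≡ 0𝔽 ⊎ f ⊥̸ t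
    test {g} g∈ with E (λ x → f x ⊗ g x) Fin.≟ 0𝔽
    ... | yes fg≡0 = inj₁ fg≡0
    ... | no  fg≢0 = inj₂ (g , All.lookup (Deg-generators n t) g∈ , fg≢0)
  ... | inj₁ f⊥ = inj₁ (generators⇒⊥ f⊥)
  ... | inj₂ f⊥̸ = inj₂ f⊥̸

  Additive-⊥ : ∀ {n} (h : Func n) m → Additive (λ P → (λ x → h x ⊗ P x) ⊥ m)
  Additive-⊥ h m .Φ-⊕ {f} {g} hf⊥ hg⊥ {Q} dQ = begin
    E (λ x → h x ⊗ (f x ⊕ g x) ⊗ Q x)
      ≡⟨ E-cong (λ x → solve 4 (λ h f g Q → h :* (f :+ g) :* Q := h :* f :* Q :+ h :* g :* Q) refl (h x)
          (f x) (g x) (Q x)) ⟩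
    E (λ x → h x ⊗ f x ⊗ Q x ⊕ h x ⊗ g x ⊗ Q x)
      ≡⟨ E-⊕ (λ x → h x ⊗ f x ⊗ Q x) (λ x → h x ⊗ g x ⊗ Q x) ⟩
    E (λ x → h x ⊗ f x ⊗ Q x) ⊕ E (λ x → h x ⊗ g x ⊗ Q x) ≡⟨ cong₂ _⊕_ (hf⊥ dQ) (hg⊥ dQ) ⟩
    0𝔽 ⊕ 0𝔽  ≡⟨ ⊕-identityˡ 0𝔽 ⟩
    0𝔽  ∎
  Additive-⊥ h m .Φ-≗ f≗g hf⊥ {Q} dQ =
      trans (E-cong λ x → cong (λ z → h x ⊗ z ⊗ Q x) (sym (f≗g x))) (hf⊥ dQ)

  -- If h P were orthogonal to degree m for every generator P, it would be so for every P of degree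
  -- e, and h would annihilate the products that span degree e + m.
  ⊥̸-product : ∀ {n} e {m} {h : Func n} → h ⊥̸ (e + m) → ∃[ P ] Deg e P × (λ x → h x ⊗ P x) ⊥̸ m
  ⊥̸-product {n} e {m} {h} (Q , dQ , hQ≢0) with all-or (generators n e) test
    where
    test : ∀ {P} → P ∈ generators n e → (λ x → h x ⊗ P x) ⊥ m ⊎ ∃[ P ] Deg e P × (λ x → h x ⊗ P x) ⊥̸ m
    test {P} P∈ with ⊥? (λ x → h x ⊗ P x) m
    ... | inj₁ hP⊥ = inj₁ hP⊥
    ... | inj₂ hP⊥̸ = inj₂ (P , All.lookup (Deg-generators n e) P∈ , hP⊥̸)
  ... | inj₂ found = found
  ... | inj₁ all⊥ = contradiction (Deg-product e (Additive-E h) (λ {u} {w} du dw →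
          trans (E-cong (λ x → sym (⊗-assoc (h x) (u x) (w x)))) (⊥u du dw)) dQ) hQ≢0
    where
    ⊥u : ∀ {u} → Deg e u → (λ x → h x ⊗ u x) ⊥ m
    ⊥u = Deg-span (Additive-⊥ h m) λ c {P} P∈ {W} dW → begin
      E (λ x → h x ⊗ (c ⊗ P x) ⊗ W x)
        ≡⟨ E-cong (λ x → solve 4 (λ h c p w → h :* (c :* p) :* w := c :* (h :* p :* w)) refl (h x) c (P x)
            (W x)) ⟩
      E (λ x → c ⊗ (h x ⊗ P x ⊗ W x))  ≡⟨ E-⊗ c (λ x → h x ⊗ P x ⊗ W x) ⟩
      c ⊗ E (λ x → h x ⊗ P x ⊗ W x)  ≡⟨ cong (c ⊗_) (All.lookup all⊥ P∈ dW) ⟩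
      c ⊗ 0𝔽  ≡⟨ ⊗-zeroʳ c ⟩
      0𝔽  ∎

  ⟪_∣_∣_⟫ : ∀ {n} → Func n → Func n → Func n → K
  ⟪ f ∣ P ∣ Q ⟫ = E λ x → f x ⊗ (P x ⊗ Q x)

  ⟪⟫-comm : ∀ {n} (f P Q : Func n) → ⟪ f ∣ P ∣ Q ⟫ ≡ ⟪ f ∣ Q ∣ P ⟫
  ⟪⟫-comm f P Q = E-cong λ x → cong (f x ⊗_) (⊗-comm (P x) (Q x))

  ⟪⟫-⊕ʳ : ∀ {n} (f P Q Q′ : Func n) → ⟪ f ∣ P ∣ (λ x → Q x ⊕ Q′ x) ⟫ ≡ ⟪ f ∣ P ∣ Q ⟫ ⊕ ⟪ f ∣ P ∣ Q′ ⟫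
  ⟪⟫-⊕ʳ f P Q Q′ = trans
    (E-cong λ x → solve 4 (λ f p q r → f :* (p :* (q :+ r)) := f :* (p :* q) :+ f :* (p :* r)) refl (f x)
        (P x) (Q x) (Q′ x))
    (E-⊕ (λ x → f x ⊗ (P x ⊗ Q x)) (λ x → f x ⊗ (P x ⊗ Q′ x)))

  ⟪⟫-⊗ʳ : ∀ {n} (f P : Func n) c Q → ⟪ f ∣ P ∣ (λ x → c ⊗ Q x) ⟫ ≡ c ⊗ ⟪ f ∣ P ∣ Q ⟫
  ⟪⟫-⊗ʳ f P c Q = trans
    (E-cong λ x → solve 4 (λ f p c q → f :* (p :* (c :* q)) := c :* (f :* (p :* q))) refl (f x) (P x) c
        (Q x))
    (E-⊗ c (λ x → f x ⊗ (P x ⊗ Q x)))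

  ⟪⟫-⊕ˡ : ∀ {n} (f P P′ Q : Func n) → ⟪ f ∣ (λ x → P x ⊕ P′ x) ∣ Q ⟫ ≡ ⟪ f ∣ P ∣ Q ⟫ ⊕ ⟪ f ∣ P′ ∣ Q ⟫
  ⟪⟫-⊕ˡ f P P′ Q = trans (⟪⟫-comm f _ Q)
      (trans (⟪⟫-⊕ʳ f Q P P′) (cong₂ _⊕_ (⟪⟫-comm f Q P) (⟪⟫-comm f Q P′)))

  ⟪⟫-⊗ˡ : ∀ {n} (f : Func n) c (P Q : Func n) → ⟪ f ∣ (λ x → c ⊗ P x) ∣ Q ⟫ ≡ c ⊗ ⟪ f ∣ P ∣ Q ⟫
  ⟪⟫-⊗ˡ f c P Q = trans (⟪⟫-comm f _ Q) (trans (⟪⟫-⊗ʳ f Q c P) (cong (c ⊗_) (⟪⟫-comm f Q P)))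

  ⟪⟫-congˡ : ∀ {n} (f : Func n) {P P′} (Q : Func n) → P ≗ P′ → ⟪ f ∣ P ∣ Q ⟫ ≡ ⟪ f ∣ P′ ∣ Q ⟫
  ⟪⟫-congˡ f Q P≗P′ = E-cong λ x → cong (λ z → f x ⊗ (z ⊗ Q x)) (P≗P′ x)

  ⟪⟫-congʳ : ∀ {n} (f P : Func n) {Q Q′} → Q ≗ Q′ → ⟪ f ∣ P ∣ Q ⟫ ≡ ⟪ f ∣ P ∣ Q′ ⟫
  ⟪⟫-congʳ f P Q≗Q′ = E-cong λ x → cong (λ z → f x ⊗ (P x ⊗ z)) (Q≗Q′ x)

  ⟪⟫-shift : ∀ {n} (f P Q W : Func n) → ⟪ f ∣ (λ x → W x ⊗ P x) ∣ Q ⟫ ≡ ⟪ f ∣ P ∣ (λ x → W x ⊗ Q x) ⟫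
  ⟪⟫-shift f P Q W = E-cong λ x →
    solve 4 (λ f w p q → f :* ((w :* p) :* q) := f :* (p :* (w :* q))) refl (f x) (W x) (P x) (Q x)

  ⟪⟫-zeroʳ : ∀ {n} (f P : Func n) {Q} → (∀ x → Q x ≡ 0𝔽) → ⟪ f ∣ P ∣ Q ⟫ ≡ 0𝔽
  ⟪⟫-zeroʳ f P Q≡0 = E-0 λ x → trans (cong (λ z → f x ⊗ (P x ⊗ z)) (Q≡0 x))
      (trans (cong (f x ⊗_) (⊗-zeroʳ (P x))) (⊗-zeroʳ (f x)))

  infix 4 _≈_[_,_]
  _≈_[_,_] : ∀ {n} → Func n → Func n → Func n → ℕ → Set
  P ≈ P′ [ f , t ] = ∀ {Q} → Deg t Q → ⟪ f ∣ P ∣ Q ⟫ ≡ ⟪ f ∣ P′ ∣ Q ⟫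

  cancel-against : ∀ {a b} → b ≢ 0𝔽 → ∃[ c ] a ⊕ c ⊗ b ≡ 0𝔽
  cancel-against {a} {b} b≢0 with b′ , bb′≡1 ← inverse b b≢0 = ⊖ a ⊗ b′ , (begin
    a ⊕ ⊖ a ⊗ b′ ⊗ b
      ≡⟨ cong (a ⊕_) (trans (⊗-assoc (⊖ a) b′ b) (cong (⊖ a ⊗_) (trans (⊗-comm b′ b) bb′≡1))) ⟩
    a ⊕ ⊖ a ⊗ 1𝔽  ≡⟨ cong (a ⊕_) (⊗-identityʳ (⊖ a)) ⟩
    a ⊕ ⊖ a  ≡⟨ ⊖-inverseʳ a ⟩
    0𝔽  ∎)

  -- Gaussian elimination on `ws`. A test function Q separating v from the tail of `ws` either
  -- annihilates the head w as well, or serves as a pivot: v is corrected by a multiple of w, and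
  -- test functions by multiples of Q.
  fredholm : ∀ {n} (f : Func n) {a} t {ws : List (Func n)} → All (Deg a) ws → ∀ v →
    (∃[ u ] Deg a u × v ≈ u [ f , t ]) ⊎
    (∃[ Q ] Deg t Q × All (λ w → ⟪ f ∣ w ∣ Q ⟫ ≡ 0𝔽) ws × ⟪ f ∣ v ∣ Q ⟫ ≢ 0𝔽)
  fredholm f t [] v with ⊥? (λ x → f x ⊗ v x) t
  ... | inj₁ fv⊥ = inj₁ ((λ _ → 0𝔽) , const 0𝔽 , λ {Q} dQ → trans
          (trans (E-cong λ x → sym (⊗-assoc (f x) (v x) (Q x))) (fv⊥ dQ))
          (sym (trans (⟪⟫-comm f _ Q) (⟪⟫-zeroʳ f Q λ _ → refl))))
  ... | inj₂ (Q , dQ , fvQ≢0) = inj₂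
      (Q , dQ , [] , λ eq → fvQ≢0 (trans (E-cong λ x → ⊗-assoc (f x) (v x) (Q x)) eq))
  fredholm f t (dw ∷ dws) v with fredholm f t dws v
  fredholm f t (dw ∷ dws) v | inj₁ found = inj₁ found
  fredholm f t {w ∷ ws} (dw ∷ dws) v | inj₂ (Q , dQ , ws⊥Q , vQ≢0) with ⟪ f ∣ w ∣ Q ⟫ Fin.≟ 0𝔽
  ... | yes wQ≡0 = inj₂ (Q , dQ , wQ≡0 ∷ ws⊥Q , vQ≢0)
  -- `c` makes v + c w orthogonal to Q, so that adding multiples of Q to a test function no longer
  -- affects its pairing with v + c w.
  ... | no  wQ≢0 with c , v+cw≡0 ← cancel-against {⟪ f ∣ v ∣ Q ⟫} wQ≢0
                 with fredholm f t dws (λ x → v x ⊕ c ⊗ w x)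
  ...   | inj₁ (u , du , v′≈u) = inj₁ (u′ , add du (Deg-scale (⊖ c) dw) , λ {R} dR → begin
            ⟪ f ∣ v ∣ R ⟫
              ≡⟨ ⟪⟫-congˡ f R (λ x → sym (undo c (v x) (w x))) ⟩
            ⟪ f ∣ (λ x → (v x ⊕ c ⊗ w x) ⊕ ⊖ c ⊗ w x) ∣ R ⟫
              ≡⟨ ⟪⟫-⊕ˡ f (λ x → v x ⊕ c ⊗ w x) (λ x → ⊖ c ⊗ w x) R ⟩
            ⟪ f ∣ (λ x → v x ⊕ c ⊗ w x) ∣ R ⟫ ⊕ ⟪ f ∣ (λ x → ⊖ c ⊗ w x) ∣ R ⟫ ≡⟨ cong (_⊕ _) (v′≈u dR) ⟩
            ⟪ f ∣ u ∣ R ⟫ ⊕ ⟪ f ∣ (λ x → ⊖ c ⊗ w x) ∣ R ⟫  ≡⟨ ⟪⟫-⊕ˡ f u (λ x → ⊖ c ⊗ w x) R ⟨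
            ⟪ f ∣ u′ ∣ R ⟫  ∎)
          where
          u′ = λ x → u x ⊕ ⊖ c ⊗ w x
          undo : ∀ c a b → (a ⊕ c ⊗ b) ⊕ ⊖ c ⊗ b ≡ a
          undo c a b = begin
            (a ⊕ c ⊗ b) ⊕ ⊖ c ⊗ b
              ≡⟨ solve 4 (λ a c b m → (a :+ c :* b) :+ m :* b := a :+ (c :+ m) :* b) refl a c b (⊖ c) ⟩
            a ⊕ (c ⊕ ⊖ c) ⊗ b  ≡⟨ cong (λ z → a ⊕ z ⊗ b) (⊖-inverseʳ c) ⟩
            a ⊕ 0𝔽 ⊗ b  ≡⟨ cong (a ⊕_) (⊗-zeroˡ b) ⟩
            a ⊕ 0𝔽  ≡⟨ ⊕-identityʳ a ⟩
            a  ∎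
  -- `e` makes R + e Q orthogonal to w. Its pairing with v then equals the one with v + c w, which
  -- is that of R and hence nonzero.
  ...   | inj₂ (R , dR , ws⊥R , v′R≢0) with e , wR+ewQ≡0 ← cancel-against {⟪ f ∣ w ∣ R ⟫} wQ≢0 =
          inj₂ (R′ , add dR (Deg-scale e dQ) , w⊥R′ ∷ All.zipWith (λ { {w′} (p , r) → both w′ p r })
              (ws⊥R , ws⊥Q) , λ vR′≡0 → v′R≢0 (begin
            ⟪ f ∣ v′ ∣ R ⟫  ≡⟨ ⊕-identityʳ _ ⟨
            ⟪ f ∣ v′ ∣ R ⟫ ⊕ 0𝔽
              ≡⟨ cong (⟪ f ∣ v′ ∣ R ⟫ ⊕_) (trans (cong (e ⊗_) (expandˡ Q))
                  (trans (cong (e ⊗_) v+cw≡0) (⊗-zeroʳ e))) ⟨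
            ⟪ f ∣ v′ ∣ R ⟫ ⊕ e ⊗ ⟪ f ∣ v′ ∣ Q ⟫  ≡⟨ expandʳ v′ ⟨
            ⟪ f ∣ v′ ∣ R′ ⟫  ≡⟨ expandˡ R′ ⟩
            ⟪ f ∣ v ∣ R′ ⟫ ⊕ c ⊗ ⟪ f ∣ w ∣ R′ ⟫  ≡⟨ cong₂ (λ y z → y ⊕ c ⊗ z) vR′≡0 w⊥R′ ⟩
            0𝔽 ⊕ c ⊗ 0𝔽  ≡⟨ trans (⊕-identityˡ _) (⊗-zeroʳ c) ⟩
            0𝔽  ∎))
          where
          R′ v′ : Func _
          R′ x = R x ⊕ e ⊗ Q x
          v′ x = v x ⊕ c ⊗ w x
          expandʳ : ∀ w′ → ⟪ f ∣ w′ ∣ R′ ⟫ ≡ ⟪ f ∣ w′ ∣ R ⟫ ⊕ e ⊗ ⟪ f ∣ w′ ∣ Q ⟫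
          expandʳ w′ = trans (⟪⟫-⊕ʳ f w′ R (λ x → e ⊗ Q x)) (cong (⟪ f ∣ w′ ∣ R ⟫ ⊕_) (⟪⟫-⊗ʳ f w′ e Q))
          expandˡ : ∀ S → ⟪ f ∣ v′ ∣ S ⟫ ≡ ⟪ f ∣ v ∣ S ⟫ ⊕ c ⊗ ⟪ f ∣ w ∣ S ⟫
          expandˡ S = trans (⟪⟫-⊕ˡ f v (λ x → c ⊗ w x) S) (cong (⟪ f ∣ v ∣ S ⟫ ⊕_) (⟪⟫-⊗ˡ f c w S))
          w⊥R′ : ⟪ f ∣ w ∣ R′ ⟫ ≡ 0𝔽
          w⊥R′ = trans (expandʳ w) wR+ewQ≡0
          both : ∀ w′ → ⟪ f ∣ w′ ∣ R ⟫ ≡ 0𝔽 → ⟪ f ∣ w′ ∣ Q ⟫ ≡ 0𝔽 → ⟪ f ∣ w′ ∣ R′ ⟫ ≡ 0𝔽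
          both w′ p r = trans (expandʳ w′)
              (trans (cong₂ (λ y z → y ⊕ e ⊗ z) p r) (trans (⊕-identityˡ _) (⊗-zeroʳ e)))

  Additive-reducible : ∀ {n} (f : Func n) a t → Additive (λ P → ∃[ P′ ] Deg a P′ × P ≈ P′ [ f , t ])
  Additive-reducible f a t .Φ-⊕ {P} {R} (P′ , dP′ , P≈P′) (R′ , dR′ , R≈R′) =
      (λ x → P′ x ⊕ R′ x) , add dP′ dR′ , λ {Q} dQ →
    trans (⟪⟫-⊕ˡ f P R Q) (trans (cong₂ _⊕_ (P≈P′ dQ) (R≈R′ dQ)) (sym (⟪⟫-⊕ˡ f P′ R′ Q)))
  Additive-reducible f a t .Φ-≗ P≗R (P′ , dP′ , P≈P′) =
    P′ , dP′ , λ {Q} dQ → trans (⟪⟫-congˡ f Q (λ x → sym (P≗R x))) (P≈P′ dQ)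

  -- Modulo the form against degree t, degree a + 1 adds nothing to degree a. This is the flatness
  -- condition on moment matrices; it lets multiplication by a coordinate act on polynomials of
  -- degree at most a.
  Flat : ∀ {n} → Func n → ℕ → ℕ → Set
  Flat f a t = ∀ {P} → Deg (suc a) P → ∃[ P′ ] Deg a P′ × P ≈ P′ [ f , t ]

  -- `fredholm` is applied to each generator of degree a + 1 against those of degree a. A single
  -- failure yields Q; if there is none, linearity gives flatness.
  flat-or-leading : ∀ {n} (f : Func n) a t →
    Flat f a t ⊎ (∃[ Q ] Deg t Q × (λ x → f x ⊗ Q x) ⊥ a × (λ x → f x ⊗ Q x) ⊥̸ suc a)
  flat-or-leading {n} f a t with all-or (generators n (suc a)) test
    where
    test : ∀ {v} → v ∈ generators n (suc a) →
      (∃[ u ] Deg a u × v ≈ u [ f , t ]) ⊎ (∃[ Q ] Deg t Q × (λ x → f x ⊗ Q x) ⊥ a × (λ x → f x ⊗ Q x) ⊥̸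
          suc a)
    test {v} v∈ with fredholm f t (Deg-generators n a) v
    ... | inj₁ found = inj₁ found
    ... | inj₂ (Q , dQ , ws⊥Q , vQ≢0) = inj₂ (Q , dQ ,
            generators⇒⊥ (All.map (λ {w} wQ≡0 → trans (swap w) wQ≡0) ws⊥Q) ,
            v , All.lookup (Deg-generators n (suc a)) v∈ , λ eq → vQ≢0 (trans (sym (swap v)) eq))
      where
      swap : ∀ w → E (λ x → f x ⊗ Q x ⊗ w x) ≡ ⟪ f ∣ w ∣ Q ⟫
      swap w = E-cong λ x → solve 3 (λ f q w → f :* q :* w := f :* (w :* q)) refl (f x) (Q x) (w x)
  ... | inj₂ found = inj₂ found
  ... | inj₁ flat  = inj₁ (Deg-span (Additive-reducible f a t) λ c g∈ → let u , du , g≈u = All.lookup flat g∈ in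
          (λ x → c ⊗ u x) , Deg-scale c du , λ {Q} dQ →
            trans (⟪⟫-⊗ˡ f c _ Q) (trans (cong (c ⊗_) (g≈u dQ)) (sym (⟪⟫-⊗ˡ f c u Q))))

m+n≤o⇒n≤o∸m : ∀ m {n o} → m + n ≤ o → n ≤ o ∸ m
m+n≤o⇒n≤o∸m m {n} {o} m+n≤o = ℕ.m+n≤o⇒m≤o∸n n (subst (_≤ o) (ℕ.+-comm m n) m+n≤o)

-- Exact degrees, and large families of multipliers whose differences preserve them.

module Leading {q : ℕ} (𝔽 : PrimeField q) where
  open PrimeField 𝔽
  open Degree 𝔽
  open Additive
  open Duality 𝔽
  open Alternative 𝔽
  open Solver using (solve; con; _:+_; _:*_; _:=_)
  open ≡-Reasoning

  -- The j-th Newton moment of h in the first coordinate. By `E-slice` it describes, with one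
  -- variable fewer, how h pairs with multiples of `newton j`.
  slice : ∀ {n} → ℕ → Func (suc n) → Func n
  slice j h x = sum λ a → newton j a ⊗ h (a ∷ x)

  E-sum : ∀ {n m} (u : Fin m → Func n) → E (λ x → sum λ i → u i x) ≡ sum λ i → E (u i)
  E-sum {zero}  u = refl
  E-sum {suc n} u = trans (sum-cong-≗ λ a → E-sum λ i x → u i (a ∷ x)) (∑-comm λ a i → E λ x → u i (a ∷ x))

  E-slice : ∀ {n} j (h : Func (suc n)) (g : Func n) →
    E (λ x → h x ⊗ (newton j (head x) ⊗ g (tail x))) ≡ E (λ x → slice j h x ⊗ g x)
  E-slice j h g = begin
    sum (λ a → E (λ x → h (a ∷ x) ⊗ (newton j a ⊗ g x)))  ≡⟨ E-sum
        (λ a x → h (a ∷ x) ⊗ (newton j a ⊗ g x)) ⟨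
    E (λ x → sum (λ a → h (a ∷ x) ⊗ (newton j a ⊗ g x)))
      ≡⟨ E-cong (λ x → sum-cong-≗ λ a → solve 3 (λ h b g → h :* (b :* g) := b :* h :* g) refl (h (a ∷ x))
          (newton j a) (g x)) ⟩
    E (λ x → sum (λ a → newton j a ⊗ h (a ∷ x) ⊗ g x))
      ≡⟨ E-cong (λ x → ⊗-distribʳ-sum (g x) (λ a → newton j a ⊗ h (a ∷ x))) ⟨
    E (λ x → slice j h x ⊗ g x)  ∎

  newton-ι : ∀ {i j} → i < j → newton j (ι i) ≡ 0𝔽
  newton-ι {i} {suc j} i<1+j with i ℕ.≟ j
  ... | yes refl = trans (cong (newton j (ι i) ⊗_) (⊖-inverseʳ (ι i))) (⊗-zeroʳ _)
  ... | no  i≢j  = trans (cong (_⊗ (ι i ⊕ ⊖ ι j)) (newton-ι (ℕ.≤∧≢⇒< (ℕ.≤-pred i<1+j) i≢j))) (⊗-zeroˡ _)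

  newton-≥q : ∀ {j} → q ≤ j → ∀ x → newton j x ≡ 0𝔽
  newton-≥q q≤j x with i , i<q , refl ← ι-surjective x = newton-ι (ℕ.<-≤-trans i<q q≤j)

  slice-≥q : ∀ {n j} → q ≤ j → (h : Func (suc n)) → ∀ x → slice j h x ≡ 0𝔽
  slice-≥q q≤j h x = sum-zero λ a → trans (cong (_⊗ h (a ∷ x)) (newton-≥q q≤j a)) (⊗-zeroˡ _)

  slice-⊥ : ∀ {n j t} {h : Func (suc n)} → h ⊥ (j + t) → slice j h ⊥ t
  slice-⊥ {j = j} {h = h} h⊥ {Q} dQ = trans (sym (E-slice j h Q)) (h⊥ (Deg-⊗ (Deg-newton j) (Deg-tail dQ)))

  -- By duality: the degree of h, as a function on 𝔽ⁿ, is exactly (q - 1) n - A.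
  record HasCodegree {n} (h : Func n) (A : ℕ) : Set where
    field
      below   : ∀ {t} → t < A → h ⊥ t
      nonzero : h ⊥̸ A

  open HasCodegree

  -- A polynomial of degree A not annihilated by h splits into multiples of Newton polynomials, and
  -- one of these terms survives; moments with j ≥ q are zero. As j = 0 is tried first, any other
  -- answer comes with the orthogonality of `slice 0 h` to degree A, which `double` needs.
  slice-codegree : ∀ {n A} {h : Func (suc n)} → HasCodegree h A →
    ∃[ j ] ∃[ t ] j + t ≡ A × j < q × HasCodegree (slice j h) t × (j ≢ 0 → slice 0 h ⊥ A)
  slice-codegree {n} {A} {h} codeg with ⊥? (slice 0 h) A
  ... | inj₂ h₀⊥̸ = 0 , A , refl , ℕ.<-trans (s≤s z≤n) 1<q ,
          record { below = λ t<A → slice-⊥ {j = 0} {h = h} (codeg .below t<A) ; nonzero = h₀⊥̸ } , contradiction refl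
  ... | inj₁ h₀⊥ with search A ℕ.≤-refl
    where
    Found = ∃[ j ] ∃[ t ] j + t ≡ A × slice j h ⊥̸ t
    search : ∀ m → m ≤ A → (∀ {j t} → j + t ≡ A → j ≤ m → slice j h ⊥ t) ⊎ Found
    search zero    _   = inj₁ λ { refl z≤n → h₀⊥ }
    search (suc m) m<A with search m (ℕ.<⇒≤ m<A) | ⊥? (slice (suc m) h) (A ∸ suc m)
    ... | inj₂ found | _       = inj₂ found
    ... | inj₁ _     | inj₂ h⊥̸ = inj₂ (suc m , A ∸ suc m , ℕ.m+[n∸m]≡n m<A , h⊥̸)
    ... | inj₁ prev  | inj₁ h⊥ = inj₁ next
      where
      next : ∀ {j t} → j + t ≡ A → j ≤ suc m → slice j h ⊥ t
      next {j} {t} j+t≡A j≤1+m with j ℕ.≟ suc m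
      ... | no  j≢   = prev j+t≡A (ℕ.≤-pred (ℕ.≤∧≢⇒< j≤1+m j≢))
      ... | yes refl = subst (slice j h ⊥_) (trans (cong (_∸ j) (sym j+t≡A)) (ℕ.m+n∸m≡n j t)) h⊥
  ...   | inj₂ (j , t , refl , hⱼ⊥̸@(Q , dQ , hⱼQ≢0)) = j , t , refl , j<q ,
            record { below = λ t′<t → slice-⊥ {j = j} {h = h} (codeg .below (ℕ.+-monoʳ-< j t′<t)) ; nonzero = hⱼ⊥̸ } , λ _ → h₀⊥
    where
    j<q : j < q
    j<q with j ℕ.<? q
    ... | yes j<q = j<q
    ... | no  j≮q = contradiction
            (E-0 λ x → trans (cong (_⊗ Q x) (slice-≥q (ℕ.≮⇒≥ j≮q) h x)) (⊗-zeroˡ (Q x))) hⱼQ≢0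
  ...   | inj₁ all⊥ = contradiction
            (Deg-split (Additive-E h) (λ j {i} {g} j+i≤A dg → trans (E-slice j h g)
              (all⊥ (ℕ.m+[n∸m]≡n (ℕ.≤-trans (ℕ.m≤m+n j i) j+i≤A)) (ℕ.≤-trans (ℕ.m≤m+n j i) j+i≤A)
                (Deg-≤ (m+n≤o⇒n≤o∸m j j+i≤A) dg))) (proj₁ (proj₂ (codeg .nonzero))))
            (proj₂ (proj₂ (codeg .nonzero)))

  -- For each P at most one member g makes h (P + g) orthogonal to degree m, because the difference
  -- of two would contradict `apart`. The size thus bounds the probability that h P drops in degree.
  record Family {n} (h : Func n) (e m t : ℕ) : Set where
    field
      size   : ℕ
      size≡  : size ≡ q ^ (2 ^ t)
      member : Fin size → Func n
      degree : ∀ c → Deg e (member c)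
      apart  : ∀ {c c′} → c ≢ c′ → (λ x → h x ⊗ (member c x ⊕ ⊖ member c′ x)) ⊥̸ m

  open Family

  ⊗-distribʳ-⊖ : ∀ a b c → (a ⊕ ⊖ b) ⊗ c ≡ a ⊗ c ⊕ ⊖ (b ⊗ c)
  ⊗-distribʳ-⊖ a b c = trans (⊗-distribʳ-⊕ c a (⊖ b)) (cong (a ⊗ c ⊕_) (sym (⊖-distribˡ-⊗ b c)))

  multiples : ∀ {n e m} {h : Func n} → h ⊥̸ (e + m) → Family h e m 0
  multiples {e = e} {m} {h} h⊥̸ with P , dP , Q , dQ , hPQ≢0 ← ⊥̸-product e h⊥̸ = record
    { size   = q
    ; size≡  = sym (ℕ.^-identityʳ q)
    ; member = λ c x → c ⊗ P x
    ; degree = λ c → Deg-scale c dP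
    ; apart  = λ {c} {c′} c≢c′ → Q , dQ , λ eq → ⊗-≢0 (c≢c′ ∘ ⊖-≡) hPQ≢0 (begin
        (c ⊕ ⊖ c′) ⊗ E (λ x → h x ⊗ P x ⊗ Q x)  ≡⟨ E-⊗ (c ⊕ ⊖ c′) (λ x → h x ⊗ P x ⊗ Q x) ⟨
        E (λ x → (c ⊕ ⊖ c′) ⊗ (h x ⊗ P x ⊗ Q x))
          ≡⟨ E-cong (λ x → solve 4 (λ d h p q → d :* (h :* p :* q) := h :* (d :* p) :* q) refl (c ⊕ ⊖ c′)
              (h x) (P x) (Q x)) ⟩
        E (λ x → h x ⊗ ((c ⊕ ⊖ c′) ⊗ P x) ⊗ Q x)
          ≡⟨ E-cong (λ x → cong (λ z → h x ⊗ z ⊗ Q x) (⊗-distribʳ-⊖ c c′ (P x))) ⟩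
        E (λ x → h x ⊗ (c ⊗ P x ⊕ ⊖ (c′ ⊗ P x)) ⊗ Q x)  ≡⟨ eq ⟩
        0𝔽  ∎)
    }

  lift : ∀ {n e m t} {h : Func (suc n)} → Family (slice 0 h) e m t → Family h e m t
  lift {h = h} fam = record
    { size   = fam .size
    ; size≡  = fam .size≡
    ; member = λ c x → fam .member c (tail x)
    ; degree = λ c → Deg-tail (fam .degree c)
    ; apart  = λ {c} {c′} c≢c′ → let Q , dQ , ≢0 = fam .apart c≢c′ in
        (λ x → Q (tail x)) , Deg-tail dQ , λ eq → ≢0 (begin
          E (λ x → slice 0 h x ⊗ (fam .member c x ⊕ ⊖ fam .member c′ x) ⊗ Q x)
            ≡⟨ E-cong (λ x → ⊗-assoc _ _ (Q x)) ⟩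
          E (λ x → slice 0 h x ⊗ ((fam .member c x ⊕ ⊖ fam .member c′ x) ⊗ Q x))
            ≡⟨ E-slice 0 h (λ x → (fam .member c x ⊕ ⊖ fam .member c′ x) ⊗ Q x) ⟨
          E (λ x → h x ⊗ (1𝔽 ⊗ ((fam .member c (tail x) ⊕ ⊖ fam .member c′ (tail x)) ⊗ Q (tail x))))
            ≡⟨ E-cong (λ x → trans (cong (h x ⊗_) (⊗-identityˡ _))
                (sym (⊗-assoc (h x) (fam .member c (tail x) ⊕ ⊖ fam .member c′ (tail x)) (Q (tail x))))) ⟩
          E (λ x → h x ⊗ (fam .member c (tail x) ⊕ ⊖ fam .member c′ (tail x)) ⊗ Q (tail x))  ≡⟨ eq ⟩
          0𝔽  ∎)
    }

  ⊖-⊕-⊗ : ∀ a b c d e → (a ⊕ c ⊗ b) ⊕ ⊖ (d ⊕ c ⊗ e) ≡ (a ⊕ ⊖ d) ⊕ c ⊗ (b ⊕ ⊖ e)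
  ⊖-⊕-⊗ a b c d e = ⊕-cancelʳ (d ⊕ c ⊗ e) _ _ (begin
    ((a ⊕ c ⊗ b) ⊕ ⊖ (d ⊕ c ⊗ e)) ⊕ (d ⊕ c ⊗ e)  ≡⟨ ⊕-assoc _ _ _ ⟩
    (a ⊕ c ⊗ b) ⊕ (⊖ (d ⊕ c ⊗ e) ⊕ (d ⊕ c ⊗ e))  ≡⟨ cong ((a ⊕ c ⊗ b) ⊕_) (⊖-inverseˡ _) ⟩
    (a ⊕ c ⊗ b) ⊕ 0𝔽
      ≡⟨ cong ((a ⊕ c ⊗ b) ⊕_) (trans (cong₂ (λ y z → y ⊕ c ⊗ z) (⊖-inverseˡ d) (⊖-inverseˡ e))
          (trans (⊕-identityˡ _) (⊗-zeroʳ c))) ⟨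
    (a ⊕ c ⊗ b) ⊕ ((⊖ d ⊕ d) ⊕ c ⊗ (⊖ e ⊕ e))
      ≡⟨ solve 7 (λ a b c d e md me → (a :+ c :* b) :+ ((md :+ d) :+ c :* (me :+ e)) :=
          ((a :+ md) :+ c :* (b :+ me)) :+ (d :+ c :* e)) refl a b c d e (⊖ d) (⊖ e) ⟩
    ((a ⊕ ⊖ d) ⊕ c ⊗ (b ⊕ ⊖ e)) ⊕ (d ⊕ c ⊗ e)  ∎)

  -- Members P + b_j P′: a nonzero difference in P′ is detected by test functions
  -- of the remaining variables, and otherwise one in P by their multiples by b_j.
  double : ∀ {n e m t} j {h : Func (suc n)} → slice 0 h ⊥ ((j + e) + (j + m)) →
    Family (slice j h) (j + e) m t → Family (slice j h) e (j + m) t → Family h (j + e) (j + m) (suc t)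
  double {n} {e} {m} {t} j {h} h₀⊥ fam₁ fam₂ = record
    { size   = fam₁ .size * fam₂ .size
    ; size≡  = trans (cong₂ _*_ (fam₁ .size≡) (fam₂ .size≡))
        (trans (sym (ℕ.^-distribˡ-+-* q (2 ^ t) (2 ^ t)))
        (cong (λ z → q ^ (2 ^ t + z)) (sym (ℕ.+-identityʳ (2 ^ t)))))
    ; member = λ c x → fam₁ .member (proj₁ (split c)) (tail x) ⊕ newton j (head x) ⊗ fam₂ .member
        (proj₂ (split c)) (tail x)
    ; degree = λ c → add (Deg-tail (fam₁ .degree _)) (Deg-⊗ (Deg-newton j) (Deg-tail (fam₂ .degree _)))
    ; apart  = λ {c} {c′} c≢c′ → go (split c) (split c′) (λ eq → c≢c′
        (trans (sym (Fin.combine-remQuot {fam₁ .size} (fam₂ .size) c))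
          (trans (cong (λ p → combine (proj₁ p) (proj₂ p)) eq)
              (Fin.combine-remQuot {fam₁ .size} (fam₂ .size) c′))))
    }
    where
    split = remQuot {fam₁ .size} (fam₂ .size)
    go : ∀ p p′ → p ≢ p′ → (λ x → h x ⊗
      ((fam₁ .member (proj₁ p) (tail x) ⊕ newton j (head x) ⊗ fam₂ .member (proj₂ p) (tail x)) ⊕
        ⊖ (fam₁ .member (proj₁ p′) (tail x) ⊕ newton j (head x) ⊗ fam₂ .member (proj₂ p′) (tail x)))) ⊥̸
            (j + m)
    go (c₁ , c₂) (d₁ , d₂) p≢p′ with c₂ Fin.≟ d₂
    ... | no c₂≢d₂ = let Q , dQ , ≢0 = fam₂ .apart c₂≢d₂ in
      (λ x → Q (tail x)) , Deg-tail dQ , λ eq → ≢0 (begin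
        E (λ x → slice j h x ⊗ Δ₂ x ⊗ Q x)
          ≡⟨ E-cong (λ x → ⊗-assoc (slice j h x) (Δ₂ x) (Q x)) ⟩
        E (λ x → slice j h x ⊗ (Δ₂ x ⊗ Q x))  ≡⟨ E-slice j h (λ x → Δ₂ x ⊗ Q x) ⟨
        E (T₂ Q)  ≡⟨ ⊕-identityˡ _ ⟨
        -- The difference Δ₁ is paired through `slice 0 h`, which annihilates degree (j + e) + (j +
        -- m); the test function Q therefore sees only Δ₂.
        0𝔽 ⊕ E (T₂ Q)
          ≡⟨ cong (_⊕ E (T₂ Q)) (trans (E-slice 0 h (λ x → Δ₁ x ⊗ Q x)) (h₀⊥ (Deg-⊗ dΔ₁ dQ))) ⟨
        E (T₁ Q) ⊕ E (T₂ Q)  ≡⟨ E-⊕ (T₁ Q) (T₂ Q) ⟨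
        E (λ x → T₁ Q x ⊕ T₂ Q x)  ≡⟨ E-cong (λ x → trans
             (solve 6 (λ h o d₁ d₂ b q → h :* (o :* (d₁ :* q)) :+ h :* (b :* (d₂ :* q)) := h :*
                 (o :* d₁ :+ b :* d₂) :* q) refl (h x) 1𝔽 (Δ₁ (tail x)) (Δ₂ (tail x)) (newton j (head x))
                     (Q (tail x)))
             (cong (λ z → h x ⊗ z ⊗ Q (tail x))
                 (trans (cong (_⊕ newton j (head x) ⊗ Δ₂ (tail x)) (⊗-identityˡ _))
                     (sym (⊖-⊕-⊗ _ _ (newton j (head x)) _ _))))) ⟩
        _  ≡⟨ eq ⟩
        0𝔽  ∎)
      where
      Δ₁ Δ₂ : Func n
      Δ₁ x = fam₁ .member c₁ x ⊕ ⊖ fam₁ .member d₁ x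
      Δ₂ x = fam₂ .member c₂ x ⊕ ⊖ fam₂ .member d₂ x
      dΔ₁ : Deg (j + e) Δ₁
      dΔ₁ = Deg-⊖ (fam₁ .degree c₁) (fam₁ .degree d₁)
      T₁ T₂ : Func n → Func (suc n)
      T₁ Q x = h x ⊗ (newton 0 (head x) ⊗ (Δ₁ (tail x) ⊗ Q (tail x)))
      T₂ Q x = h x ⊗ (newton j (head x) ⊗ (Δ₂ (tail x) ⊗ Q (tail x)))
    ... | yes refl = let Q , dQ , ≢0 = fam₁ .apart (λ c₁≡d₁ → p≢p′ (cong (_, c₂) c₁≡d₁)) in
      (λ x → newton j (head x) ⊗ Q (tail x)) , Deg-⊗ (Deg-newton j) (Deg-tail dQ) , λ eq → ≢0 (begin
        E (λ x → slice j h x ⊗ Δ₁ x ⊗ Q x)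
          ≡⟨ E-cong (λ x → ⊗-assoc (slice j h x) (Δ₁ x) (Q x)) ⟩
        E (λ x → slice j h x ⊗ (Δ₁ x ⊗ Q x))  ≡⟨ E-slice j h (λ x → Δ₁ x ⊗ Q x) ⟨
        E (λ x → h x ⊗ (newton j (head x) ⊗ (Δ₁ (tail x) ⊗ Q (tail x))))  ≡⟨ E-cong (λ x → trans
             (solve 4 (λ h b d q → h :* (b :* (d :* q)) := h :* d :* (b :* q)) refl (h x)
                 (newton j (head x)) (Δ₁ (tail x)) (Q (tail x)))
             (cong (λ z → h x ⊗ z ⊗ (newton j (head x) ⊗ Q (tail x)))
                 (sym (same (fam₁ .member c₁ (tail x)) (fam₂ .member c₂ (tail x)) (newton j (head x))
                     (fam₁ .member d₁ (tail x)))))) ⟩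
        _  ≡⟨ eq ⟩
        0𝔽  ∎)
      where
      Δ₁ : Func n
      Δ₁ x = fam₁ .member c₁ x ⊕ ⊖ fam₁ .member d₁ x
      same : ∀ a b c d → (a ⊕ c ⊗ b) ⊕ ⊖ (d ⊕ c ⊗ b) ≡ a ⊕ ⊖ d
      same a b c d = trans (⊖-⊕-⊗ a b c d b) (trans (cong (λ z → (a ⊕ ⊖ d) ⊕ c ⊗ z) (⊖-inverseʳ b))
        (trans (cong ((a ⊕ ⊖ d) ⊕_) (⊗-zeroʳ c)) (⊕-identityʳ _)))

  -- If the moment found is j = 0, the first coordinate is dropped. Otherwise `double` squares the
  -- size, and the two smaller families give up j ≤ q - 1 of m and of e respectively; so t doublings
  -- fit when both are at least t (q - 1).
  family : ∀ n t e m {h : Func n} → HasCodegree h (e + m) → t * (q ∸ 1) ≤ e → t * (q ∸ 1) ≤ m →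
      Family h e m t
  family n       zero    e m codeg _ _ = multiples (codeg .nonzero)
  -- On a single point all functions are constants, so a codegree can only be 0, while a doubling
  -- still to come forces e + m > 0.
  family zero    (suc t) e m {h} codeg t≤e t≤m with e+m>0 ← ℕ.<-≤-trans (ℕ.m<n⇒0<n∸m 1<q)
      (ℕ.≤-trans (ℕ.m≤m+n (q ∸ 1) (t * (q ∸ 1))) (ℕ.≤-trans t≤e (ℕ.m≤m+n e m)))
    with Q , dQ , hQ≢0 ← codeg .nonzero =
        contradiction (trans (cong (h [] ⊗_) (sym (⊗-identityʳ (Q [])))) (begin
        h [] ⊗ (Q [] ⊗ 1𝔽)  ≡⟨ solve 3 (λ a b c → a :* (b :* c) := b :* (a :* c)) refl (h []) (Q []) 1𝔽 ⟩
        Q [] ⊗ (h [] ⊗ 1𝔽)  ≡⟨ cong (Q [] ⊗_) (codeg .below e+m>0 (const 1𝔽)) ⟩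
        Q [] ⊗ 0𝔽  ≡⟨ ⊗-zeroʳ _ ⟩
        0𝔽  ∎)) hQ≢0
  family (suc n) (suc t) e m {h} codeg t≤e t≤m with slice-codegree codeg
  ... | zero , _ , refl , _ , codeg₀ , _ = lift (family n (suc t) e m codeg₀ t≤e t≤m)
  ... | j@(suc _) , s , j+s≡ , j<q , codegⱼ , h₀⊥ =
    subst₂ (λ e m → Family h e m (suc t)) j+e′≡e j+m′≡m (double {e = e ∸ j} {m ∸ j} j
      (subst (slice 0 h ⊥_) (sym (cong₂ _+_ j+e′≡e j+m′≡m)) (h₀⊥ λ ()))
      (family n t (j + (e ∸ j)) (m ∸ j) (subst (HasCodegree (slice j h)) s≡₁ codegⱼ)
        (ℕ.≤-trans (ℕ.m≤n+m _ (q ∸ 1)) (subst (suc t * (q ∸ 1) ≤_) (sym j+e′≡e) t≤e)) (shrink t≤m))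
      (family n t (e ∸ j) (j + (m ∸ j)) (subst (HasCodegree (slice j h)) s≡₂ codegⱼ)
        (shrink t≤e) (ℕ.≤-trans (ℕ.m≤n+m _ (q ∸ 1)) (subst (suc t * (q ∸ 1) ≤_) (sym j+m′≡m) t≤m))))
    where
    j≤q-1 : j ≤ q ∸ 1
    j≤q-1 = ℕ.∸-monoˡ-≤ 1 j<q
    shrink : ∀ {k} → suc t * (q ∸ 1) ≤ k → t * (q ∸ 1) ≤ k ∸ j
    shrink {k} t≤k = m+n≤o⇒n≤o∸m j (ℕ.≤-trans (ℕ.+-monoˡ-≤ _ j≤q-1) t≤k)
    above : ∀ {k} → suc t * (q ∸ 1) ≤ k → j ≤ k
    above t≤k = ℕ.≤-trans (ℕ.≤-trans j≤q-1 (ℕ.m≤m+n _ _)) t≤k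
    j+e′≡e : j + (e ∸ j) ≡ e
    j+e′≡e = ℕ.m+[n∸m]≡n (above t≤e)
    j+m′≡m : j + (m ∸ j) ≡ m
    j+m′≡m = ℕ.m+[n∸m]≡n (above t≤m)
    s≡₁ : s ≡ (j + (e ∸ j)) + (m ∸ j)
    s≡₁ = ℕ.+-cancelˡ-≡ j _ _ (trans j+s≡ (trans (cong (e ℕ.+_) (sym j+m′≡m))
      (trans (cong (_+ (j + (m ∸ j))) (sym j+e′≡e)) (swap (j + (e ∸ j)) j (m ∸ j)))))
      where
      swap : ∀ a b c → a + (b + c) ≡ b + (a + c)
      swap a b c = trans (sym (ℕ.+-assoc a b c)) (trans (cong (_+ c) (ℕ.+-comm a b)) (ℕ.+-assoc b a c))
    s≡₂ : s ≡ (e ∸ j) + (j + (m ∸ j))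
    s≡₂ = ℕ.+-cancelˡ-≡ j _ _ (trans j+s≡ (trans (cong₂ _+_ (sym j+e′≡e) (sym j+m′≡m))
        (ℕ.+-assoc j (e ∸ j) _)))

-- Flat extension: the functional as a combination of point evaluations.

module FlatExtension {q : ℕ} (𝔽 : PrimeField q) where
  open PrimeField 𝔽
  open Degree 𝔽
  open Additive
  open Duality 𝔽
  open Alternative 𝔽
  open Leading 𝔽 using (E-sum)
  open Solver using (solve; con; _:+_; _:*_; _:=_)
  open ≡-Reasoning

  𝟏 : ∀ {n} → Func n
  𝟏 _ = 1𝔽

  -- On polynomials of degree at most t, the functional E (f w ·) is a nonzero
  -- multiple of the evaluation at z.
  record Visible {n} (f : Func n) (a t : ℕ) (z : Vec K n) : Set where
    field
      probe  : Func n
      degree : Deg a probe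
      mass≢0 : ⟪ f ∣ probe ∣ 𝟏 ⟫ ≢ 0𝔽
      point  : ∀ {P} → Deg t P → ⟪ f ∣ probe ∣ P ⟫ ≡ ⟪ f ∣ probe ∣ 𝟏 ⟫ ⊗ P z

  open Visible

  sum≢0 : ∀ {m} {u : Fin m → K} → sum u ≢ 0𝔽 → ∃[ i ] u i ≢ 0𝔽
  sum≢0 {m} {u} Σ≢0 = Fin.¬∀⟶∃¬ m (λ i → u i ≡ 0𝔽) (λ i → u i Fin.≟ 0𝔽) (λ u≡0 → Σ≢0 (sum-zero u≡0))

  Deg-sum : ∀ {n m d} {u : Fin m → Func n} → (∀ i → Deg d (u i)) → Deg d (λ x → sum λ i → u i x)
  Deg-sum {m = zero}  du = const 0𝔽
  Deg-sum {m = suc m} du = add (du zero) (Deg-sum (du ∘ suc))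

  ⟪⟫-sumˡ : ∀ {n m} (f : Func n) (u : Fin m → Func n) (Q : Func n) →
    ⟪ f ∣ (λ x → sum λ i → u i x) ∣ Q ⟫ ≡ sum λ i → ⟪ f ∣ u i ∣ Q ⟫
  ⟪⟫-sumˡ f u Q = trans
    (E-cong λ x → trans (cong (f x ⊗_) (⊗-distribʳ-sum (Q x) (λ i → u i x)))
        (⊗-distribˡ-sum (f x) (λ i → u i x ⊗ Q x)))
    (E-sum λ i x → f x ⊗ (u i x ⊗ Q x))

  -- `slack` leaves room for a product of two polynomials of degree a, and for a polynomial of
  -- degree a times an indicator of degree q - 1.
  module _ {n} (f : Func n) (a t : ℕ) (flat : Flat f a t) (slack : a + a + q ≤ suc t) where

    -- One coordinate factor is moved to the test function, the cofactor is reduced, and flatness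
    -- reduces the product. Each degree removed from P therefore costs one degree of the test
    -- functions.
    reduce : ∀ j {t′ P} → j + t′ ≡ suc t → Deg (a + j) P → ∃[ P′ ] Deg a P′ × P ≈ P′ [ f , t′ ]
    reduce zero    {P = P} refl dP = P , Deg-≤ (ℕ.≤-reflexive (ℕ.+-identityʳ a)) dP , λ _ → refl
    reduce (suc j) {t′} eq dP = Deg-product 1 (Additive-reducible f a t′) (λ {u} {w} du dw →
      let w′ , dw′ , w≈w′ = reduce j {suc t′} (trans (ℕ.+-suc j t′) eq) dw
          v , dv , uw′≈v  = flat (Deg-⊗ du dw′)
      in v , dv , λ {Q} dQ → begin
        ⟪ f ∣ (λ x → u x ⊗ w x) ∣ Q ⟫  ≡⟨ ⟪⟫-shift f w Q u ⟩
        ⟪ f ∣ w ∣ (λ x → u x ⊗ Q x) ⟫  ≡⟨ w≈w′ (Deg-⊗ du dQ) ⟩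
        ⟪ f ∣ w′ ∣ (λ x → u x ⊗ Q x) ⟫  ≡⟨ ⟪⟫-shift f w′ Q u ⟨
        ⟪ f ∣ (λ x → u x ⊗ w′ x) ∣ Q ⟫  ≡⟨ uw′≈v (Deg-≤ t′≤t dQ) ⟩
        ⟪ f ∣ v ∣ Q ⟫  ∎) (Deg-≤ (ℕ.≤-reflexive (ℕ.+-suc a j)) dP)
      where
      t′≤t : t′ ≤ t
      t′≤t = ℕ.≤-pred (ℕ.≤-trans (s≤s (ℕ.m≤n+m t′ j)) (ℕ.≤-reflexive eq))

    reduce-to : ∀ {i t′ P} → i + t′ ≤ suc (a + t) → Deg i P → a ≤ i → ∃[ P′ ] Deg a P′ × P ≈ P′ [ f , t′ ]
    reduce-to {i} {t′} i+t′≤ dP a≤i =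
      let P′ , dP′ , P≈P′ = reduce (i ∸ a) (ℕ.m+[n∸m]≡n j≤) (Deg-≤ (ℕ.≤-reflexive (sym (ℕ.m+[n∸m]≡n a≤i))) dP)
      in P′ , dP′ , λ dQ → P≈P′ (Deg-≤ (m+n≤o⇒n≤o∸m (i ∸ a) j+t′≤) dQ)
      where
      j+t′≤ : (i ∸ a) + t′ ≤ suc t
      j+t′≤ = ℕ.+-cancelˡ-≤ a _ _ (ℕ.≤-trans
          (ℕ.≤-reflexive (trans (sym (ℕ.+-assoc a (i ∸ a) t′)) (cong (_+ t′) (ℕ.m+[n∸m]≡n a≤i))))
        (ℕ.≤-trans i+t′≤ (ℕ.≤-reflexive (sym (ℕ.+-suc a t)))))
      j≤ : i ∸ a ≤ suc t
      j≤ = ℕ.≤-trans (ℕ.m≤m+n (i ∸ a) t′) j+t′≤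

    -- By symmetry of the form the test function Q can itself be reduced to degree a, where
    -- agreement is assumed.
    extend : ∀ {i t′ R R′} → i + t′ ≤ suc (a + t) → Deg i R → Deg i R′ → R ≈ R′ [ f , a ] →
        R ≈ R′ [ f , t′ ]
    extend {i} {t′} {R} {R′} i+t′≤ dR dR′ R≈R′ {Q} dQ with a ℕ.≤? t′
    ... | no  a≰t′ = R≈R′ (Deg-≤ (ℕ.<⇒≤ (ℕ.≰⇒> a≰t′)) dQ)
    ... | yes a≤t′ = let Q′ , dQ′ , Q≈Q′ = reduce-to (ℕ.≤-trans (ℕ.≤-reflexive (ℕ.+-comm t′ i)) i+t′≤) dQ a≤t′ in begin
      ⟪ f ∣ R ∣ Q ⟫  ≡⟨ ⟪⟫-comm f R Q ⟩
      ⟪ f ∣ Q ∣ R ⟫  ≡⟨ Q≈Q′ dR ⟩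
      ⟪ f ∣ Q′ ∣ R ⟫  ≡⟨ ⟪⟫-comm f Q′ R ⟩
      ⟪ f ∣ R ∣ Q′ ⟫  ≡⟨ R≈R′ dQ′ ⟩
      ⟪ f ∣ R′ ∣ Q′ ⟫  ≡⟨ ⟪⟫-comm f R′ Q′ ⟩
      ⟪ f ∣ Q′ ∣ R′ ⟫  ≡⟨ Q≈Q′ dR′ ⟨
      ⟪ f ∣ Q ∣ R′ ⟫  ≡⟨ ⟪⟫-comm f Q R′ ⟩
      ⟪ f ∣ R′ ∣ Q ⟫  ∎

    -- An eigenvector w, with eigenvalue b, of multiplication by coordinate i modulo the radical of
    -- the form. For w of degree a, tests of degree a suffice by `Eigen-extend`.
    Eigen : Func n → Fin n → K → Set
    Eigen w i b = (λ x → lookup x i ⊗ w x) ≈ (λ x → b ⊗ w x) [ f , a ]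

    Eigen-extend : ∀ {w i b} → Deg a w → Eigen w i b → (λ x → lookup x i ⊗ w x) ≈ (λ x → b ⊗ w x) [ f , t ]
    Eigen-extend {i = i} {b} dw = extend {i = suc a} ℕ.≤-refl (var i dw)
        (Deg-scale b (Deg-≤ (ℕ.n≤1+n a) dw))

    -- For a simultaneous eigenvector, each coordinate factor of P can be pulled out as the
    -- corresponding coordinate of y.
    Eigen-point : ∀ {w} (y : Vec K n) → Deg a w → (∀ i → Eigen w i (lookup y i)) →
      ∀ {P} → Deg (suc t) P → ⟪ f ∣ w ∣ P ⟫ ≡ ⟪ f ∣ w ∣ 𝟏 ⟫ ⊗ P y
    Eigen-point {w} y dw eigen = λ dP → go ℕ.≤-refl dP
      where
      go : ∀ {t′ P} → t′ ≤ suc t → Deg t′ P → ⟪ f ∣ w ∣ P ⟫ ≡ ⟪ f ∣ w ∣ 𝟏 ⟫ ⊗ P y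
      go _ (const c) = trans (⟪⟫-congʳ f w (λ x → sym (⊗-identityʳ c))) (trans (⟪⟫-⊗ʳ f w c 𝟏) (⊗-comm c _))
      go t′≤ (add {f = P} {Q} dP dQ) = trans (⟪⟫-⊕ʳ f w P Q)
        (trans (cong₂ _⊕_ (go t′≤ dP) (go t′≤ dQ)) (sym (⊗-distribˡ-⊕ _ (P y) (Q y))))
      go (s≤s t′≤t) (var {f = P} i dP) = begin
        ⟪ f ∣ w ∣ (λ x → lookup x i ⊗ P x) ⟫  ≡⟨ ⟪⟫-shift f w P (λ x → lookup x i) ⟨
        ⟪ f ∣ (λ x → lookup x i ⊗ w x) ∣ P ⟫  ≡⟨ Eigen-extend dw (eigen i) (Deg-≤ t′≤t dP) ⟩
        ⟪ f ∣ (λ x → lookup y i ⊗ w x) ∣ P ⟫  ≡⟨ ⟪⟫-⊗ˡ f (lookup y i) w P ⟩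
        lookup y i ⊗ ⟪ f ∣ w ∣ P ⟫
          ≡⟨ cong (lookup y i ⊗_) (go (ℕ.≤-trans t′≤t (ℕ.n≤1+n t)) dP) ⟩
        lookup y i ⊗ (⟪ f ∣ w ∣ 𝟏 ⟫ ⊗ P y)
          ≡⟨ solve 3 (λ a b c → a :* (b :* c) := b :* (a :* c)) refl (lookup y i) ⟪ f ∣ w ∣ 𝟏 ⟫ (P y) ⟩
        ⟪ f ∣ w ∣ 𝟏 ⟫ ⊗ (lookup y i ⊗ P y)  ∎
      go t′≤ (resp≗ P≗Q dP) = trans (⟪⟫-congʳ f w (λ x → sym (P≗Q x)))
          (trans (go t′≤ dP) (cong (_ ⊗_) (P≗Q y)))

    Decomposes : Func n → Set
    Decomposes u = Σ[ h ∈ Func n ] (∀ {P} → Deg (suc t) P → ⟪ f ∣ u ∣ P ⟫ ≡ E (λ x → h x ⊗ P x)) ×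
                          ((z : Vec K n) → h z ≢ 0𝔽 → Visible f a (suc t) z)

    eigen-decomposes : ∀ {w} (y : Vec K n) → Deg a w → (∀ i → Eigen w i (lookup y i)) → Decomposes w
    eigen-decomposes {w} y dw eigen = (λ x → mass ⊗ δ y x) ,
      (λ {P} dP → begin
        ⟪ f ∣ w ∣ P ⟫  ≡⟨ Eigen-point y dw eigen dP ⟩
        mass ⊗ P y  ≡⟨ cong (mass ⊗_) (E-δ P y) ⟨
        mass ⊗ E (λ x → P x ⊗ δ y x)  ≡⟨ E-⊗ mass (λ x → P x ⊗ δ y x) ⟨
        E (λ x → mass ⊗ (P x ⊗ δ y x))
          ≡⟨ E-cong (λ x → solve 3 (λ m p d → m :* (p :* d) := m :* d :* p) refl mass (P x) (δ y x)) ⟩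
        E (λ x → mass ⊗ δ y x ⊗ P x)  ∎) ,
      λ z hz≢0 → record
        { probe  = w
        ; degree = dw
        ; mass≢0 = λ mass≡0 → hz≢0 (trans (cong (_⊗ δ y z) mass≡0) (⊗-zeroˡ _))
        ; point  = λ {P} dP → trans (Eigen-point y dw eigen dP)
            (cong (λ x → mass ⊗ P x) (δ≢0⇒≡ y z (λ δ≡0 → hz≢0 (trans (cong (mass ⊗_) δ≡0) (⊗-zeroʳ mass)))))
        }
      where mass = ⟪ f ∣ w ∣ 𝟏 ⟫

    indicator : Fin n → K → Func n
    indicator i b x = spike (lookup x i ⊕ ⊖ b)

    indicator-var : ∀ i b x → lookup x i ⊗ indicator i b x ≡ b ⊗ indicator i b x
    indicator-var i b x with lookup x i Fin.≟ b
    ... | yes x≡b = cong (_⊗ indicator i b x) x≡b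
    ... | no  x≢b = trans (zero′ (lookup x i)) (sym (zero′ b))
      where
      zero′ : ∀ c → c ⊗ indicator i b x ≡ 0𝔽
      zero′ c = trans (cong (c ⊗_) (spike-≢0 (x≢b ∘ ⊖-≡))) (⊗-zeroʳ c)

    sum-indicator : ∀ i x → sum (λ b → indicator i b x) ≡ 1𝔽
    sum-indicator i x = trans
      (sum-single (lookup x i) (λ b b≢ → spike-≢0 λ eq → b≢ (sym (⊖-≡ eq))))
      (trans (cong spike (⊖-inverseʳ (lookup x i))) spike-0)

    a+q-1≤t : a + (q ∸ 1) ≤ t
    a+q-1≤t = ℕ.≤-pred (ℕ.≤-trans (ℕ.≤-reflexive (trans (sym (ℕ.+-suc a (q ∸ 1))) (cong (a ℕ.+_) 1+q-1≡q)))
      (ℕ.≤-trans (ℕ.+-monoˡ-≤ q (ℕ.m≤m+n a a)) slack))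
      where
      1+q-1≡q : suc (q ∸ 1) ≡ q
      1+q-1≡q = ℕ.m+[n∸m]≡n (ℕ.<⇒≤ 1<q)

    -- The indicators of the values of coordinate i are its spectral projections; `part b` is the
    -- component of u with eigenvalue b, brought back to degree a.
    module Localise (u : Func n) (du : Deg a u) (i : Fin n) where

      -- Congruence against degree a + 1 instead of a pays for the coordinate factor in `part-eigen`
      -- and `part-preserves`.
      localised : ∀ b → ∃[ u′ ] Deg a u′ × (λ x → indicator i b x ⊗ u x) ≈ u′ [ f , suc a ]
      localised b = reduce-to
        (ℕ.≤-trans (ℕ.≤-reflexive (trans (ℕ.+-suc (q ∸ 1 + a) a) (cong suc (rearrange (q ∸ 1) a))))
          (s≤s (ℕ.+-monoʳ-≤ a a+q-1≤t)))
        (Deg-⊗ (Deg-spike i b) du) (ℕ.m≤n+m a (q ∸ 1))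
        where
        rearrange : ∀ p a → p + a + a ≡ a + (a + p)
        rearrange p a = trans (ℕ.+-comm (p + a) a) (cong (a ℕ.+_) (ℕ.+-comm p a))

      part : K → Func n
      part b = proj₁ (localised b)

      part-degree : ∀ b → Deg a (part b)
      part-degree b = proj₁ (proj₂ (localised b))

      part-≈ : ∀ b → (λ x → indicator i b x ⊗ u x) ≈ part b [ f , suc a ]
      part-≈ b = proj₂ (proj₂ (localised b))

      part-eigen : ∀ b → Eigen (part b) i b
      part-eigen b {Q} dQ = begin
        ⟪ f ∣ (λ x → lookup x i ⊗ part b x) ∣ Q ⟫
          ≡⟨ ⟪⟫-shift f (part b) Q (λ x → lookup x i) ⟩
        ⟪ f ∣ part b ∣ (λ x → lookup x i ⊗ Q x) ⟫  ≡⟨ part-≈ b (var i dQ) ⟨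
        ⟪ f ∣ (λ x → indicator i b x ⊗ u x) ∣ (λ x → lookup x i ⊗ Q x) ⟫
          ≡⟨ E-cong (λ x → cong (f x ⊗_) (move x)) ⟩
        ⟪ f ∣ (λ x → b ⊗ (indicator i b x ⊗ u x)) ∣ Q ⟫  ≡⟨ ⟪⟫-⊗ˡ f b _ Q ⟩
        b ⊗ ⟪ f ∣ (λ x → indicator i b x ⊗ u x) ∣ Q ⟫
          ≡⟨ cong (b ⊗_) (part-≈ b (Deg-≤ (ℕ.n≤1+n a) dQ)) ⟩
        b ⊗ ⟪ f ∣ part b ∣ Q ⟫  ≡⟨ ⟪⟫-⊗ˡ f b (part b) Q ⟨
        ⟪ f ∣ (λ x → b ⊗ part b x) ∣ Q ⟫  ∎
        where
        move : ∀ x → indicator i b x ⊗ u x ⊗ (lookup x i ⊗ Q x) ≡ b ⊗ (indicator i b x ⊗ u x) ⊗ Q x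
        move x = trans
          (solve 4 (λ d u y q → d :* u :* (y :* q) := y :* d :* (u :* q)) refl (indicator i b x) (u x)
              (lookup x i) (Q x))
          (trans (cong (_⊗ (u x ⊗ Q x)) (indicator-var i b x))
            (solve 4 (λ b d u q → b :* d :* (u :* q) := b :* (d :* u) :* q) refl b (indicator i b x) (u x)
                (Q x)))

      -- Multiplications commute: the indicator is moved to the test side, the known eigenvalue of u
      -- is used there, and the indicator is moved back.
      part-preserves : ∀ b {j c} → Eigen u j c → Eigen (part b) j c
      part-preserves b {j} {c} eigen {Q} dQ = begin
        ⟪ f ∣ (λ x → lookup x j ⊗ part b x) ∣ Q ⟫
          ≡⟨ ⟪⟫-shift f (part b) Q (λ x → lookup x j) ⟩
        ⟪ f ∣ part b ∣ (λ x → lookup x j ⊗ Q x) ⟫  ≡⟨ part-≈ b (var j dQ) ⟨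
        ⟪ f ∣ (λ x → indicator i b x ⊗ u x) ∣ (λ x → lookup x j ⊗ Q x) ⟫
          ≡⟨ E-cong (λ x → solve 5 (λ f d u y q → f :* (d :* u :* (y :* q)) := f :* (y :* u :* (d :* q)))
              refl (f x) (indicator i b x) (u x) (lookup x j) (Q x)) ⟩
        ⟪ f ∣ (λ x → lookup x j ⊗ u x) ∣ (λ x → indicator i b x ⊗ Q x) ⟫
          ≡⟨ Eigen-extend du eigen (Deg-≤ (ℕ.≤-trans (ℕ.≤-reflexive (ℕ.+-comm (q ∸ 1) a)) a+q-1≤t)
              (Deg-⊗ (Deg-spike i b) dQ)) ⟩
        ⟪ f ∣ (λ x → c ⊗ u x) ∣ (λ x → indicator i b x ⊗ Q x) ⟫  ≡⟨ ⟪⟫-⊗ˡ f c u _ ⟩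
        c ⊗ ⟪ f ∣ u ∣ (λ x → indicator i b x ⊗ Q x) ⟫
          ≡⟨ cong (c ⊗_) (⟪⟫-shift f u Q (indicator i b)) ⟨
        c ⊗ ⟪ f ∣ (λ x → indicator i b x ⊗ u x) ∣ Q ⟫
          ≡⟨ cong (c ⊗_) (part-≈ b (Deg-≤ (ℕ.n≤1+n a) dQ)) ⟩
        c ⊗ ⟪ f ∣ part b ∣ Q ⟫  ≡⟨ ⟪⟫-⊗ˡ f c (part b) Q ⟨
        ⟪ f ∣ (λ x → c ⊗ part b x) ∣ Q ⟫  ∎

      sum-parts : u ≈ (λ x → sum λ b → part b x) [ f , suc t ]
      sum-parts = extend (ℕ.≤-reflexive (ℕ.+-suc a t)) du (Deg-sum part-degree) λ {Q} dQ → begin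
        ⟪ f ∣ u ∣ Q ⟫
          ≡⟨ ⟪⟫-congˡ f Q (λ x → trans (sym (⊗-identityˡ (u x)))
              (trans (cong (_⊗ u x) (sym (sum-indicator i x)))
                  (⊗-distribʳ-sum (u x) (λ b → indicator i b x)))) ⟩
        ⟪ f ∣ (λ x → sum λ b → indicator i b x ⊗ u x) ∣ Q ⟫
          ≡⟨ ⟪⟫-sumˡ f (λ b x → indicator i b x ⊗ u x) Q ⟩
        sum (λ b → ⟪ f ∣ (λ x → indicator i b x ⊗ u x) ∣ Q ⟫)
          ≡⟨ sum-cong-≗ (λ b → part-≈ b (Deg-≤ (ℕ.n≤1+n a) dQ)) ⟩
        sum (λ b → ⟪ f ∣ part b ∣ Q ⟫)  ≡⟨ ⟪⟫-sumˡ f part Q ⟨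
        ⟪ f ∣ (λ x → sum λ b → part b x) ∣ Q ⟫  ∎

    -- `is` lists the coordinates not yet diagonalised; each is removed by splitting u into q
    -- components. When none is left, u is a simultaneous eigenvector and contributes one point
    -- mass.
    decomposes : ∀ is {u} → Deg a u → (∀ i → i ∈ is ⊎ ∃[ b ] Eigen u i b) → Decomposes u
    decomposes [] {u} du eigen = eigen-decomposes (tabulate (proj₁ ∘ value)) du λ i →
      subst (Eigen u i) (sym (Vec.lookup∘tabulate (proj₁ ∘ value) i)) (proj₂ (value i))
      where
      value : ∀ i → ∃[ b ] Eigen u i b
      value i with inj₂ e ← eigen i = e
    decomposes (i ∷ is) {u} du eigen = h , agree , visible
      where
      open Localise u du i
      pieces : ∀ b → Decomposes (part b)
      pieces b = decomposes is (part-degree b) λ j → inherit j (eigen j)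
        where
        inherit : ∀ j → j ∈ i ∷ is ⊎ (∃[ c ] Eigen u j c) → j ∈ is ⊎ (∃[ c ] Eigen (part b) j c)
        inherit j (inj₁ (here refl)) = inj₂ (b , part-eigen b)
        inherit j (inj₁ (there j∈))  = inj₁ j∈
        inherit j (inj₂ (c , e))     = inj₂ (c , part-preserves b e)
      h : Func n
      h x = sum λ b → proj₁ (pieces b) x
      agree : ∀ {P} → Deg (suc t) P → ⟪ f ∣ u ∣ P ⟫ ≡ E (λ x → h x ⊗ P x)
      agree {P} dP = begin
        ⟪ f ∣ u ∣ P ⟫  ≡⟨ sum-parts dP ⟩
        ⟪ f ∣ (λ x → sum λ b → part b x) ∣ P ⟫  ≡⟨ ⟪⟫-sumˡ f part P ⟩
        sum (λ b → ⟪ f ∣ part b ∣ P ⟫)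
          ≡⟨ sum-cong-≗ (λ b → proj₁ (proj₂ (pieces b)) dP) ⟩
        sum (λ b → E (λ x → proj₁ (pieces b) x ⊗ P x))  ≡⟨ E-sum (λ b x → proj₁ (pieces b) x ⊗ P x) ⟨
        E (λ x → sum λ b → proj₁ (pieces b) x ⊗ P x)
          ≡⟨ E-cong (λ x → ⊗-distribʳ-sum (P x) (λ b → proj₁ (pieces b) x)) ⟨
        E (λ x → h x ⊗ P x)  ∎
      visible : ∀ z → h z ≢ 0𝔽 → Visible f a (suc t) z
      visible z hz≢0 = let b , ≢0 = sum≢0 hz≢0 in proj₂ (proj₂ (pieces b)) z ≢0

    -- Decomposing the constant 1 gives agreement up to degree t + 1. In a product u w with deg u ≤
    -- t + 1 and deg w ≤ a, u is replaced by a congruent u′ of degree a. Both agree on the support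
    -- of h, since evaluation at a visible point is a pairing with a probe of degree a, and u′ w has
    -- degree 2a, which is already covered.
    flat-extension : Σ[ h ∈ Func n ] (∀ {P} → Deg (suc (a + t)) P → E (λ x → f x ⊗ P x) ≡ E
        (λ x → h x ⊗ P x)) ×
                            ((z : Vec K n) → h z ≢ 0𝔽 → Visible f a (suc t) z)
    flat-extension = h , (λ dP → Deg-product (suc t) agree-additive agree-product
        (Deg-≤ (s≤s (ℕ.≤-reflexive (ℕ.+-comm a t))) dP)) , visible
      where
      decomposition = decomposes (allFin n) (const 1𝔽) (λ i → inj₁ (∈-allFin i))
      h : Func n
      h = proj₁ decomposition
      agree : ∀ {P} → Deg (suc t) P → ⟪ f ∣ 𝟏 ∣ P ⟫ ≡ E (λ x → h x ⊗ P x)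
      agree = proj₁ (proj₂ decomposition)
      visible = proj₂ (proj₂ decomposition)
      agree-additive : Additive (λ P → E (λ x → f x ⊗ P x) ≡ E (λ x → h x ⊗ P x))
      agree-additive .Φ-⊕ {P} {Q} p r = trans (split f) (trans (cong₂ _⊕_ p r) (sym (split h)))
        where
        split : ∀ g → E (λ x → g x ⊗ (P x ⊕ Q x)) ≡ E (λ x → g x ⊗ P x) ⊕ E (λ x → g x ⊗ Q x)
        split g = trans (E-cong λ x → ⊗-distribˡ-⊕ (g x) (P x) (Q x))
            (E-⊕ (λ x → g x ⊗ P x) (λ x → g x ⊗ Q x))
      agree-additive .Φ-≗ P≗Q p = trans (E-cong λ x → cong (f x ⊗_) (sym (P≗Q x)))
          (trans p (E-cong λ x → cong (h x ⊗_) (P≗Q x)))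
      a+a≤1+t : a + a ≤ suc t
      a+a≤1+t = ℕ.≤-trans (ℕ.m≤m+n (a + a) q) slack
      agree-product : ∀ {u w} → Deg (suc t) u → Deg a w → ⟪ f ∣ u ∣ w ⟫ ≡ E (λ x → h x ⊗ (u x ⊗ w x))
      agree-product {u} {w} du dw =
        let u′ , du′ , u≈u′ = reduce-to (ℕ.≤-reflexive (cong suc (ℕ.+-comm t a))) du (ℕ.≤-trans (ℕ.m≤m+n a a) a+a≤1+t)
            same : ∀ z → h z ⊗ u z ≡ h z ⊗ u′ z
            same z = case-zero (h z Fin.≟ 0𝔽) (λ hz≢0 → let v = visible z hz≢0 in ⊗-cancelˡ _ (v .mass≢0)
              (trans (sym (v .point du)) (trans (⟪⟫-comm f (v .probe) u) (trans (u≈u′ (v .degree))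
                (trans (⟪⟫-comm f u′ (v .probe))
                    (v .point (Deg-≤ (ℕ.≤-trans (ℕ.m≤m+n a a) a+a≤1+t) du′)))))))
        in begin
          ⟪ f ∣ u ∣ w ⟫  ≡⟨ u≈u′ dw ⟩
          ⟪ f ∣ u′ ∣ w ⟫  ≡⟨ E-cong (λ x → cong (f x ⊗_) (⊗-identityˡ (u′ x ⊗ w x))) ⟨
          ⟪ f ∣ 𝟏 ∣ (λ x → u′ x ⊗ w x) ⟫  ≡⟨ agree (Deg-≤ a+a≤1+t (Deg-⊗ du′ dw)) ⟩
          E (λ x → h x ⊗ (u′ x ⊗ w x))
            ≡⟨ E-cong (λ x → trans (sym (⊗-assoc (h x) (u′ x) (w x)))
                (trans (cong (_⊗ w x) (sym (same x))) (⊗-assoc (h x) (u x) (w x)))) ⟩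
          E (λ x → h x ⊗ (u x ⊗ w x))  ∎
        where
        case-zero : ∀ {z} {b c} → Dec (h z ≡ 0𝔽) → (h z ≢ 0𝔽 → b ≡ c) → h z ⊗ b ≡ h z ⊗ c
        case-zero {b = b} {c} (yes hz≡0) _  =
            trans (trans (cong (_⊗ b) hz≡0) (⊗-zeroˡ b)) (sym (trans (cong (_⊗ c) hz≡0) (⊗-zeroˡ c)))
        case-zero {z} (no  hz≢0) eq = cong (h z ⊗_) (eq hz≢0)

funToFin-cong : ∀ {m n} {f g : Fin m → Fin n} → f ≗ g → funToFin f ≡ funToFin g
funToFin-cong {zero}  f≗g = refl
funToFin-cong {suc m} f≗g = cong₂ combine (f≗g zero) (funToFin-cong (f≗g ∘ suc))

-- Spanning sets on finite point sets, and Newton interpolation.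

module Dimension {q : ℕ} (𝔽 : PrimeField q) where
  open PrimeField 𝔽
  open Degree 𝔽
  open Additive
  open Duality 𝔽
  open Alternative 𝔽
  open FlatExtension 𝔽
  open Visible
  open Solver using (solve; con; _:+_; _:*_; _:=_)
  open ≡-Reasoning

  combo : ∀ {n m} → Vec (Func n) m → Vec K m → Func n
  combo []      []       x = 0𝔽
  combo (b ∷ B) (c ∷ cs) x = c ⊗ b x ⊕ combo B cs x

  combo-⊕ : ∀ {n m} (B : Vec (Func n) m) cs ds x →
    combo B (Vec.zipWith _⊕_ cs ds) x ≡ combo B cs x ⊕ combo B ds x
  combo-⊕ []      []       []       x = sym (⊕-identityˡ 0𝔽)
  combo-⊕ (b ∷ B) (c ∷ cs) (d ∷ ds) x = trans (cong ((c ⊕ d) ⊗ b x ⊕_) (combo-⊕ B cs ds x))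
    (solve 5 (λ c d b u v → (c :+ d) :* b :+ (u :+ v) := (c :* b :+ u) :+ (d :* b :+ v)) refl c d (b x)
        (combo B cs x) (combo B ds x))

  combo-⊗ : ∀ {n m} (B : Vec (Func n) m) a cs x → combo B (Vec.map (a ⊗_) cs) x ≡ a ⊗ combo B cs x
  combo-⊗ []      a []       x = sym (⊗-zeroʳ a)
  combo-⊗ (b ∷ B) a (c ∷ cs) x = trans (cong (a ⊗ c ⊗ b x ⊕_) (combo-⊗ B a cs x))
    (solve 4 (λ a c b u → a :* c :* b :+ a :* u := a :* (c :* b :+ u)) refl a c (b x) (combo B cs x))

  combo-++ : ∀ {n m m′} (B : Vec (Func n) m) (B′ : Vec (Func n) m′) cs cs′ x →
    combo (B ++ B′) (cs ++ cs′) x ≡ combo B cs x ⊕ combo B′ cs′ x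
  combo-++ []      B′ []       cs′ x = sym (⊕-identityˡ _)
  combo-++ (b ∷ B) B′ (c ∷ cs) cs′ x =
      trans (cong (c ⊗ b x ⊕_) (combo-++ B B′ cs cs′ x)) (sym (⊕-assoc _ _ _))

  combo-map : ∀ {n m} (b : Func n) (B : Vec (Func n) m) cs x →
    combo (Vec.map (λ g x → b x ⊗ g x) B) cs x ≡ b x ⊗ combo B cs x
  combo-map b []      []       x = sym (⊗-zeroʳ (b x))
  combo-map b (g ∷ B) (c ∷ cs) x = trans (cong (c ⊗ (b x ⊗ g x) ⊕_) (combo-map b B cs x))
    (solve 4 (λ b c g u → c :* (b :* g) :+ b :* u := b :* (c :* g :+ u)) refl (b x) c (g x) (combo B cs x))

  products : ∀ {n m m′} → Vec (Func n) m → Vec (Func n) m′ → Vec (Func n) (m * m′)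
  products []      C = []
  products (b ∷ B) C = Vec.map (λ g x → b x ⊗ g x) C ++ products B C

  powers : ∀ {n m} → Vec (Func n) m → ∀ k → Vec (Func n) (m ^ k)
  powers B zero    = (λ _ → 1𝔽) ∷ []
  powers B (suc k) = products B (powers B k)

  tensor-coefficients : ∀ {m m′} → Vec K m → Vec K m′ → Vec K (m * m′)
  tensor-coefficients []       ds = []
  tensor-coefficients (c ∷ cs) ds = Vec.map (c ⊗_) ds ++ tensor-coefficients cs ds

  combo-products : ∀ {n m m′} (B : Vec (Func n) m) (C : Vec (Func n) m′) cs ds x →
    combo (products B C) (tensor-coefficients cs ds) x ≡ combo B cs x ⊗ combo C ds x
  combo-products []      C []       ds x = sym (⊗-zeroˡ _)
  combo-products (b ∷ B) C (c ∷ cs) ds x = begin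
    combo (Vec.map (λ g x → b x ⊗ g x) C ++ products B C) (Vec.map (c ⊗_) ds ++ tensor-coefficients cs ds) x
      ≡⟨ combo-++ (Vec.map (λ g x → b x ⊗ g x) C) (products B C) (Vec.map (c ⊗_) ds)
          (tensor-coefficients cs ds) x ⟩
    combo (Vec.map (λ g x → b x ⊗ g x) C) (Vec.map (c ⊗_) ds) x ⊕ combo (products B C)
        (tensor-coefficients cs ds) x
      ≡⟨ cong₂ _⊕_ (trans (combo-map b C (Vec.map (c ⊗_) ds) x) (cong (b x ⊗_) (combo-⊗ C c ds x)))
          (combo-products B C cs ds x) ⟩
    b x ⊗ (c ⊗ combo C ds x) ⊕ combo B cs x ⊗ combo C ds x
      ≡⟨ solve 4 (λ b c u v → b :* (c :* v) :+ u :* v := (c :* b :+ u) :* v) refl (b x) c (combo B cs x)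
          (combo C ds x) ⟩
    (c ⊗ b x ⊕ combo B cs x) ⊗ combo C ds x
      ∎

  Spanned : ∀ {n m} → (Vec K n → Set) → Vec (Func n) m → Func n → Set
  Spanned {m = m} S B P = Σ[ cs ∈ Vec K m ] (∀ x → S x → P x ≡ combo B cs x)

  Additive-Spanned : ∀ {n m} (S : Vec K n → Set) (B : Vec (Func n) m) → Additive (Spanned S B)
  Additive-Spanned S B .Φ-⊕ (cs , p) (ds , r) = Vec.zipWith _⊕_ cs ds , λ x x∈ →
    trans (cong₂ _⊕_ (p x x∈) (r x x∈)) (sym (combo-⊕ B cs ds x))
  Additive-Spanned S B .Φ-≗ f≗g (cs , p) = cs , λ x x∈ → trans (sym (f≗g x)) (p x x∈)

  powers-span : ∀ {n m e} (S : Vec K n → Set) (B : Vec (Func n) m) → (∀ {P} → Deg e P → Spanned S B P) →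
    ∀ k {P} → Deg (k * e) P → Spanned S (powers B k) P
  powers-span S B span zero dP = Deg-span {d = 0} (Additive-Spanned S (powers B 0))
    (λ { c (Any.here refl) → (c ∷ []) , λ x _ → sym (⊕-identityʳ (c ⊗ 1𝔽)) }) dP
  powers-span {e = e} S B span (suc k) dP = Deg-product e (Additive-Spanned S (powers B (suc k)))
    (λ du dw → let cs , p = span du ; ds , r = powers-span S B span k dw in
      tensor-coefficients cs ds , λ x x∈ →
          trans (cong₂ _⊗_ (p x x∈) (r x x∈)) (sym (combo-products B (powers B k) cs ds x))) dP

  -- All q^N functions on the points z i are restrictions of the q^M combinations of B.
  independent⇒≤ : ∀ {n N M} {S : Vec K n → Set} (B : Vec (Func n) M) (z : Fin N → Vec K n)
      (w : Fin N → Func n) →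
    (∀ i → S (z i)) → (∀ i → Spanned S B (w i)) →
    (∀ {i j} → i ≢ j → w i (z j) ≡ 0𝔽) → (∀ i → w i (z i) ≢ 0𝔽) → N ≤ M
  independent⇒≤ {n} {N} {M} {S} B z w z∈ span off on with N ℕ.≤? M
  ... | yes N≤M = N≤M
  ... | no  N≰M = contradiction (Fin.injective⇒≤ {f = encode} encode-injective)
      (ℕ.<⇒≱ (ℕ.^-monoʳ-< q 1<q (ℕ.≰⇒> N≰M)))
    where
    P : (Fin N → K) → Func n
    P c x = sum λ i → c i ⊗ w i x

    Spanned-sum : ∀ {m} (u : Fin m → Func n) → (∀ i → Spanned S B (u i)) →
        Spanned S B (λ x → sum λ i → u i x)
    Spanned-sum {zero}  u _  = Vec.replicate M 0𝔽 , λ x _ → sym (combo-0 B x)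
      where
      combo-0 : ∀ {m} (B : Vec (Func n) m) x → combo B (Vec.replicate m 0𝔽) x ≡ 0𝔽
      combo-0 []      x = refl
      combo-0 (b ∷ B) x = trans (cong₂ _⊕_ (⊗-zeroˡ (b x)) (combo-0 B x)) (⊕-identityˡ 0𝔽)
    Spanned-sum {suc m} u su = Additive-Spanned S B .Φ-⊕ (su zero) (Spanned-sum (u ∘ suc) (su ∘ suc))

    P-spanned : ∀ c → Spanned S B (P c)
    P-spanned c = Spanned-sum (λ i x → c i ⊗ w i x) λ i → let cs , p = span i in
      Vec.map (c i ⊗_) cs , λ x x∈ → trans (cong (c i ⊗_) (p x x∈)) (sym (combo-⊗ B (c i) cs x))

    P-at : ∀ c j → P c (z j) ≡ w j (z j) ⊗ c j
    P-at c j = trans (sum-single j λ i i≢j → trans (cong (c i ⊗_) (off i≢j)) (⊗-zeroʳ (c i))) (⊗-comm _ _)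

    encode : Fin (q ^ N) → Fin (q ^ M)
    encode i = funToFin (lookup (proj₁ (P-spanned (finToFun i))))

    encode-injective : ∀ {i j} → encode i ≡ encode j → i ≡ j
    encode-injective {i} {j} eq = trans (sym (Fin.funToFin-finToFin {N} i))
        (trans (funToFin-cong same) (Fin.funToFin-finToFin {N} j))
      where
      cs≡ds : proj₁ (P-spanned (finToFun i)) ≡ proj₁ (P-spanned (finToFun j))
      cs≡ds = trans (sym (Vec.tabulate∘lookup _)) (trans (Vec.tabulate-cong (λ l →
        trans (sym (Fin.finToFun-funToFin _ l))
            (trans (cong (λ m → finToFun m l) eq) (Fin.finToFun-funToFin _ l)))) (Vec.tabulate∘lookup _))
      same : finToFun i ≗ finToFun j
      same l = ⊗-cancelˡ (w l (z l)) (on l) (begin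
        w l (z l) ⊗ finToFun i l  ≡⟨ P-at (finToFun i) l ⟨
        P (finToFun i) (z l)  ≡⟨ proj₂ (P-spanned (finToFun i)) (z l) (z∈ l) ⟩
        combo B (proj₁ (P-spanned (finToFun i))) (z l) ≡⟨ cong (λ cs → combo B cs (z l)) cs≡ds ⟩
        combo B (proj₁ (P-spanned (finToFun j))) (z l) ≡⟨ proj₂ (P-spanned (finToFun j)) (z l) (z∈ l) ⟨
        P (finToFun j) (z l)  ≡⟨ P-at (finToFun j) l ⟩
        w l (z l) ⊗ finToFun j l  ∎)

  Point : ℕ → Set
  Point n = Vec K n

  -- Newton interpolation data: a basis function is 1 at its own node and 0 at the nodes behind it
  -- in the vector, with no condition at those in front.
  data Triangular {n} (e : ℕ) : ∀ {m} → Vec (Point n) m → Vec (Func n) m → Set where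
    []   : Triangular e [] []
    cons : ∀ {m y D} {ys : Vec (Point n) m} {Ds} → Deg e D → D y ≡ 1𝔽 → (∀ i → D (lookup ys i) ≡ 0𝔽) →
           Triangular e ys Ds → Triangular e (y ∷ ys) (D ∷ Ds)

  -- The remainder of Newton interpolation. The tail is handled first; for triangular data D
  -- vanishes there, so the correction at y leaves the zeros at the tail nodes intact.
  residue : ∀ {n m} → Vec (Point n) m → Vec (Func n) m → Func n → Func n
  residue []       []       P x = P x
  residue (y ∷ ys) (D ∷ Ds) P x = residue ys Ds P x ⊕ ⊖ residue ys Ds P y ⊗ D x

  residue-⊕ : ∀ {n m} (ys : Vec (Point n) m) Ds P Q x →
    residue ys Ds (λ x → P x ⊕ Q x) x ≡ residue ys Ds P x ⊕ residue ys Ds Q x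
  residue-⊕ []       []       P Q x = refl
  residue-⊕ (y ∷ ys) (D ∷ Ds) P Q x = begin
    residue ys Ds (λ x → P x ⊕ Q x) x ⊕ ⊖ residue ys Ds (λ x → P x ⊕ Q x) y ⊗ D x
      ≡⟨ cong₂ (λ u v → u ⊕ ⊖ v ⊗ D x) (residue-⊕ ys Ds P Q x) (residue-⊕ ys Ds P Q y) ⟩
    (residue ys Ds P x ⊕ residue ys Ds Q x) ⊕ ⊖ (residue ys Ds P y ⊕ residue ys Ds Q y) ⊗ D x
      ≡⟨ cong (λ u → (residue ys Ds P x ⊕ residue ys Ds Q x) ⊕ u ⊗ D x)
          (sym (⊖-⊕-comm (residue ys Ds P y) (residue ys Ds Q y))) ⟩
    (residue ys Ds P x ⊕ residue ys Ds Q x) ⊕ (⊖ residue ys Ds P y ⊕ ⊖ residue ys Ds Q y) ⊗ D x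
      ≡⟨ solve 5 (λ a b c d e → (a :+ b) :+ (c :+ d) :* e := (a :+ c :* e) :+ (b :+ d :* e)) refl
           (residue ys Ds P x) (residue ys Ds Q x) (⊖ residue ys Ds P y) (⊖ residue ys Ds Q y) (D x) ⟩
    (residue ys Ds P x ⊕ ⊖ residue ys Ds P y ⊗ D x) ⊕ (residue ys Ds Q x ⊕ ⊖ residue ys Ds Q y ⊗ D x)
      ∎

  residue-⊗ : ∀ {n m} (ys : Vec (Point n) m) Ds c P x →
    residue ys Ds (λ x → c ⊗ P x) x ≡ c ⊗ residue ys Ds P x
  residue-⊗ []       []       c P x = refl
  residue-⊗ (y ∷ ys) (D ∷ Ds) c P x = begin
    residue ys Ds (λ x → c ⊗ P x) x ⊕ ⊖ residue ys Ds (λ x → c ⊗ P x) y ⊗ D x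
      ≡⟨ cong₂ (λ u v → u ⊕ ⊖ v ⊗ D x) (residue-⊗ ys Ds c P x) (residue-⊗ ys Ds c P y) ⟩
    c ⊗ residue ys Ds P x ⊕ ⊖ (c ⊗ residue ys Ds P y) ⊗ D x
      ≡⟨ cong (λ u → c ⊗ residue ys Ds P x ⊕ u ⊗ D x) (⊖-distribʳ-⊗ c (residue ys Ds P y)) ⟩
    c ⊗ residue ys Ds P x ⊕ c ⊗ ⊖ residue ys Ds P y ⊗ D x
      ≡⟨ solve 4 (λ c a b d → c :* a :+ c :* b :* d := c :* (a :+ b :* d)) refl c (residue ys Ds P x)
          (⊖ residue ys Ds P y) (D x) ⟩
    c ⊗ (residue ys Ds P x ⊕ ⊖ residue ys Ds P y ⊗ D x)
      ∎

  residue-≗ : ∀ {n m} (ys : Vec (Point n) m) Ds {P Q} → P ≗ Q → residue ys Ds P ≗ residue ys Ds Q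
  residue-≗ []       []       P≗Q x = P≗Q x
  residue-≗ (y ∷ ys) (D ∷ Ds) P≗Q x =
    cong₂ (λ u v → u ⊕ ⊖ v ⊗ D x) (residue-≗ ys Ds P≗Q x) (residue-≗ ys Ds P≗Q y)

  residue-Deg : ∀ {n m e} {ys : Vec (Point n) m} {Ds P} → Triangular e ys Ds → Deg e P →
      Deg e (residue ys Ds P)
  residue-Deg []               dP = resp≗ (λ _ → refl) dP
  residue-Deg (cons dD _ _ tr) dP = add (residue-Deg tr dP) (Deg-scale _ dD)

  residue-vanishes : ∀ {n m e} {ys : Vec (Point n) m} {Ds} → Triangular e ys Ds → ∀ P i →
      residue ys Ds P (lookup ys i) ≡ 0𝔽
  residue-vanishes {ys = y ∷ ys} {D ∷ Ds} (cons _ Dy≡1 _ tr) P zero = begin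
    residue ys Ds P y ⊕ ⊖ residue ys Ds P y ⊗ D y
      ≡⟨ cong (λ u → residue ys Ds P y ⊕ ⊖ residue ys Ds P y ⊗ u) Dy≡1 ⟩
    residue ys Ds P y ⊕ ⊖ residue ys Ds P y ⊗ 1𝔽  ≡⟨ cong (residue ys Ds P y ⊕_) (⊗-identityʳ _) ⟩
    residue ys Ds P y ⊕ ⊖ residue ys Ds P y  ≡⟨ ⊖-inverseʳ _ ⟩
    0𝔽  ∎
  residue-vanishes {ys = y ∷ ys} {D ∷ Ds} (cons _ _ D≡0 tr) P (suc i) = trans
    (cong₂ (λ u v → u ⊕ ⊖ residue ys Ds P y ⊗ v) (residue-vanishes tr P i) (D≡0 i))
    (trans (⊕-identityˡ _) (⊗-zeroʳ _))

  residue-id : ∀ {n m} (ys : Vec (Point n) m) Ds {P : Func n} → (∀ i → P (lookup ys i) ≡ 0𝔽) →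
      residue ys Ds P ≗ P
  residue-id []       []       P≡0 x = refl
  residue-id (y ∷ ys) (D ∷ Ds) {P} P≡0 x = begin
    residue ys Ds P x ⊕ ⊖ residue ys Ds P y ⊗ D x
      ≡⟨ cong₂ (λ u v → u ⊕ ⊖ v ⊗ D x) (residue-id ys Ds (P≡0 ∘ suc) x)
          (trans (residue-id ys Ds (P≡0 ∘ suc) y) (P≡0 zero)) ⟩
    P x ⊕ ⊖ 0𝔽 ⊗ D x  ≡⟨ cong (λ u → P x ⊕ u ⊗ D x) ⊖0≡0 ⟩
    P x ⊕ 0𝔽 ⊗ D x  ≡⟨ cong (P x ⊕_) (⊗-zeroˡ (D x)) ⟩
    P x ⊕ 0𝔽  ≡⟨ ⊕-identityʳ (P x) ⟩
    P x  ∎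

  residue-combo : ∀ {n m} (ys : Vec (Point n) m) Ds P →
      Σ[ cs ∈ Vec K m ] (∀ x → P x ≡ residue ys Ds P x ⊕ combo Ds cs x)
  residue-combo []       []       P = [] , λ x → sym (⊕-identityʳ (P x))
  residue-combo (y ∷ ys) (D ∷ Ds) P with cs , p ← residue-combo ys Ds P =
      (r ∷ cs) , λ x → trans (p x) (sym (begin
    (residue ys Ds P x ⊕ ⊖ r ⊗ D x) ⊕ (r ⊗ D x ⊕ combo Ds cs x)
      ≡⟨ solve 5 (λ a m d r u → (a :+ m :* d) :+ (r :* d :+ u) := (a :+ u) :+ (m :+ r) :* d) refl
          (residue ys Ds P x) (⊖ r) (D x) r (combo Ds cs x) ⟩
    (residue ys Ds P x ⊕ combo Ds cs x) ⊕ (⊖ r ⊕ r) ⊗ D x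
      ≡⟨ cong (λ u → (residue ys Ds P x ⊕ combo Ds cs x) ⊕ u ⊗ D x) (⊖-inverseˡ r) ⟩
    (residue ys Ds P x ⊕ combo Ds cs x) ⊕ 0𝔽 ⊗ D x
      ≡⟨ cong ((residue ys Ds P x ⊕ combo Ds cs x) ⊕_) (⊗-zeroˡ (D x)) ⟩
    (residue ys Ds P x ⊕ combo Ds cs x) ⊕ 0𝔽  ≡⟨ ⊕-identityʳ _ ⟩
    residue ys Ds P x ⊕ combo Ds cs x  ∎))
    where r = residue ys Ds P y

  record Interpolation {n} (e : ℕ) (zs : List (Point n)) : Set where
    field
      rank       : ℕ
      nodes      : Vec (Point n) rank
      basis      : Vec (Func n) rank
      triangular : Triangular e nodes basis
      nodes∈     : ∀ i → lookup nodes i ∈ zs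
      maximal    : ∀ {P} → Deg e P → (∀ i → P (lookup nodes i) ≡ 0𝔽) → All (λ z → P z ≡ 0𝔽) zs

  open Interpolation

  -- Greedy choice: z becomes a node when the residue of some generator is nonzero at z. If there is
  -- none, residues of all degree e polynomials vanish at z, and a polynomial that is zero at the
  -- nodes is its own residue.
  interpolation : ∀ {n} e (zs : List (Point n)) → Interpolation e zs
  interpolation e [] = record
    { rank = 0 ; nodes = [] ; basis = [] ; triangular = [] ; nodes∈ = λ () ; maximal = λ _ _ → [] }
  interpolation {n} e (z ∷ zs) with interpolation e zs
  ... | I with all-or {C = ∃[ R ] Deg e R × (∀ i → R (lookup (I .nodes) i) ≡ 0𝔽) × R z ≢ 0𝔽}
      (generators n e) test
    where
    test : ∀ {g} → g ∈ generators n e → residue (I .nodes) (I .basis) g z ≡ 0𝔽 ⊎ _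
    test {g} g∈ with residue (I .nodes) (I .basis) g z Fin.≟ 0𝔽
    ... | yes ≡0 = inj₁ ≡0
    ... | no  ≢0 = inj₂ (residue (I .nodes) (I .basis) g ,
            residue-Deg (I .triangular) (All.lookup (Deg-generators n e) g∈) , residue-vanishes
                (I .triangular) g , ≢0)
  ... | inj₁ all0 = record
    { rank = I .rank ; nodes = I .nodes ; basis = I .basis ; triangular = I .triangular
    ; nodes∈  = there ∘ I .nodes∈
    ; maximal = λ {P} dP P≡0 → trans (sym (residue-id (I .nodes) (I .basis) P≡0 z)) (vanish dP) ∷ I
        .maximal dP P≡0
    }
    where
    ad : Additive (λ P → residue (I .nodes) (I .basis) P z ≡ 0𝔽)
    ad .Φ-⊕ {P} {Q} p r = trans (residue-⊕ (I .nodes) (I .basis) P Q z)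
        (trans (cong₂ _⊕_ p r) (⊕-identityˡ 0𝔽))
    ad .Φ-≗ P≗Q p = trans (sym (residue-≗ (I .nodes) (I .basis) P≗Q z)) p
    vanish : ∀ {P} → Deg e P → residue (I .nodes) (I .basis) P z ≡ 0𝔽
    vanish = Deg-span ad λ c {g} g∈ → trans (residue-⊗ (I .nodes) (I .basis) c g z)
      (trans (cong (c ⊗_) (All.lookup all0 g∈)) (⊗-zeroʳ c))
  ... | inj₂ (R , dR , R≡0 , Rz≢0) with c , Rzc≡1 ← inverse (R z) Rz≢0 = record
    { rank = suc (I .rank) ; nodes = z ∷ I .nodes ; basis = (λ x → c ⊗ R x) ∷ I .basis
    ; triangular = cons (Deg-scale c dR) (trans (⊗-comm c (R z)) Rzc≡1)
        (λ i → trans (cong (c ⊗_) (R≡0 i)) (⊗-zeroʳ c)) (I .triangular)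
    ; nodes∈  = λ { zero → here refl ; (suc i) → there (I .nodes∈ i) }
    ; maximal = λ dP P≡0 → P≡0 zero ∷ I .maximal dP (P≡0 ∘ suc)
    }

  Interpolation-spans : ∀ {n e} {zs : List (Point n)} (I : Interpolation e zs) {P} → Deg e P →
      Spanned (_∈ zs) (I .basis) P
  Interpolation-spans I {P} dP with cs , p ← residue-combo (I .nodes) (I .basis) P = cs , λ z z∈ →
    trans (p z) (trans (cong (_⊕ combo (I .basis) cs z)
      (All.lookup (I .maximal (residue-Deg (I .triangular) dP) (residue-vanishes (I .triangular) P)) z∈))
          (⊕-identityˡ _))

  -- The pairing of the two probes with an extra factor x_i can be evaluated at z or at z′. Compared
  -- with the pairing without that factor, a nonzero value of the probe forces all coordinates of z
  -- and z′ to agree.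
  probe-off : ∀ {n f a t z z′} → suc a ≤ t → (v : Visible {n} f a t z) (v′ : Visible f a t z′) →
    z ≢ z′ → v .probe z′ ≡ 0𝔽
  probe-off {n} {f} {a} {t} {z} {z′} a<t v v′ z≢z′ with v .probe z′ Fin.≟ 0𝔽
  ... | yes ≡0 = ≡0
  ... | no  ≢0 = contradiction (vec-ext λ i → ⊗-cancelˡ X (⊗-≢0 (v′ .mass≢0) ≢0) (begin
          X ⊗ lookup z i  ≡⟨ cong (_⊗ lookup z i) X≡X′ ⟩
          X′ ⊗ lookup z i
            ≡⟨ solve 3 (λ m p y → m :* p :* y := m :* (y :* p)) refl ⟪ f ∣ v .probe ∣ 𝟏 ⟫ (v′ .probe z)
                (lookup z i) ⟩
          ⟪ f ∣ v .probe ∣ 𝟏 ⟫ ⊗ (lookup z i ⊗ v′ .probe z)  ≡⟨ v .point (Deg-≤ a<t (var i (v′ .degree))) ⟨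
          ⟪ f ∣ v .probe ∣ (λ x → lookup x i ⊗ v′ .probe x) ⟫ ≡⟨ ⟪⟫-swap i ⟩
          ⟪ f ∣ v′ .probe ∣ (λ x → lookup x i ⊗ v .probe x) ⟫ ≡⟨ v′ .point (Deg-≤ a<t (var i (v .degree))) ⟩
          ⟪ f ∣ v′ .probe ∣ 𝟏 ⟫ ⊗ (lookup z′ i ⊗ v .probe z′)
            ≡⟨ solve 3 (λ m p y → m :* (y :* p) := m :* p :* y) refl ⟪ f ∣ v′ .probe ∣ 𝟏 ⟫ (v .probe z′)
                (lookup z′ i) ⟩
          X ⊗ lookup z′ i  ∎)) z≢z′
    where
    X X′ : K
    X  = ⟪ f ∣ v′ .probe ∣ 𝟏 ⟫ ⊗ v .probe z′
    X′ = ⟪ f ∣ v .probe ∣ 𝟏 ⟫ ⊗ v′ .probe z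
    a≤t : a ≤ t
    a≤t = ℕ.≤-trans (ℕ.n≤1+n a) a<t
    X≡X′ : X ≡ X′
    X≡X′ = trans (sym (v′ .point (Deg-≤ a≤t (v .degree)))) (trans (⟪⟫-comm f (v′ .probe) (v .probe))
        (v .point (Deg-≤ a≤t (v′ .degree))))
    ⟪⟫-swap : ∀ i → ⟪ f ∣ v .probe ∣ (λ x → lookup x i ⊗ v′ .probe x) ⟫ ≡ ⟪ f ∣ v′ .probe ∣
        (λ x → lookup x i ⊗ v .probe x) ⟫
    ⟪⟫-swap i = trans (sym (⟪⟫-shift f (v .probe) (v′ .probe) (λ x → lookup x i))) (⟪⟫-comm f _ (v′ .probe))
    vec-ext : ∀ {m} {x y : Vec K m} → (∀ i → lookup x i ≡ lookup y i) → x ≡ y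
    vec-ext {x = x} {y} eq = trans (sym (Vec.tabulate∘lookup x))
        (trans (Vec.tabulate-cong eq) (Vec.tabulate∘lookup y))

  -- The mass of the probe is a sum over the support of h, where `probe-off` kills all points but z;
  -- so the value at z cannot vanish too.
  probe-on : ∀ {n} {f h : Func n} {a t} → suc a ≤ t →
      (∀ {P} → Deg a P → E (λ x → f x ⊗ P x) ≡ E (λ x → h x ⊗ P x)) →
    (visible : (z : Point n) → h z ≢ 0𝔽 → Visible f a t z) → ∀ z (hz≢0 : h z ≢ 0𝔽) →
        visible z hz≢0 .probe z ≢ 0𝔽
  probe-on {f = f} {h} a<t agree visible z hz≢0 wz≡0 = v .mass≢0 (begin
    ⟪ f ∣ w ∣ 𝟏 ⟫  ≡⟨ E-cong (λ x → cong (f x ⊗_) (⊗-identityʳ (w x))) ⟩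
    E (λ x → f x ⊗ w x)  ≡⟨ agree (v .degree) ⟩
    E (λ x → h x ⊗ w x)  ≡⟨ E-0 hw≡0 ⟩
    0𝔽  ∎)
    where
    v = visible z hz≢0
    w = v .probe
    hw≡0 : ∀ x → h x ⊗ w x ≡ 0𝔽
    hw≡0 x with h x Fin.≟ 0𝔽
    ... | yes hx≡0 = trans (cong (_⊗ w x) hx≡0) (⊗-zeroˡ (w x))
    ... | no  hx≢0 with Vec.≡-dec Fin._≟_ z x
    ...   | yes refl = trans (cong (h x ⊗_) wz≡0) (⊗-zeroʳ (h x))
    ...   | no  z≢x  = trans (cong (h x ⊗_) (probe-off a<t v (visible x hx≢0) z≢x)) (⊗-zeroʳ (h x))

-- Sums over lists and indicator functions.

∑ : ∀ {A : Set} → List A → (A → ℕ) → ℕ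
∑ []       g = 0
∑ (x ∷ xs) g = g x + ∑ xs g

∑-mono : ∀ {A : Set} (xs : List A) {g h : A → ℕ} → (∀ {x} → x ∈ xs → g x ≤ h x) → ∑ xs g ≤ ∑ xs h
∑-mono []       g≤h = z≤n
∑-mono (x ∷ xs) g≤h = ℕ.+-mono-≤ (g≤h (here refl)) (∑-mono xs (g≤h ∘ there))

∑-+ : ∀ {A : Set} (xs : List A) (g h : A → ℕ) → ∑ xs (λ x → g x + h x) ≡ ∑ xs g + ∑ xs h
∑-+ []       g h = refl
∑-+ (x ∷ xs) g h = trans (cong (g x + h x ℕ.+_) (∑-+ xs g h))
  (solve 4 (λ a b c d → (a :+ b) :+ (c :+ d) := (a :+ c) :+ (b :+ d)) refl (g x) (h x) (∑ xs g) (∑ xs h))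
  where open +-*-Solver

∑-*ˡ : ∀ {A : Set} c (xs : List A) (g : A → ℕ) → ∑ xs (λ x → c * g x) ≡ c * ∑ xs g
∑-*ˡ c []       g = sym (ℕ.*-zeroʳ c)
∑-*ˡ c (x ∷ xs) g = trans (cong (c * g x ℕ.+_) (∑-*ˡ c xs g)) (sym (ℕ.*-distribˡ-+ c (g x) (∑ xs g)))

∑-const : ∀ {A : Set} (xs : List A) c → ∑ xs (λ _ → c) ≡ length xs * c
∑-const []       c = refl
∑-const (x ∷ xs) c = cong (c ℕ.+_) (∑-const xs c)

∑-1 : ∀ {A : Set} (xs : List A) → ∑ xs (λ _ → 1) ≡ length xs
∑-1 xs = trans (∑-const xs 1) (ℕ.*-identityʳ (length xs))

∑-zero : ∀ {A : Set} (xs : List A) → ∑ xs (λ _ → 0) ≡ 0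
∑-zero xs = trans (∑-const xs 0) (ℕ.*-zeroʳ (length xs))

∑-swap : ∀ {A B : Set} (xs : List A) (ys : List B) (g : A → B → ℕ) →
  ∑ xs (λ x → ∑ ys (g x)) ≡ ∑ ys (λ y → ∑ xs λ x → g x y)
∑-swap []       ys g = sym (∑-zero ys)
∑-swap (x ∷ xs) ys g = trans (cong (∑ ys (g x) ℕ.+_) (∑-swap xs ys g))
    (sym (∑-+ ys (g x) (λ y → ∑ xs λ x → g x y)))

∑-++ : ∀ {A : Set} (xs ys : List A) g → ∑ (xs List.++ ys) g ≡ ∑ xs g + ∑ ys g
∑-++ []       ys g = refl
∑-++ (x ∷ xs) ys g = trans (cong (g x ℕ.+_) (∑-++ xs ys g)) (sym (ℕ.+-assoc (g x) _ _))

∑-map : ∀ {A B : Set} (f : A → B) xs (g : B → ℕ) → ∑ (map f xs) g ≡ ∑ xs (g ∘ f)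
∑-map f []       g = refl
∑-map f (x ∷ xs) g = cong (g (f x) ℕ.+_) (∑-map f xs g)

∑-tuples : ∀ {A : Set} (xs : List A) m (g : Vec A (suc m) → ℕ) →
  ∑ (tuples xs (suc m)) g ≡ ∑ xs (λ x → ∑ (tuples xs m) λ v → g (x ∷ v))
∑-tuples xs m g = go xs
  where
  go : ∀ ys → ∑ (cartesianProductWith _∷_ ys (tuples xs m)) g ≡ ∑ ys (λ x → ∑ (tuples xs m) λ v → g (x ∷ v))
  go []       = refl
  go (y ∷ ys) = trans (∑-++ (map (y ∷_) (tuples xs m)) _ g) (cong₂ _+_ (∑-map (y ∷_) (tuples xs m) g)
      (go ys))

length-tuples : ∀ {A : Set} (xs : List A) m → length (tuples xs m) ≡ length xs ^ m
length-tuples xs zero    = refl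
length-tuples xs (suc m) = begin
  length (tuples xs (suc m))  ≡⟨ ∑-1 (tuples xs (suc m)) ⟨
  ∑ (tuples xs (suc m)) (λ _ → 1)  ≡⟨ ∑-tuples xs m (λ _ → 1) ⟩
  ∑ xs (λ _ → ∑ (tuples xs m) λ _ → 1)  ≡⟨ ∑-const xs _ ⟩
  length xs * ∑ (tuples xs m) (λ _ → 1)
    ≡⟨ cong (length xs *_) (trans (∑-1 (tuples xs m)) (length-tuples xs m)) ⟩
  length xs * length xs ^ m  ∎
  where open ≡-Reasoning

𝟙 : ∀ {A : Set} → Dec A → ℕ
𝟙 (yes _) = 1
𝟙 (no _)  = 0

𝟙≤1 : ∀ {A : Set} (A? : Dec A) → 𝟙 A? ≤ 1
𝟙≤1 (yes _) = s≤s z≤n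
𝟙≤1 (no _)  = z≤n

𝟙-mono : ∀ {A B : Set} (A? : Dec A) (B? : Dec B) → (A → B) → 𝟙 A? ≤ 𝟙 B?
𝟙-mono (no _)  B?      f = z≤n
𝟙-mono (yes a) (yes _) f = ℕ.≤-refl
𝟙-mono (yes a) (no ¬b) f = contradiction (f a) ¬b

𝟙-no : ∀ {A : Set} (A? : Dec A) → ¬ A → 𝟙 A? ≡ 0
𝟙-no (yes a) ¬a = contradiction a ¬a
𝟙-no (no _)  ¬a = refl

𝟙-× : ∀ {A B C : Set} (A? : Dec A) (B? : Dec B) (C? : Dec C) → (A → B) → (A → C) → 𝟙 A? ≤ 𝟙 B? * 𝟙 C?
𝟙-× (no _)  B?      C?      f g = z≤n
𝟙-× (yes _) (yes _) (yes _) f g = ℕ.≤-refl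
𝟙-× (yes a) (no ¬b) C?      f g = contradiction (f a) ¬b
𝟙-× (yes a) (yes _) (no ¬c) f g = contradiction (g a) ¬c

length-filter-∑ : ∀ {A : Set} {P : Pred A _} (P? : Decidable P) xs → length (filter P? xs) ≡ ∑ xs (𝟙 ∘ P?)
length-filter-∑ P? []       = refl
length-filter-∑ P? (x ∷ xs) with P? x
... | yes _ = cong suc (length-filter-∑ P? xs)
... | no  _ = length-filter-∑ P? xs

∑-𝟙≤1 : ∀ {A : Set} {xs : List A} {P : A → Set} (P? : ∀ x → Dec (P x)) → Unique xs →
  (∀ {x y} → P x → P y → x ≡ y) → ∑ xs (𝟙 ∘ P?) ≤ 1
∑-𝟙≤1 P? [] _ = z≤n
∑-𝟙≤1 {xs = x ∷ xs} P? (x∉ ∷ uniq) same with P? x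
... | no  _  = ∑-𝟙≤1 P? uniq same
... | yes px = s≤s (ℕ.≤-trans (∑-mono xs λ {y} y∈ → ℕ.≤-reflexive
    (𝟙-no (P? y) λ py → All.lookup x∉ y∈ (same px py)))
    (ℕ.≤-reflexive (∑-zero xs)))

∑-𝟙<length : ∀ {A : Set} {xs : List A} {P : A → Set} (P? : ∀ x → Dec (P x)) {x} → x ∈ xs → ¬ P x →
  ∑ xs (𝟙 ∘ P?) ≤ length xs ∸ 1
∑-𝟙<length {xs = x ∷ xs} P? (here refl) ¬px = ℕ.≤-trans
  (ℕ.≤-reflexive (cong (_+ ∑ xs (𝟙 ∘ P?)) (𝟙-no (P? x) ¬px)))
  (ℕ.≤-trans (∑-mono xs λ {y} _ → 𝟙≤1 (P? y)) (ℕ.≤-reflexive (trans (∑-const xs 1) (ℕ.*-identityʳ _))))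
∑-𝟙<length {xs = x ∷ xs@(_ ∷ _)} P? (there x∈) ¬px = ℕ.+-mono-≤ (𝟙≤1 (P? x)) (∑-𝟙<length P? x∈ ¬px)

module _ {A : Set} (_≈_ : A → A → Set) (≈-sym : ∀ {x y} → x ≈ y → y ≈ x) (≈-trans : ∀ {x y z} → x ≈ y → y ≈ z → x ≈ z) where

  ∑-remove : ∀ {g : A → ℕ} {x ys} → (∀ {x y} → x ≈ y → g x ≡ g y) → Any (x ≈_) ys →
    Σ[ ys′ ∈ List A ] (∑ ys g ≡ g x + ∑ ys′ g) × (∀ {z} → Any (z ≈_) ys → z ≈ x ⊎ Any (z ≈_) ys′)
  ∑-remove {g} {ys = y ∷ ys} g-cong (here x≈y) = ys , cong (_+ ∑ ys g) (sym (g-cong x≈y)) ,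
    λ { (here z≈y) → inj₁ (≈-trans z≈y (≈-sym x≈y)) ; (there z∈) → inj₂ z∈ }
  ∑-remove {g} {x} {y ∷ ys} g-cong (there x∈) with ys′ , eq , keep ← ∑-remove {g} g-cong x∈ =
    y ∷ ys′ , trans (cong (g y ℕ.+_) eq) (solve 3 (λ a b c → a :+ (b :+ c) := b :+ (a :+ c)) refl (g y)
        (g x) (∑ ys′ g)) , keep′
    where
    open +-*-Solver
    keep′ : ∀ {z} → Any (z ≈_) (y ∷ ys) → z ≈ x ⊎ Any (z ≈_) (y ∷ ys′)
    keep′ (here z≈y) = inj₂ (here z≈y)
    keep′ (there z∈) with keep z∈
    ... | inj₁ z≈x = inj₁ z≈x
    ... | inj₂ z∈′ = inj₂ (there z∈′)

  -- As `xs` has no repetitions, its elements can be struck out of `ys` one after the other.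
  ∑-⊆ : ∀ {g : A → ℕ} {xs ys} → (∀ {x y} → x ≈ y → g x ≡ g y) → AllPairs (λ x y → ¬ x ≈ y) xs →
    All (λ x → Any (x ≈_) ys) xs → ∑ xs g ≤ ∑ ys g
  ∑-⊆ g-cong [] [] = z≤n
  ∑-⊆ {g} {x ∷ xs} g-cong (x≉ ∷ uniq) (x∈ ∷ xs⊆) with ys′ , eq , keep ← ∑-remove {g} g-cong x∈ =
    ℕ.≤-trans (ℕ.+-monoʳ-≤ (g x) (∑-⊆ g-cong uniq
        (All.tabulate λ {z} z∈ → strip (keep (All.lookup xs⊆ z∈)) (All.lookup x≉ z∈))))
      (ℕ.≤-reflexive (sym eq))
    where
    strip : ∀ {z} → z ≈ x ⊎ Any (z ≈_) ys′ → ¬ x ≈ z → Any (z ≈_) ys′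
    strip (inj₁ z≈x) x≉z = contradiction (≈-sym z≈x) x≉z
    strip (inj₂ z∈)  _   = z∈

-- Counting tuples of polynomials by averaging over translations.

module Counting {q : ℕ} (𝔽 : PrimeField q) where
  open PrimeField 𝔽
  open Degree 𝔽
  open Duality 𝔽
  open Alternative 𝔽
  open Leading 𝔽
  open HasCodegree
  open Family
  open Dimension 𝔽

  record Enumeration {n} (e : ℕ) (L : List (Func n)) : Set where
    field
      sound    : ∀ {P} → P ∈ L → Deg e P
      complete : ∀ {P} → Deg e P → Any (P ≗_) L
      unique   : AllPairs (λ P Q → ¬ P ≗ Q) L

  ∏ : ∀ {n k} → Vec (Func n) k → Func n
  ∏ = Vec.foldr′ (λ f g x → f x ⊗ g x) (λ _ → 1𝔽)

  ∏-cong : ∀ {n k} {Ps Qs : Vec (Func n) k} → Pointwise _≗_ Ps Qs → ∏ Ps ≗ ∏ Qs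
  ∏-cong []            x = refl
  ∏-cong (P≗Q ∷ Ps≗Qs) x = cong₂ _⊗_ (P≗Q x) (∏-cong Ps≗Qs x)

  ⊥-dec : ∀ {n} (f : Func n) t → Dec (f ⊥ t)
  ⊥-dec f t with ⊥? f t
  ... | inj₁ f⊥              = yes f⊥
  ... | inj₂ (Q , dQ , fQ≢0) = no λ f⊥ → fQ≢0 (f⊥ dQ)

  ⊥-resp : ∀ {n t} {f g : Func n} → f ≗ g → f ⊥ t → g ⊥ t
  ⊥-resp f≗g f⊥ {Q} dQ = trans (E-cong λ x → cong (_⊗ Q x) (sym (f≗g x))) (f⊥ dQ)

  module _ {n e : ℕ} {L : List (Func n)} (enum : Enumeration e L) where
    open Enumeration enum

    -- Each P in L is Q + D, where Q is the entry of L representing P - D. Only this inequality is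
    -- used, so no bijection has to be built.
    ∑-translate : ∀ {g : Func n → ℕ} {D} → (∀ {P Q} → P ≗ Q → g P ≡ g Q) → Deg e D →
      ∑ L g ≤ ∑ L (λ P → g (λ x → P x ⊕ D x))
    ∑-translate {g} {D} g-cong dD = ℕ.≤-trans
      (∑-⊆ _≗_ (λ p x → sym (p x)) (λ p r x → trans (p x) (r x)) g-cong unique (All.tabulate shifted))
      (ℕ.≤-reflexive (∑-map (λ P x → P x ⊕ D x) L g))
      where
      shifted : ∀ {P} → P ∈ L → Any (P ≗_) (map (λ P x → P x ⊕ D x) L)
      shifted {P} P∈ = Any.map⁺ (Any.map (λ {Q} P-D≗Q x → trans (sym (undo (P x) (D x)))
          (cong (_⊕ D x) (P-D≗Q x)))
        (complete (Deg-⊖ (sound P∈) dD)))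
        where
        undo : ∀ a b → a ⊕ ⊖ b ⊕ b ≡ a
        undo a b = trans (⊕-assoc a (⊖ b) b) (trans (cong (a ⊕_) (⊖-inverseˡ b)) (⊕-identityʳ a))

    shift : ∀ {k} → Func n → Vec K k → Vec (Func n) k → Vec (Func n) k
    shift D = Vec.zipWith λ c P x → P x ⊕ c ⊗ D x

    ∑-translate-tuples : ∀ k {g : Vec (Func n) k → ℕ} {D} →
        (∀ {Ps Qs} → Pointwise _≗_ Ps Qs → g Ps ≡ g Qs) → Deg e D →
      ∀ cs → ∑ (tuples L k) g ≤ ∑ (tuples L k) (g ∘ shift D cs)
    ∑-translate-tuples zero    g-cong dD []       = ℕ.≤-refl
    ∑-translate-tuples (suc k) {g} {D} g-cong dD (c ∷ cs) = begin
      ∑ (tuples L (suc k)) g  ≡⟨ ∑-tuples L k g ⟩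
      ∑ L (λ P → ∑ (tuples L k) λ Ps → g (P ∷ Ps))
        ≤⟨ ∑-mono L (λ {P} _ → ∑-translate-tuples k (λ Ps≗Qs → g-cong ((λ _ → refl) ∷ Ps≗Qs)) dD cs) ⟩
      ∑ L (λ P → ∑ (tuples L k) λ Ps → g (P ∷ shift D cs Ps))
        ≤⟨ ∑-translate inner-cong (Deg-scale c dD) ⟩
      ∑ L (λ P → ∑ (tuples L k) λ Ps → g ((λ x → P x ⊕ c ⊗ D x) ∷ shift D cs Ps))
        ≡⟨ ∑-tuples L k (g ∘ shift D (c ∷ cs)) ⟨
      ∑ (tuples L (suc k)) (g ∘ shift D (c ∷ cs))  ∎
      where
      open ℕ.≤-Reasoning
      inner-cong : ∀ {P Q} → P ≗ Q → ∑ (tuples L k) (λ Ps → g (P ∷ shift D cs Ps)) ≡ ∑ (tuples L k)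
          (λ Ps → g (Q ∷ shift D cs Ps))
      inner-cong P≗Q = ℕ.≤-antisym
        (∑-mono (tuples L k) λ _ → ℕ.≤-reflexive (g-cong (P≗Q ∷ refl-pointwise _)))
        (∑-mono (tuples L k) λ _ → ℕ.≤-reflexive (sym (g-cong (P≗Q ∷ refl-pointwise _))))
        where
        refl-pointwise : ∀ {k} (Ps : Vec (Func n) k) → Pointwise _≗_ Ps Ps
        refl-pointwise []       = []
        refl-pointwise (P ∷ Ps) = (λ _ → refl) ∷ refl-pointwise Ps

    -- The count of bad P is at most the count after translation by any member. Summed over all
    -- members, each P is counted at most once.
    family-count : ∀ {h m t} → Family h e m t →
      q ^ (2 ^ t) * ∑ L (λ P → 𝟙 (⊥-dec (λ x → h x ⊗ P x) m)) ≤ length L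
    family-count {h} {m} {t} fam = begin
      q ^ (2 ^ t) * ∑ L bad
        ≡⟨ cong (_* ∑ L bad) (trans (sym (fam .size≡))
            (sym (List.length-tabulate {n = fam .size} (λ i → i)))) ⟩
      length (allFin (fam .size)) * ∑ L bad
        ≡⟨ ∑-const (allFin (fam .size)) (∑ L bad) ⟨
      ∑ (allFin (fam .size)) (λ _ → ∑ L bad)
        ≤⟨ ∑-mono (allFin (fam .size)) (λ {c} _ → ∑-translate bad-cong (fam .degree c)) ⟩
      ∑ (allFin (fam .size)) (λ c → ∑ L λ P → bad (λ x → P x ⊕ fam .member c x))
        ≡⟨ ∑-swap (allFin (fam .size)) L _ ⟩
      ∑ L (λ P → ∑ (allFin (fam .size)) λ c → bad (λ x → P x ⊕ fam .member c x))
        ≤⟨ ∑-mono L (λ {P} _ → ∑-𝟙≤1 (λ c → bad? (λ x → P x ⊕ fam .member c x))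
            (Unique.allFin⁺ (fam .size)) (at-most-one P)) ⟩
      ∑ L (λ _ → 1)
        ≡⟨ trans (∑-const L 1) (ℕ.*-identityʳ (length L)) ⟩
      length L  ∎
      where
      open ℕ.≤-Reasoning
      bad? : (P : Func n) → Dec ((λ x → h x ⊗ P x) ⊥ m)
      bad? P = ⊥-dec (λ x → h x ⊗ P x) m
      bad : Func n → ℕ
      bad P = 𝟙 (bad? P)
      bad-cong : ∀ {P Q} → P ≗ Q → bad P ≡ bad Q
      bad-cong {P} {Q} P≗Q = ℕ.≤-antisym
        (𝟙-mono (bad? P) (bad? Q) (⊥-resp λ x → cong (h x ⊗_) (P≗Q x)))
        (𝟙-mono (bad? Q) (bad? P) (⊥-resp λ x → cong (h x ⊗_) (sym (P≗Q x))))
      at-most-one : ∀ P {c c′} → (λ x → h x ⊗ (P x ⊕ fam .member c x)) ⊥ m →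
          (λ x → h x ⊗ (P x ⊕ fam .member c′ x)) ⊥ m → c ≡ c′
      at-most-one P {c} {c′} bad₁ bad₂ with c Fin.≟ c′
      ... | yes c≡c′ = c≡c′
      ... | no  c≢c′ with Q , dQ , ≢0 ← fam .apart c≢c′ =
          contradiction (⊕-cancelʳ (E (λ x → h x ⊗ (P x ⊕ fam .member c′ x) ⊗ Q x)) _ _
        (trans (sym (E-⊕ (λ x → h x ⊗ (fam .member c x ⊕ ⊖ fam .member c′ x) ⊗ Q x)
            (λ x → h x ⊗ (P x ⊕ fam .member c′ x) ⊗ Q x)))
                (trans (E-cong λ x → add-back (h x) (P x) (fam .member c x) (fam .member c′ x) (Q x))
          (trans (bad₁ dQ) (sym (trans (⊕-identityˡ _) (bad₂ dQ))))))) ≢0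
        where
        add-back : ∀ h p a b z → h ⊗ (a ⊕ ⊖ b) ⊗ z ⊕ h ⊗ (p ⊕ b) ⊗ z ≡ h ⊗ (p ⊕ a) ⊗ z
        add-back h p a b z = trans
          (Solver.solve 6 (λ h p a b m z → h Solver.:* (a Solver.:+ m) Solver.:* z Solver.:+ h Solver.:*
              (p Solver.:+ b) Solver.:* z
            Solver.:= h Solver.:* (p Solver.:+ a Solver.:+ (m Solver.:+ b)) Solver.:* z) refl h p a b
                (⊖ b) z)
          (cong (λ y → h ⊗ y ⊗ z) (trans (cong (p ⊕ a ⊕_) (⊖-inverseˡ b)) (⊕-identityʳ _)))

    codegree-product : ∀ {h : Func n} {P m} → HasCodegree h (e + m) → Deg e P → (λ x → h x ⊗ P x) ⊥̸ m →
      HasCodegree (λ x → h x ⊗ P x) m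
    codegree-product {h} {P} codeg dP hP⊥̸ = record
      { below   = λ t<m {Q} dQ → trans (E-cong λ x → ⊗-assoc (h x) (P x) (Q x))
          (codeg .below (ℕ.+-monoʳ-< e t<m) (Deg-⊗ dP dQ))
      ; nonzero = hP⊥̸
      }

    -- A product h P₁ ⋯ P_k drops in degree only if some factor P_i makes it drop.
    codegree-count : ∀ k {h : Func n} {m t} → HasCodegree h (k * e + m) → t * (q ∸ 1) ≤ e →
        t * (q ∸ 1) ≤ m →
      q ^ (2 ^ t) * ∑ (tuples L k) (λ Ps → 𝟙 (⊥-dec (λ x → h x ⊗ ∏ Ps x) m)) ≤ k * length L ^ k
    codegree-count zero {h} {m} {t} codeg _ _ = ℕ.≤-reflexive (trans
      (cong (λ z → q ^ (2 ^ t) * (z + 0)) (𝟙-no (⊥-dec (λ x → h x ⊗ 1𝔽) m) λ h⊥ → let Q , dQ , ≢0 = codeg .nonzero in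
        ≢0 (trans (E-cong λ x → cong (_⊗ Q x) (sym (⊗-identityʳ (h x)))) (h⊥ dQ))))
            (ℕ.*-zeroʳ (q ^ (2 ^ t))))
    codegree-count (suc k) {h} {m} {t} codeg t≤e t≤m = begin
      N * ∑ (tuples L (suc k)) (𝟙 ∘ event? h)
        ≡⟨ cong (N *_) (∑-tuples L k (𝟙 ∘ event? h)) ⟩
      N * ∑ L (λ P → ∑ (tuples L k) λ Ps → 𝟙 (event? h (P ∷ Ps)))  ≡⟨ ∑-*ˡ N L _ ⟨
      ∑ L (λ P → N * ∑ (tuples L k) λ Ps → 𝟙 (event? h (P ∷ Ps)))  ≤⟨ ∑-mono L step ⟩
      ∑ L (λ P → N * length L ^ k * bad P + k * length L ^ k)
        ≡⟨ ∑-+ L (λ P → N * length L ^ k * bad P) (λ _ → k * length L ^ k) ⟩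
      ∑ L (λ P → N * length L ^ k * bad P) + ∑ L (λ _ → k * length L ^ k)
        ≡⟨ cong₂ _+_ (∑-*ˡ (N * length L ^ k) L bad) (∑-const L (k * length L ^ k)) ⟩
      N * length L ^ k * ∑ L bad + length L * (k * length L ^ k)
        ≡⟨ solve 5 (λ N l b l′ k → N :* l :* b :+ l′ :* (k :* l) := N :* b :* l :+ k :* (l′ :* l)) refl N
            (length L ^ k) (∑ L bad) (length L) k ⟩
      N * ∑ L bad * length L ^ k + k * (length L * length L ^ k)
        ≤⟨ ℕ.+-monoˡ-≤ _ (ℕ.*-monoˡ-≤ (length L ^ k) (family-count fam)) ⟩
      length L * length L ^ k + k * (length L * length L ^ k)  ∎
      where
      open ℕ.≤-Reasoning
      open +-*-Solver
      N = q ^ (2 ^ t)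
      codeg′ : HasCodegree h (e + (k * e + m))
      codeg′ = subst (HasCodegree h) (ℕ.+-assoc e (k * e) m) codeg
      fam : Family h e (k * e + m) t
      fam = family n t e (k * e + m) codeg′ t≤e (ℕ.≤-trans t≤m (ℕ.m≤n+m m (k * e)))
      event? : ∀ {k} (h : Func n) (Ps : Vec (Func n) k) → Dec ((λ x → h x ⊗ ∏ Ps x) ⊥ m)
      event? h Ps = ⊥-dec (λ x → h x ⊗ ∏ Ps x) m
      bad : Func n → ℕ
      bad P = 𝟙 (⊥-dec (λ x → h x ⊗ P x) (k * e + m))
      all-tuples : ∀ P → ∑ (tuples L k) (λ Ps → 𝟙 (event? h (P ∷ Ps))) ≤ length L ^ k
      all-tuples P = ℕ.≤-trans (∑-mono (tuples L k) λ {Ps} _ → 𝟙≤1 (event? h (P ∷ Ps)))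
        (ℕ.≤-reflexive (trans (∑-const (tuples L k) 1) (trans (ℕ.*-identityʳ _) (length-tuples L k))))
      -- If the first factor is bad, all tuples behind it are counted, and `family-count` bounds how
      -- often this happens. Otherwise h P has codegree k e + m and induction applies.
      step : ∀ {P} → P ∈ L → N * ∑ (tuples L k) (λ Ps → 𝟙 (event? h (P ∷ Ps))) ≤ N * length L ^ k * bad P
          + k * length L ^ k
      step {P} P∈ with ⊥-dec (λ x → h x ⊗ P x) (k * e + m)
      ... | yes _ = ℕ.≤-trans (ℕ.*-monoʳ-≤ N (all-tuples P))
              (ℕ.≤-trans (ℕ.≤-reflexive (sym (ℕ.*-identityʳ _))) (ℕ.m≤m+n _ _))
      ... | no ¬⊥ with ⊥? (λ x → h x ⊗ P x) (k * e + m)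
      ...   | inj₁ hP⊥ = ⊥-elim (¬⊥ hP⊥)
      ...   | inj₂ hP⊥̸ = ℕ.≤-trans (ℕ.≤-trans
              (ℕ.*-monoʳ-≤ N (∑-mono (tuples L k) λ {Ps} _ → 𝟙-mono (event? h (P ∷ Ps))
                  (event? (λ x → h x ⊗ P x) Ps)
                (⊥-resp λ x → sym (⊗-assoc (h x) (P x) (∏ Ps x)))))
              (codegree-count k {t = t} (codegree-product codeg′ (sound P∈) hP⊥̸) t≤e t≤m)) (ℕ.m≤n+m _ _)

    Vanishes : ∀ {k m} → Vec (Point n) m → Vec (Func n) k → Set
    Vanishes ys Ps = ∀ i → ∏ Ps (lookup ys i) ≡ 0𝔽

    vanishes? : ∀ {k m} (ys : Vec (Point n) m) (Ps : Vec (Func n) k) → Dec (Vanishes ys Ps)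
    vanishes? ys Ps = Fin.all? λ i → ∏ Ps (lookup ys i) Fin.≟ 0𝔽

    shift-away : ∀ {k D z} (cs : Vec K k) (Ps : Vec (Func n) k) → D z ≡ 0𝔽 → ∏ (shift D cs Ps) z ≡ ∏ Ps z
    shift-away []       []       Dz≡0 = refl
    shift-away {D = D} {z} (c ∷ cs) (P ∷ Ps) Dz≡0 = cong₂ _⊗_
      (trans (cong (λ d → P z ⊕ c ⊗ d) Dz≡0) (trans (cong (P z ⊕_) (⊗-zeroʳ c)) (⊕-identityʳ (P z))))
      (shift-away cs Ps Dz≡0)

    shift-to-one : ∀ {k D z} (Ps : Vec (Func n) k) → D z ≡ 1𝔽 →
        ∏ (shift D (Vec.map (λ P → 1𝔽 ⊕ ⊖ P z) Ps) Ps) z ≡ 1𝔽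
    shift-to-one []       Dz≡1 = refl
    shift-to-one {D = D} {z} (P ∷ Ps) Dz≡1 =
        trans (cong₂ _⊗_ head≡1 (shift-to-one Ps Dz≡1)) (⊗-identityˡ 1𝔽)
      where
      head≡1 : P z ⊕ (1𝔽 ⊕ ⊖ P z) ⊗ D z ≡ 1𝔽
      head≡1 = trans (cong (λ d → P z ⊕ (1𝔽 ⊕ ⊖ P z) ⊗ d) Dz≡1) (trans (cong (P z ⊕_) (⊗-identityʳ _))
        (trans (⊕-comm (P z) _) (trans (⊕-assoc 1𝔽 (⊖ P z) (P z)) (trans (cong (1𝔽 ⊕_) (⊖-inverseˡ (P z)))
            (⊕-identityʳ 1𝔽)))))

    -- Adding multiples of D to the factors makes their values at y uniform and leaves
    -- those at the later nodes unchanged.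
    node-count : ∀ k {m} {ys : Vec (Point n) m} {Ds} → Triangular e ys Ds →
      (q ^ k) ^ m * ∑ (tuples L k) (λ Ps → 𝟙 (vanishes? ys Ps)) ≤ (q ^ k ∸ 1) ^ m * length L ^ k
    node-count k [] = ℕ.+-monoˡ-≤ 0 (ℕ.≤-trans (∑-mono (tuples L k) λ {Ps} _ → 𝟙≤1 (vanishes? [] Ps))
      (ℕ.≤-reflexive (trans (∑-const (tuples L k) 1) (trans (ℕ.*-identityʳ _) (length-tuples L k)))))
    node-count k {suc m} {y ∷ ys} {D ∷ Ds} (cons dD Dy≡1 D≡0 tr) = begin
      (q ^ k) * (q ^ k) ^ m * V (y ∷ ys)
        ≡⟨ solve 3 (λ a b c → a :* b :* c := b :* (a :* c)) refl (q ^ k) ((q ^ k) ^ m) (V (y ∷ ys)) ⟩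
      (q ^ k) ^ m * (q ^ k * V (y ∷ ys))  ≤⟨ ℕ.*-monoʳ-≤ ((q ^ k) ^ m) step ⟩
      (q ^ k) ^ m * ((q ^ k ∸ 1) * V ys)
        ≡⟨ solve 3 (λ a b c → b :* (a :* c) := a :* (b :* c)) refl (q ^ k ∸ 1) ((q ^ k) ^ m) (V ys) ⟩
      (q ^ k ∸ 1) * ((q ^ k) ^ m * V ys)  ≤⟨ ℕ.*-monoʳ-≤ (q ^ k ∸ 1) (node-count k tr) ⟩
      (q ^ k ∸ 1) * ((q ^ k ∸ 1) ^ m * length L ^ k)  ≡⟨ ℕ.*-assoc (q ^ k ∸ 1) _ _ ⟨
      (q ^ k ∸ 1) * (q ^ k ∸ 1) ^ m * length L ^ k  ∎
      where
      open ℕ.≤-Reasoning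
      open +-*-Solver
      V : ∀ {m} → Vec (Point n) m → ℕ
      V ys = ∑ (tuples L k) λ Ps → 𝟙 (vanishes? ys Ps)
      shifts = tuples (allFin q) k
      length-shifts : length shifts ≡ q ^ k
      length-shifts = trans (length-tuples (allFin q) k)
          (cong (_^ k) (List.length-tabulate {n = q} (λ i → i)))
      g-cong : ∀ {Ps Qs} → Pointwise _≗_ Ps Qs → 𝟙 (vanishes? (y ∷ ys) Ps) ≡ 𝟙 (vanishes? (y ∷ ys) Qs)
      g-cong {Ps} {Qs} Ps≗Qs = ℕ.≤-antisym
        (𝟙-mono (vanishes? (y ∷ ys) Ps) (vanishes? (y ∷ ys) Qs) λ v i → trans (sym (∏-cong Ps≗Qs _)) (v i))
        (𝟙-mono (vanishes? (y ∷ ys) Qs) (vanishes? (y ∷ ys) Ps) λ v i → trans (∏-cong Ps≗Qs _) (v i))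
      at-y? : (Ps : Vec (Func n) k) (cs : Vec K k) → Dec (∏ (shift D cs Ps) y ≡ 0𝔽)
      at-y? Ps cs = ∏ (shift D cs Ps) y Fin.≟ 0𝔽
      𝟙-split : ∀ Ps cs → 𝟙 (vanishes? (y ∷ ys) (shift D cs Ps)) ≤ 𝟙 (vanishes? ys Ps) * 𝟙 (at-y? Ps cs)
      𝟙-split Ps cs = 𝟙-× (vanishes? (y ∷ ys) (shift D cs Ps)) (vanishes? ys Ps) (at-y? Ps cs)
        (λ v i → trans (sym (shift-away cs Ps (D≡0 i))) (v (suc i))) (λ v → v zero)
      -- These shifts give every factor the value 1 at y, so at most q^k - 1 of the q^k choices of
      -- shifts leave a zero of the product there.
      escape : Vec (Func n) k → Vec K k
      escape = Vec.map λ P → 1𝔽 ⊕ ⊖ P y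
      escapes : ∀ Ps → ∏ (shift D (escape Ps) Ps) y ≢ 0𝔽
      escapes Ps eq = 1≢0 (trans (sym (shift-to-one {D = D} Ps Dy≡1)) eq)
      one-escapes : ∀ Ps → ∑ shifts (λ cs → 𝟙 (vanishes? ys Ps) * 𝟙 (at-y? Ps cs)) ≤ (q ^ k ∸ 1) * 𝟙
          (vanishes? ys Ps)
      one-escapes Ps = begin
        ∑ shifts (λ cs → v * 𝟙 (at-y? Ps cs))  ≡⟨ ∑-*ˡ v shifts (λ cs → 𝟙 (at-y? Ps cs)) ⟩
        v * ∑ shifts (λ cs → 𝟙 (at-y? Ps cs))
          ≤⟨ ℕ.*-monoʳ-≤ v (∑-𝟙<length (at-y? Ps) (∈-tuples ∈-allFin (escape Ps)) (escapes Ps)) ⟩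
        v * (length shifts ∸ 1)  ≡⟨ cong (λ l → v * (l ∸ 1)) length-shifts ⟩
        v * (q ^ k ∸ 1)  ≡⟨ ℕ.*-comm v (q ^ k ∸ 1) ⟩
        (q ^ k ∸ 1) * v  ∎
        where v = 𝟙 (vanishes? ys Ps)
      step : q ^ k * V (y ∷ ys) ≤ (q ^ k ∸ 1) * V ys
      step = begin
        q ^ k * V (y ∷ ys)
          ≡⟨ cong (_* V (y ∷ ys)) length-shifts ⟨
        length shifts * V (y ∷ ys)  ≡⟨ ∑-const shifts (V (y ∷ ys)) ⟨
        ∑ shifts (λ _ → V (y ∷ ys))
          ≤⟨ ∑-mono shifts (λ {cs} _ → ∑-translate-tuples k g-cong dD cs) ⟩
        ∑ shifts (λ cs → ∑ (tuples L k) λ Ps → 𝟙 (vanishes? (y ∷ ys) (shift D cs Ps)))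
          ≤⟨ ∑-mono shifts (λ {cs} _ → ∑-mono (tuples L k) λ {Ps} _ → 𝟙-split Ps cs) ⟩
        ∑ shifts (λ cs → ∑ (tuples L k) λ Ps → 𝟙 (vanishes? ys Ps) * 𝟙 (at-y? Ps cs))
          ≡⟨ ∑-swap shifts (tuples L k) _ ⟩
        ∑ (tuples L k) (λ Ps → ∑ shifts λ cs → 𝟙 (vanishes? ys Ps) * 𝟙 (at-y? Ps cs))
          ≤⟨ ∑-mono (tuples L k) (λ {Ps} _ → one-escapes Ps) ⟩
        ∑ (tuples L k) (λ Ps → (q ^ k ∸ 1) * 𝟙 (vanishes? ys Ps))
          ≡⟨ ∑-*ˡ (q ^ k ∸ 1) (tuples L k) _ ⟩
        (q ^ k ∸ 1) * V ys  ∎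

tuples⁺ : ∀ {A : Set} {xs : List A} {m} (v : Vec A m) → (∀ i → lookup v i ∈ xs) → v ∈ tuples xs m
tuples⁺ []      _  = here refl
tuples⁺ (x ∷ v) v∈ = ∈-cartesianProductWith⁺ _∷_ (v∈ zero) (tuples⁺ v (v∈ ∘ suc))

tuples-unique : ∀ {A : Set} {xs : List A} → Unique xs → ∀ m → Unique (tuples xs m)
tuples-unique uniq zero    = [] ∷ []
tuples-unique uniq (suc m) = Unique.cartesianProductWith⁺ _∷_ Vec.∷-injective uniq (tuples-unique uniq m)

Unique-lookup : ∀ {A : Set} {xs : List A} → Unique xs → ∀ {i j} → i ≢ j →
    List.lookup xs i ≢ List.lookup xs j
Unique-lookup (x∉ ∷ uniq) {zero}  {zero}  i≢j = contradiction refl i≢j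
Unique-lookup (x∉ ∷ uniq) {zero}  {suc j} i≢j = All.lookup x∉ (∈-lookup j)
Unique-lookup (x∉ ∷ uniq) {suc i} {zero}  i≢j = All.lookup x∉ (∈-lookup i) ∘ sym
Unique-lookup (x∉ ∷ uniq) {suc i} {suc j} i≢j = Unique-lookup uniq (i≢j ∘ cong suc)

-- The two cases of the product test.

module ProductTest {q : ℕ} (𝔽 : PrimeField q) where
  open PrimeField 𝔽
  open Degree 𝔽
  open Duality 𝔽
  open Alternative 𝔽
  open Leading 𝔽
  open FlatExtension 𝔽
  open Dimension 𝔽
  open Interpolation
  open Visible
  open Counting 𝔽
  open Enumeration using (sound)

  support : ∀ {n} → Func n → List (Point n)
  support {n} h = filter (λ x → ¬? (h x Fin.≟ 0𝔽)) (tuples (allFin q) n)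

  ∈-support⁻ : ∀ {n} {h : Func n} {z} → z ∈ support h → h z ≢ 0𝔽
  ∈-support⁻ {n} {h} z∈ = proj₂ (∈-filter⁻ (λ x → ¬? (h x Fin.≟ 0𝔽)) {xs = tuples (allFin q) n} z∈)

  Deg-∏ : ∀ {n e} {L : List (Func n)} → Enumeration e L → ∀ {k} {Ps : Vec (Func n) k} → Ps ∈ tuples L k →
      Deg (k * e) (∏ Ps)
  Deg-∏ enum {zero}  {[]} _ = const 1𝔽
  Deg-∏ {L = L} enum {suc k} Ps∈ with _ , _ , P∈ , Ps∈′ , refl ← ∈-cartesianProductWith⁻ _∷_ L
      (tuples L k) Ps∈ =
    Deg-⊗ (sound enum P∈) (Deg-∏ enum Ps∈′)

  -- Up to nonzero scalars the probes are dual to the points of the support. Having degree at most k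
  -- e, they are combinations there of the rank^k products of interpolation basis functions.
  support-≤ : ∀ {n e k a t} {f h : Func n} → a ≤ k * e → suc a ≤ t →
      (∀ {P} → Deg a P → E (λ x → f x ⊗ P x) ≡ E (λ x → h x ⊗ P x)) →
    ((z : Point n) → h z ≢ 0𝔽 → Visible f a t z) → (I : Interpolation e (support h)) →
        length (support h) ≤ I .rank ^ k
  support-≤ {n} {e} {k} {a} {t} {f} {h} a≤ke a<t agree visible I =
    independent⇒≤ {S = _∈ support h} (powers (I .basis) k) (List.lookup (support h)) (λ i → vis i .probe)
        ∈-lookup
      (λ i → powers-span (_∈ support h) (I .basis) (Interpolation-spans I) k (Deg-≤ a≤ke (vis i .degree)))
      (λ {i} {j} i≢j → probe-off a<t (vis i) (vis j)
        (Unique-lookup (Unique.filter⁺ (λ x → ¬? (h x Fin.≟ 0𝔽)) (tuples-unique (Unique.allFin⁺ q) n)) i≢j))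
      (λ i → probe-on a<t agree visible (List.lookup (support h) i) (h≢0 i))
    where
    h≢0 : ∀ i → h (List.lookup (support h) i) ≢ 0𝔽
    h≢0 i = ∈-support⁻ {h = h} (∈-lookup i)
    vis : ∀ i → Visible f a t (List.lookup (support h) i)
    vis i = visible (List.lookup (support h) i) (h≢0 i)

  split-r : ∀ a r → 3 * suc a + q ≤ r → 2 + a + (r ∸ (2 + a)) ≡ r
  split-r a r 3a+q≤r = ℕ.m+[n∸m]≡n (ℕ.≤-trans (ℕ.m≤m+n (2 + a) (1 + a + a + q))
      (ℕ.≤-trans (ℕ.≤-reflexive (expand a q)) 3a+q≤r))
    where
    open +-*-Solver
    expand : ∀ a q → 2 + a + (1 + a + a + q) ≡ 3 * suc a + q
    expand = solve 2 (λ a q → con 2 :+ a :+ (con 1 :+ a :+ a :+ q) := con 3 :* (con 1 :+ a) :+ q) refl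

  split-slack : ∀ a r → 3 * suc a + q ≤ r → a + a + q ≤ suc (r ∸ (2 + a))
  split-slack a r 3a+q≤r = ℕ.≤-trans (ℕ.n≤1+n (a + a + q))
      (ℕ.≤-trans (m+n≤o⇒n≤o∸m (2 + a) {1 + (a + a + q)} {r}
    (ℕ.≤-trans (ℕ.≤-reflexive (expand a q)) 3a+q≤r)) (ℕ.n≤1+n _))
    where
    open +-*-Solver
    expand : ∀ a q → 2 + a + (1 + (a + a + q)) ≡ 3 * suc a + q
    expand = solve 2 (λ a q → con 2 :+ a :+ (con 1 :+ (a :+ a :+ q)) := con 3 :* (con 1 :+ a) :+ q) refl

  leading-bound : ∀ d b w T {N} → 2 + (b + w) + T + d ≡ N → d + b + (T + suc w) < N
  leading-bound d b w T refl = ℕ.≤-reflexive (rearrange d b w T)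
    where
    open +-*-Solver
    rearrange : ∀ d b w T → 1 + (d + b + (T + (1 + w))) ≡ 2 + (b + w) + T + d
    rearrange = solve 4 (λ d b w T → con 1 :+ (d :+ b :+ (T :+ (con 1 :+ w))) := con 2 :+ (b :+ w) :+ T :+
        d) refl

  flat-< : ∀ a T → a + a + q ≤ suc T → a < suc T
  flat-< a T slack = ℕ.≤-trans (ℕ.≤-trans (ℕ.≤-reflexive (ℕ.+-comm 1 a))
      (ℕ.≤-trans (ℕ.+-monoʳ-≤ a (ℕ.<⇒≤ 1<q)) (ℕ.+-monoˡ-≤ q (ℕ.m≤m+n a a)))) slack

  flat-bound : ∀ d b w T {N} → (b + w) + (b + w) + q ≤ suc T → 2 + (b + w) + T + d ≡ N → d + b + (b + w) < N
  flat-bound d b w T slack refl =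
      s≤s (ℕ.≤-trans (ℕ.+-monoˡ-≤ (b + w)
          (ℕ.+-monoʳ-≤ d (ℕ.≤-trans (ℕ.m≤m+n b w) (ℕ.≤-pred (flat-< (b + w) T slack)))))
    (ℕ.≤-trans (ℕ.≤-reflexive (rearrange d (b + w) T)) (ℕ.n≤1+n _)))
    where
    open +-*-Solver
    rearrange : ∀ d a T → d + T + a ≡ a + T + d
    rearrange = solve 3 (λ d a T → d :+ T :+ a := a :+ T :+ d) refl

  -- Either some f Q has degree exactly (q - 1) n - (1 + a), and the product with
  -- f Q drops in degree whenever the test accepts, or f is congruent to a function
  -- of support larger than Δ, and the product vanishes on interpolation nodes of the
  -- support whenever the test accepts.
  acceptance-count : ∀ {n d r e k Δ w t} {L : List (Func n)} (f : Func n) → Enumeration e L →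
    r + d ≡ (q ∸ 1) * n → w < e → t * (q ∸ 1) ≤ suc w → 3 * (k * e + suc w) + q ≤ r →
    (∀ {h} → Deg d (λ x → f x ⊕ ⊖ h x) → Δ < length (support h)) →
    {Accepts : Vec (Func n) k → Set} (accepts? : ∀ Ps → Dec (Accepts Ps)) →
    (∀ {Ps} → Accepts Ps → Deg (d + k * e) (λ x → f x ⊗ ∏ Ps x)) →
    let accepted = length (filter accepts? (tuples L k))
        total    = length (tuples L k)
    in (q ^ (2 ^ t) * accepted ≤ k * total) ⊎
       (∃[ ρ ] suc Δ ≤ ρ ^ suc k × (q ^ k) ^ ρ * accepted ≤ (q ^ k ∸ 1) ^ ρ * total)
  acceptance-count {n} {d} {r} {e} {k} {Δ} {w} {t} {L} f enum r+d≡ w<e t≤w slack far accepts? accepts⇒Deg =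
    cases (flat-or-leading f a T)
    where
    -- With w + 1 as the excess of A over ke, this is A - 1, so that `flat-or-leading` compares
    -- degrees A - 1 and A; `T` is s - A.
    a = k * e + w
    T = r ∸ (2 + a)
    X = tuples L k
    accepted = length (filter accepts? X)
    2+a+T≡r : 2 + a + T ≡ r
    2+a+T≡r = split-r a r (subst (λ z → 3 * z + q ≤ r) (ℕ.+-suc (k * e) w) slack)
    codegree-sum : 2 + a + T + d ≡ (q ∸ 1) * n
    codegree-sum = trans (cong (_+ d) 2+a+T≡r) r+d≡
    flat-slack : a + a + q ≤ suc T
    flat-slack = split-slack a r (subst (λ z → 3 * z + q ≤ r) (ℕ.+-suc (k * e) w) slack)
    length-X : length X ≡ length L ^ k
    length-X = length-tuples L k
    accepted≤ : ∀ {A : Vec (Func n) k → Set} (A? : ∀ Ps → Dec (A Ps)) →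
      (∀ {Ps} → Ps ∈ X → Deg (d + k * e) (λ x → f x ⊗ ∏ Ps x) → A Ps) → accepted ≤ ∑ X (λ Ps → 𝟙 (A? Ps))
    accepted≤ A? imp = ℕ.≤-trans (ℕ.≤-reflexive (length-filter-∑ accepts? X))
      (∑-mono X λ {Ps} Ps∈ → 𝟙-mono (accepts? Ps) (A? Ps) (λ acc → imp Ps∈ (accepts⇒Deg acc)))

    leading-case : (∃[ Q ] Deg T Q × (λ x → f x ⊗ Q x) ⊥ a × (λ x → f x ⊗ Q x) ⊥̸ suc a) →
      q ^ (2 ^ t) * accepted ≤ k * length X
    leading-case (Q , dQ , fQ⊥ , fQ⊥̸) = begin
      q ^ (2 ^ t) * accepted
        ≤⟨ ℕ.*-monoʳ-≤ (q ^ (2 ^ t)) (accepted≤ drops? drops) ⟩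
      q ^ (2 ^ t) * ∑ X (λ Ps → 𝟙 (drops? Ps))
        ≤⟨ codegree-count enum k {t = t} codegree (ℕ.≤-trans t≤w w<e) t≤w ⟩
      k * length L ^ k  ≡⟨ cong (k *_) length-X ⟨
      k * length X  ∎
      where
      open ℕ.≤-Reasoning
      h : Func n
      h x = f x ⊗ Q x
      drops? : ∀ Ps → Dec ((λ x → h x ⊗ ∏ Ps x) ⊥ suc w)
      drops? Ps = ⊥-dec (λ x → h x ⊗ ∏ Ps x) (suc w)
      codegree : HasCodegree h (k * e + suc w)
      codegree = subst (HasCodegree h) (sym (ℕ.+-suc (k * e) w)) (record
        { below = λ t<1+a → ⊥-≤ {f = h} (ℕ.≤-pred t<1+a) fQ⊥ ; nonzero = fQ⊥̸ })
      drops : ∀ {Ps} → Ps ∈ X → Deg (d + k * e) (λ x → f x ⊗ ∏ Ps x) → (λ x → h x ⊗ ∏ Ps x) ⊥ suc w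
      drops {Ps} _ dfP {W} dW = trans
        (E-cong λ x → Solver.solve 4 (λ f q p w → f :* q :* p :* w := f :* p :* (q :* w)) refl (f x) (Q x)
            (∏ Ps x) (W x))
        -- The degrees d + ke, T and w + 1 add up to exactly (q - 1) n - 1.
        (Deg⇒⊥ {t = T + suc w} (leading-bound d (k * e) w T codegree-sum) dfP (Deg-⊗ dQ dW))
        where open Solver using (_:*_; _:=_)

    flat-case : (Σ[ h ∈ Func n ] (∀ {P} → Deg (suc (a + T)) P → E (λ x → f x ⊗ P x) ≡ E (λ x → h x ⊗ P x)) ×
                                 ((z : Point n) → h z ≢ 0𝔽 → Visible f a (suc T) z)) →
      ∃[ ρ ] suc Δ ≤ ρ ^ suc k × (q ^ k) ^ ρ * accepted ≤ (q ^ k ∸ 1) ^ ρ * length X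
    flat-case (h , agree , visible) = I .rank , support-large , (begin
      (q ^ k) ^ I .rank * accepted
        ≤⟨ ℕ.*-monoʳ-≤ ((q ^ k) ^ I .rank) (accepted≤ (vanishes? enum (I .nodes)) vanish) ⟩
      (q ^ k) ^ I .rank * ∑ X (λ Ps → 𝟙 (vanishes? enum (I .nodes) Ps))
        ≤⟨ node-count enum k (I .triangular) ⟩
      (q ^ k ∸ 1) ^ I .rank * length L ^ k
        ≡⟨ cong ((q ^ k ∸ 1) ^ I .rank *_) length-X ⟨
      (q ^ k ∸ 1) ^ I .rank * length X  ∎)
      where
      open ℕ.≤-Reasoning
      I : Interpolation e (support h)
      I = interpolation e (support h)
      a<1+T : a < suc T
      a<1+T = flat-< a T flat-slack
      a≤ : a ≤ suc k * e
      a≤ = ℕ.≤-trans (ℕ.+-monoʳ-≤ (k * e) (ℕ.<⇒≤ w<e)) (ℕ.≤-reflexive (ℕ.+-comm (k * e) e))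
      f-h⊥ : (λ x → f x ⊕ ⊖ h x) ⊥ suc (a + T)
      f-h⊥ {P} dP = ⊕-cancelʳ (E (λ x → h x ⊗ P x)) (E (λ x → (f x ⊕ ⊖ h x) ⊗ P x)) 0𝔽 (trans
        (sym (E-⊕ (λ x → (f x ⊕ ⊖ h x) ⊗ P x) (λ x → h x ⊗ P x)))
        (trans (E-cong λ x → undo (f x) (h x) (P x)) (trans (agree dP) (sym (⊕-identityˡ _)))))
        where
        undo : ∀ a b c → (a ⊕ ⊖ b) ⊗ c ⊕ b ⊗ c ≡ a ⊗ c
        undo a b c = trans (sym (⊗-distribʳ-⊕ c (a ⊕ ⊖ b) b)) (cong (_⊗ c)
          (trans (⊕-assoc a (⊖ b) b) (trans (cong (a ⊕_) (⊖-inverseˡ b)) (⊕-identityʳ a))))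
      -- Agreement reaches degree a + T + 1 = r - 1, exactly what duality asks for degree d.
      f-h : Deg d (λ x → f x ⊕ ⊖ h x)
      f-h = ⊥⇒Deg {s = suc (a + T)} (ℕ.≤-reflexive (sym codegree-sum)) f-h⊥
      agree-a : ∀ {P} → Deg a P → E (λ x → f x ⊗ P x) ≡ E (λ x → h x ⊗ P x)
      agree-a dP = agree (Deg-≤ (ℕ.≤-trans (ℕ.m≤m+n a T) (ℕ.n≤1+n (a + T))) dP)
      support-large : suc Δ ≤ I .rank ^ suc k
      support-large = ℕ.≤-trans (far {h} f-h) (support-≤ {k = suc k} {f = f} {h} a≤ a<1+T agree-a visible I)
      -- The value of the product at a node is, up to the nonzero mass, the pairing of f with the
      -- probe times the product. On acceptance this integrand has degree below (q - 1) n.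
      vanish : ∀ {Ps} → Ps ∈ X → Deg (d + k * e) (λ x → f x ⊗ ∏ Ps x) → Vanishes enum (I .nodes) Ps
      vanish {Ps} Ps∈ dfP i = ⊗-cancelˡ ⟪ f ∣ v .probe ∣ 𝟏 ⟫ (v .mass≢0)
        (trans (sym (v .point (Deg-≤ (ℕ.≤-trans (ℕ.m≤m+n (k * e) w) (ℕ.<⇒≤ a<1+T)) (Deg-∏ enum Ps∈))))
        (trans (E-cong λ x → Solver.solve 3 (λ f w p → f :* (w :* p) := f :* p :* w) refl (f x)
            (v .probe x) (∏ Ps x))
          (trans (Deg⇒⊥ {t = a} (flat-bound d (k * e) w T flat-slack codegree-sum) dfP (v .degree))
              (sym (⊗-zeroʳ _)))))
        where
        open Solver using (_:*_; _:=_)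
        v : Visible f a (suc T) (lookup (I .nodes) i)
        v = visible (lookup (I .nodes) i) (∈-support⁻ {h = h} (I .nodes∈ i))

    cases : Flat f a T ⊎ (∃[ Q ] Deg T Q × (λ x → f x ⊗ Q x) ⊥ a × (λ x → f x ⊗ Q x) ⊥̸ suc a) →
      (q ^ (2 ^ t) * accepted ≤ k * length X) ⊎
      (∃[ ρ ] suc Δ ≤ ρ ^ suc k × (q ^ k) ^ ρ * accepted ≤ (q ^ k ∸ 1) ^ ρ * length X)
    cases (inj₁ flat)    = inj₂ (flat-case (flat-extension f a T flat flat-slack))
    cases (inj₂ leading) = inj₁ (leading-case leading)

-- The field of residues modulo a prime.

module Residues (q : ℕ) .{{_ : NonZero q}} (q-prime : Prime q) where
  open ReedMuller q

  1<q : 1 < q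
  1<q = ℕ.nonTrivial⇒n>1 q {{prime⇒nonTrivial q-prime}}

  fromℕ𝔽 : ℕ → 𝔽
  fromℕ𝔽 m = m mod q

  toℕ-fromℕ𝔽 : ∀ m → toℕ (fromℕ𝔽 m) ≡ m % q
  toℕ-fromℕ𝔽 m = Fin.toℕ-fromℕ< (m%n<n m q)

  fromℕ𝔽-% : ∀ {m n} → m % q ≡ n % q → fromℕ𝔽 m ≡ fromℕ𝔽 n
  fromℕ𝔽-% {m} {n} eq =
    Fin.toℕ-injective (trans (toℕ-fromℕ𝔽 m) (trans eq (sym (toℕ-fromℕ𝔽 n))))

  fromℕ𝔽-toℕ : ∀ a → fromℕ𝔽 (toℕ a) ≡ a
  fromℕ𝔽-toℕ a =
    Fin.toℕ-injective (trans (toℕ-fromℕ𝔽 (toℕ a)) (m<n⇒m%n≡m (Fin.toℕ<n a)))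

  fromℕ𝔽-+ : ∀ m n → fromℕ𝔽 m ⊕ fromℕ𝔽 n ≡ fromℕ𝔽 (m + n)
  fromℕ𝔽-+ m n = fromℕ𝔽-% (trans
    (cong₂ (λ i j → (i + j) % q) (toℕ-fromℕ𝔽 m) (toℕ-fromℕ𝔽 n))
    (sym (%-distribˡ-+ m n q)))

  fromℕ𝔽-* : ∀ m n → fromℕ𝔽 m ⊗ fromℕ𝔽 n ≡ fromℕ𝔽 (m * n)
  fromℕ𝔽-* m n = fromℕ𝔽-% (trans
    (cong₂ (λ i j → (i * j) % q) (toℕ-fromℕ𝔽 m) (toℕ-fromℕ𝔽 n))
    (sym (%-distribˡ-* m n q)))

  fromℕ𝔽-q : ∀ m → fromℕ𝔽 (m * q) ≡ 0𝔽
  fromℕ𝔽-q m = fromℕ𝔽-% (trans (m*n%n≡0 m q) (sym (m<n⇒m%n≡m (ℕ.<-trans (ℕ.s≤s ℕ.z≤n) 1<q))))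

  ⊖_ : 𝔽 → 𝔽
  ⊖ a = fromℕ𝔽 (q ∸ toℕ a)

  private
    lift₁ : ∀ {u v : 𝔽 → 𝔽} → (∀ m → u (fromℕ𝔽 m) ≡ v (fromℕ𝔽 m)) → ∀ a → u a ≡ v a
    lift₁ {u} {v} eq a = subst (λ b → u b ≡ v b) (fromℕ𝔽-toℕ a) (eq (toℕ a))

    lift₂ : ∀ {u v : 𝔽 → 𝔽 → 𝔽} → (∀ m n → u (fromℕ𝔽 m) (fromℕ𝔽 n) ≡ v (fromℕ𝔽 m) (fromℕ𝔽 n)) →
            ∀ a b → u a b ≡ v a b
    lift₂ {u} {v} eq a b = lift₁ {λ x → u x b} {λ x → v x b} (λ m → lift₁ {u (fromℕ𝔽 m)} {v (fromℕ𝔽 m)}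
        (eq m) b) a

    lift₃ : ∀ {u v : 𝔽 → 𝔽 → 𝔽 → 𝔽} →
            (∀ l m n → u (fromℕ𝔽 l) (fromℕ𝔽 m) (fromℕ𝔽 n) ≡ v (fromℕ𝔽 l) (fromℕ𝔽 m) (fromℕ𝔽 n)) →
            ∀ a b c → u a b c ≡ v a b c
    lift₃ {u} {v} eq a b c =
      lift₁ {λ x → u x b c} {λ x → v x b c} (λ l → lift₂ {u (fromℕ𝔽 l)} {v (fromℕ𝔽 l)} (eq l) b c) a

  ⊕-assoc : ∀ a b c → (a ⊕ b) ⊕ c ≡ a ⊕ (b ⊕ c)
  ⊕-assoc = lift₃ λ l m n → trans (cong (_⊕ fromℕ𝔽 n) (fromℕ𝔽-+ l m)) (trans (fromℕ𝔽-+ (l + m) n)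
    (trans (cong fromℕ𝔽 (ℕ.+-assoc l m n))
        (sym (trans (cong (fromℕ𝔽 l ⊕_) (fromℕ𝔽-+ m n)) (fromℕ𝔽-+ l (m + n))))))

  ⊗-assoc : ∀ a b c → (a ⊗ b) ⊗ c ≡ a ⊗ (b ⊗ c)
  ⊗-assoc = lift₃ λ l m n → trans (cong (_⊗ fromℕ𝔽 n) (fromℕ𝔽-* l m)) (trans (fromℕ𝔽-* (l * m) n)
    (trans (cong fromℕ𝔽 (ℕ.*-assoc l m n))
        (sym (trans (cong (fromℕ𝔽 l ⊗_) (fromℕ𝔽-* m n)) (fromℕ𝔽-* l (m * n))))))

  ⊕-comm : ∀ a b → a ⊕ b ≡ b ⊕ a
  ⊕-comm a b = cong fromℕ𝔽 (ℕ.+-comm (toℕ a) (toℕ b))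

  ⊗-comm : ∀ a b → a ⊗ b ≡ b ⊗ a
  ⊗-comm a b = cong fromℕ𝔽 (ℕ.*-comm (toℕ a) (toℕ b))

  ⊕-identityˡ : ∀ a → 0𝔽 ⊕ a ≡ a
  ⊕-identityˡ = lift₁ λ m → fromℕ𝔽-+ 0 m

  ⊗-identityˡ : ∀ a → 1𝔽 ⊗ a ≡ a
  ⊗-identityˡ = lift₁ λ m → trans (fromℕ𝔽-* 1 m) (cong fromℕ𝔽 (ℕ.*-identityˡ m))

  ⊗-distribˡ-⊕ : ∀ a b c → a ⊗ (b ⊕ c) ≡ a ⊗ b ⊕ a ⊗ c
  ⊗-distribˡ-⊕ = lift₃ λ l m n → trans (cong (fromℕ𝔽 l ⊗_) (fromℕ𝔽-+ m n)) (trans (fromℕ𝔽-* l (m + n))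
    (trans (cong fromℕ𝔽 (ℕ.*-distribˡ-+ l m n))
      (sym (trans (cong₂ _⊕_ (fromℕ𝔽-* l m) (fromℕ𝔽-* l n)) (fromℕ𝔽-+ (l * m) (l * n))))))

  ⊖-inverseʳ : ∀ a → a ⊕ ⊖ a ≡ 0𝔽
  ⊖-inverseʳ a = begin
    a ⊕ ⊖ a  ≡⟨ cong (_⊕ ⊖ a) (fromℕ𝔽-toℕ a) ⟨
    fromℕ𝔽 (toℕ a) ⊕ ⊖ a  ≡⟨ fromℕ𝔽-+ (toℕ a) (q ∸ toℕ a) ⟩
    fromℕ𝔽 (toℕ a + (q ∸ toℕ a)) ≡⟨ cong fromℕ𝔽 (ℕ.m+[n∸m]≡n (ℕ.<⇒≤ (Fin.toℕ<n a))) ⟩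
    fromℕ𝔽 q  ≡⟨ cong fromℕ𝔽 (ℕ.*-identityˡ q) ⟨
    fromℕ𝔽 (1 * q)  ≡⟨ fromℕ𝔽-q 1 ⟩
    0𝔽  ∎
    where open ≡-Reasoning

  isCommutativeRing : IsCommutativeRing _≡_ _⊕_ _⊗_ ⊖_ 0𝔽 1𝔽
  isCommutativeRing = record
    { isRing = record
      { +-isAbelianGroup = record
        { isGroup = record
          { isMonoid = record
            { isSemigroup = record
              { isMagma = isMagma _⊕_ ; assoc = ⊕-assoc }
            ; identity = ⊕-identityˡ , λ a → trans (⊕-comm a 0𝔽) (⊕-identityˡ a)
            }
          ; inverse = (λ a → trans (⊕-comm (⊖ a) a) (⊖-inverseʳ a)) , ⊖-inverseʳ
          ; ⁻¹-cong = cong ⊖_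
          }
        ; comm = ⊕-comm
        }
      ; *-cong = cong₂ _⊗_
      ; *-assoc = ⊗-assoc
      ; *-identity = ⊗-identityˡ , λ a → trans (⊗-comm a 1𝔽) (⊗-identityˡ a)
      ; distrib = ⊗-distribˡ-⊕ , λ a b c → trans (⊗-comm (b ⊕ c) a)
          (trans (⊗-distribˡ-⊕ a b c) (cong₂ _⊕_ (⊗-comm a b) (⊗-comm a c)))
      }
    ; *-comm = ⊗-comm
    }

  private
    residueRing : CommutativeRing 0ℓ 0ℓ
    residueRing = record { isCommutativeRing = isCommutativeRing }

  open CommutativeRing residueRing using () renaming
    (-‿inverseˡ to ⊖-inverseˡ; zeroʳ to ⊗-zeroʳ; +-identityʳ to ⊕-identityʳ; +-group to ⊕-group)
  open Algebra.Properties.Group ⊕-group using () renaming (∙-cancelʳ to ⊕-cancelʳ)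

  fromℕ𝔽-≢0 : ∀ {m} → 0 < m → m < q → fromℕ𝔽 m ≢ 0𝔽
  fromℕ𝔽-≢0 {m} 0<m m<q eq = ℕ.<-irrefl (sym m≡0) 0<m
    where
    m≡0 : m ≡ 0
    m≡0 = trans (sym (m<n⇒m%n≡m m<q)) (trans (sym (toℕ-fromℕ𝔽 m)) (trans (cong toℕ eq)
      (trans (toℕ-fromℕ𝔽 0) (m<n⇒m%n≡m (ℕ.<-trans (ℕ.s≤s ℕ.z≤n) 1<q)))))

  inverse : ∀ a → a ≢ 0𝔽 → ∃[ b ] a ⊗ b ≡ 1𝔽
  inverse a a≢0 with coprime-Bézout
    (prime⇒coprime q-prime {{ℕ.≢-nonZero λ eq → a≢0 (trans (sym (fromℕ𝔽-toℕ a)) (cong fromℕ𝔽 eq))}}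
        (Fin.toℕ<n a))
  ... | Bézout.-+ x y 1+xq≡ya = fromℕ𝔽 y , (begin
    a ⊗ fromℕ𝔽 y  ≡⟨ ⊗-comm a (fromℕ𝔽 y) ⟩
    fromℕ𝔽 y ⊗ a  ≡⟨ cong (fromℕ𝔽 y ⊗_) (fromℕ𝔽-toℕ a) ⟨
    fromℕ𝔽 y ⊗ fromℕ𝔽 (toℕ a) ≡⟨ fromℕ𝔽-* y (toℕ a) ⟩
    fromℕ𝔽 (y * toℕ a)  ≡⟨ cong fromℕ𝔽 1+xq≡ya ⟨
    fromℕ𝔽 (1 + x * q)  ≡⟨ fromℕ𝔽-+ 1 (x * q) ⟨
    1𝔽 ⊕ fromℕ𝔽 (x * q)  ≡⟨ cong (1𝔽 ⊕_) (fromℕ𝔽-q x) ⟩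
    1𝔽 ⊕ 0𝔽  ≡⟨ ⊕-identityʳ 1𝔽 ⟩
    1𝔽  ∎)
    where open ≡-Reasoning
  ... | Bézout.+- x y 1+ya≡xq = ⊖ fromℕ𝔽 y , ⊕-cancelʳ (fromℕ𝔽 y ⊗ a) _ _ (begin
    a ⊗ ⊖ fromℕ𝔽 y ⊕ fromℕ𝔽 y ⊗ a  ≡⟨ cong (a ⊗ ⊖ fromℕ𝔽 y ⊕_) (⊗-comm (fromℕ𝔽 y) a) ⟩
    a ⊗ ⊖ fromℕ𝔽 y ⊕ a ⊗ fromℕ𝔽 y  ≡⟨ ⊗-distribˡ-⊕ a _ _ ⟨
    a ⊗ (⊖ fromℕ𝔽 y ⊕ fromℕ𝔽 y)  ≡⟨ cong (a ⊗_) (⊖-inverseˡ (fromℕ𝔽 y)) ⟩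
    a ⊗ 0𝔽  ≡⟨ ⊗-zeroʳ a ⟩
    0𝔽  ≡⟨ fromℕ𝔽-q x ⟨
    fromℕ𝔽 (x * q)  ≡⟨ cong fromℕ𝔽 1+ya≡xq ⟨
    fromℕ𝔽 (1 + y * toℕ a)  ≡⟨ fromℕ𝔽-+ 1 (y * toℕ a) ⟨
    1𝔽 ⊕ fromℕ𝔽 (y * toℕ a)  ≡⟨ cong (1𝔽 ⊕_) (fromℕ𝔽-* y (toℕ a)) ⟨
    1𝔽 ⊕ fromℕ𝔽 y ⊗ fromℕ𝔽 (toℕ a)  ≡⟨ cong (λ b → 1𝔽 ⊕ fromℕ𝔽 y ⊗ b) (fromℕ𝔽-toℕ a) ⟩
    1𝔽 ⊕ fromℕ𝔽 y ⊗ a  ∎)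
    where open ≡-Reasoning

  fold-1⊕ : ∀ j → fold 0𝔽 (1𝔽 ⊕_) j ≡ fromℕ𝔽 j
  fold-1⊕ zero    = refl
  fold-1⊕ (suc j) = trans (cong (1𝔽 ⊕_) (fold-1⊕ j)) (fromℕ𝔽-+ 1 j)

  primeField : PrimeField q
  primeField = record
    { _⊕_ = _⊕_ ; _⊗_ = _⊗_ ; ⊖_ = ⊖_ ; 0𝔽 = 0𝔽 ; 1𝔽 = 1𝔽
    ; isCommutativeRing = isCommutativeRing
    ; inverse = inverse
    ; ι≢0 = λ {j} 0<j j<q eq → fromℕ𝔽-≢0 0<j j<q (trans (sym (fold-1⊕ j)) eq)
    ; ι-surjective = λ a → toℕ a , Fin.toℕ<n a , trans (fold-1⊕ (toℕ a)) (fromℕ𝔽-toℕ a)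
    ; 1<q = 1<q
    }

-- From coefficient vectors and Hamming distance to degrees and supports.

module ReedMullerCode (q : ℕ) .{{_ : NonZero q}} (q-prime : Prime q) where
  open ReedMuller q
  open Residues q q-prime using (primeField)
  private module F = PrimeField primeField
  open F using (⊖_)
  open Degree primeField hiding (Func)
  open Additive
  open Duality primeField
  open Alternative primeField
  open Leading primeField
  open FlatExtension primeField
  open Dimension primeField
  open Interpolation
  open Visible
  open Counting primeField hiding (∏)
  open ProductTest primeField using (support)

  -- `eval` with the list of exponents made arbitrary, so that induction on it is possible.
  evalList : ∀ {n} (αs : List (Vec ℕ n)) → Vec 𝔽 (length αs) → Func n
  evalList αs p x = foldr′ _⊕_ 0𝔽 (zipWith (λ c α → c ⊗ monomial α x) p (fromList αs))

  Deg-monomial : ∀ {n} (α : Vec ℕ n) → Deg (Vec.sum α) (monomial α)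
  Deg-monomial []      = resp≗ (λ { [] → refl }) (const 1𝔽)
  Deg-monomial (a ∷ α) = resp≗ (λ { (x ∷ xs) → refl }) (Deg-⊗ (power a) (Deg-tail (Deg-monomial α)))
    where
    power : ∀ {n} a → Deg {suc n} a (λ x → head x ^𝔽 a)
    power zero    = const 1𝔽
    power (suc a) = resp≗ (λ { (x ∷ xs) → refl }) (var zero (power a))

  Deg-evalList : ∀ {n d} {αs : List (Vec ℕ n)} → All (λ α → Vec.sum α ≤ d) αs → ∀ p → Deg d (evalList αs p)
  Deg-evalList []           []      = const 0𝔽
  Deg-evalList (α≤d ∷ αs≤d) (c ∷ p) = add (Deg-scale c (Deg-≤ α≤d (Deg-monomial _))) (Deg-evalList αs≤d p)

  Deg-eval : ∀ {n d} (p : Poly≤ n d) → Deg d (eval {n} {d} p)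
  Deg-eval {n} {d} = Deg-evalList (All.all-filter (λ α → Vec.sum α ℕ.≤? d) (tuples (upTo (suc d)) n))

  monomial-zero : ∀ {n} (x : Vec 𝔽 n) → monomial (Vec.replicate n 0) x ≡ 1𝔽
  monomial-zero []      = refl
  monomial-zero (a ∷ x) = trans (F.⊗-identityˡ _) (monomial-zero x)

  monomial-suc : ∀ {n} (α : Vec ℕ n) i x → monomial (updateAt α i suc) x ≡ lookup x i ⊗ monomial α x
  monomial-suc (a ∷ α) zero    (x ∷ xs) = F.⊗-assoc x (x ^𝔽 a) (monomial α xs)
  monomial-suc (a ∷ α) (suc i) (x ∷ xs) = begin
    x ^𝔽 a ⊗ monomial (updateAt α i suc) xs  ≡⟨ cong (x ^𝔽 a ⊗_) (monomial-suc α i xs) ⟩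
    x ^𝔽 a ⊗ (lookup xs i ⊗ monomial α xs)  ≡⟨ F.⊗-assoc (x ^𝔽 a) (lookup xs i) (monomial α xs) ⟨
    x ^𝔽 a ⊗ lookup xs i ⊗ monomial α xs  ≡⟨ cong (_⊗ monomial α xs) (F.⊗-comm (x ^𝔽 a) (lookup xs i)) ⟩
    lookup xs i ⊗ x ^𝔽 a ⊗ monomial α xs  ≡⟨ F.⊗-assoc (lookup xs i) (x ^𝔽 a) (monomial α xs) ⟩
    lookup xs i ⊗ (x ^𝔽 a ⊗ monomial α xs)  ∎
    where open ≡-Reasoning

  sum-suc : ∀ {n} (α : Vec ℕ n) i → Vec.sum (updateAt α i suc) ≡ suc (Vec.sum α)
  sum-suc (a ∷ α) zero    = refl
  sum-suc (a ∷ α) (suc i) = trans (cong (a ℕ.+_) (sum-suc α i)) (ℕ.+-suc a (Vec.sum α))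

  sum-zero : ∀ n → Vec.sum (Vec.replicate n 0) ≡ 0
  sum-zero zero    = refl
  sum-zero (suc n) = sum-zero n

  lookup≤sum : ∀ {n} (α : Vec ℕ n) i → lookup α i ≤ Vec.sum α
  lookup≤sum (a ∷ α) zero    = ℕ.m≤m+n a (Vec.sum α)
  lookup≤sum (a ∷ α) (suc i) = ℕ.≤-trans (lookup≤sum α i) (ℕ.m≤n+m (Vec.sum α) a)

  Deg-monomials : ∀ {n d} {Φ : Func n → Set} → Additive Φ →
    (∀ c α → Vec.sum α ≤ d → Φ (λ x → c ⊗ monomial α x)) → ∀ {f} → Deg d f → Φ f
  Deg-monomials {n} ad gen (const c) =
      ad .Φ-≗ (λ x → trans (cong (c ⊗_) (monomial-zero x)) (F.⊗-identityʳ c))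
    (gen c (Vec.replicate n 0) (ℕ.≤-trans (ℕ.≤-reflexive (sum-zero n)) z≤n))
  Deg-monomials ad gen (add df dg) = ad .Φ-⊕ (Deg-monomials ad gen df) (Deg-monomials ad gen dg)
  Deg-monomials {d = suc d} ad gen (var i df) = Deg-monomials (Additive-⊗ ad (λ x → lookup x i))
    (λ c α α≤d → ad .Φ-≗ (λ x → trans (cong (c ⊗_) (monomial-suc α i x))
        (swap c (lookup x i) (monomial α x)))
      (gen c (updateAt α i suc) (subst (_≤ suc d) (sym (sum-suc α i)) (s≤s α≤d)))) df
    where
    swap : ∀ a b c → a ⊗ (b ⊗ c) ≡ b ⊗ (a ⊗ c)
    swap a b c = trans (sym (F.⊗-assoc a b c)) (trans (cong (_⊗ c) (F.⊗-comm a b)) (F.⊗-assoc b a c))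
  Deg-monomials ad gen (resp≗ f≗g df) = ad .Φ-≗ f≗g (Deg-monomials ad gen df)

  evalList-⊕ : ∀ {n} (αs : List (Vec ℕ n)) p r x →
      evalList αs (zipWith _⊕_ p r) x ≡ evalList αs p x ⊕ evalList αs r x
  evalList-⊕ []       []      []      x = sym (F.⊕-identityˡ 0𝔽)
  evalList-⊕ (α ∷ αs) (c ∷ p) (d ∷ r) x = trans (cong ((c ⊕ d) ⊗ monomial α x ⊕_) (evalList-⊕ αs p r x))
    (F.Solver.solve 5 (λ c d m u v → (c :+ d) :* m :+ (u :+ v) := (c :* m :+ u) :+ (d :* m :+ v)) refl
      c d (monomial α x) (evalList αs p x) (evalList αs r x))
    where open F.Solver using (_:+_; _:*_; _:=_)

  evalList-0 : ∀ {n} (αs : List (Vec ℕ n)) x → evalList αs (Vec.replicate _ 0𝔽) x ≡ 0𝔽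
  evalList-0 []       x = refl
  evalList-0 (α ∷ αs) x = trans (cong₂ _⊕_ (F.⊗-zeroˡ _) (evalList-0 αs x)) (F.⊕-identityˡ 0𝔽)

  evalList-monomial : ∀ {n} {αs : List (Vec ℕ n)} c {α} → α ∈ αs →
      ∃[ p ] (∀ x → evalList αs p x ≡ c ⊗ monomial α x)
  evalList-monomial {αs = α ∷ αs} c (here refl) = (c ∷ Vec.replicate _ 0𝔽) , λ x →
    trans (cong (c ⊗ monomial α x ⊕_) (evalList-0 αs x)) (F.⊕-identityʳ _)
  evalList-monomial {αs = β ∷ αs} c (there α∈) = let p , eq = evalList-monomial c α∈ in (0𝔽 ∷ p) , λ x →
    trans (cong₂ _⊕_ (F.⊗-zeroˡ (monomial β x)) (eq x)) (F.⊕-identityˡ _)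

  Deg⇒eval : ∀ {n d f} → Deg {n} d f → Σ[ p ∈ Poly≤ n d ] (f ≗ eval {n} {d} p)
  Deg⇒eval {n} {d} = Deg-monomials ad λ c α α≤d →
    let p , eq = evalList-monomial c (∈-filter⁺ (λ α → Vec.sum α ℕ.≤? d)
          (tuples⁺ α λ i → ∈-upTo⁺ (s≤s (ℕ.≤-trans (lookup≤sum α i) α≤d))) α≤d)
    in p , λ x → sym (eq x)
    where
    ad : Additive (λ f → Σ[ p ∈ Poly≤ n d ] (f ≗ eval {n} {d} p))
    ad .Φ-⊕ (p , f≗p) (r , g≗r) = zipWith _⊕_ p r , λ x →
      trans (cong₂ _⊕_ (f≗p x) (g≗r x)) (sym (evalList-⊕ (exponents n d) p r x))
    ad .Φ-≗ f≗g (p , f≗p) = p , λ x → trans (sym (f≗g x)) (f≗p x)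

  𝒫-enumeration : ∀ n d → Enumeration d (𝒫 n d)
  𝒫-enumeration n d = record
    { sound    = λ P∈ → sound (∈-map⁻ (eval {n} {d}) (Any.deduplicate⁻ _≗?_ P∈))
    ; complete = λ dP → let p , P≗p = Deg⇒eval dP in
        SetoidMembership.∈-deduplicate⁺ S _≗?_ (λ {h} {f} {g} f≗g h≗f x → trans (h≗f x) (sym (f≗g x)))
          (Any.map (λ { refl → P≗p }) (∈-map⁺ (eval {n} {d}) (∈-tuples ∈-allFin p)))
    ; unique   = DecUnique.deduplicate-! (funcDecSetoid n) _
    }
    where
    S = DecSetoid.setoid (funcDecSetoid n)
    sound : ∀ {P} → (∃[ p ] p ∈ _ × P ≡ eval {n} {d} p) → Deg d P
    sound (p , _ , refl) = Deg-eval {n} {d} p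

  -- The function f - h lies in the code, and f differs from it only where h is nonzero.
  far⇒support : ∀ {n d Δ} {f h : Func n} → Far Δ f (𝒫 n d) → Deg d (λ x → f x ⊕ ⊖ h x) →
    Δ < length (support h)
  far⇒support {n} {d} {Δ} {f} {h} far dg with g , g∈ , f-h≗g ← find
      (Enumeration.complete (𝒫-enumeration n d) dg) = begin-strict
    Δ  <⟨ far ⟩
    distance f (𝒫 n d)
      ≤⟨ All.lookup (Extrema.min≤xs (q ^ n) (map (hamming f) (𝒫 n d))) (∈-map⁺ (hamming f) g∈) ⟩
    hamming f g
      ≡⟨ length-filter-∑ (λ x → ¬? (f x Fin.≟ g x)) (points n) ⟩
    ∑ (points n) (λ x → 𝟙 (¬? (f x Fin.≟ g x)))
      ≤⟨ ∑-mono (points n) (λ {x} _ → 𝟙-mono (¬? (f x Fin.≟ g x)) (¬? (h x Fin.≟ 0𝔽)) (differ x)) ⟩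
    ∑ (points n) (λ x → 𝟙 (¬? (h x Fin.≟ 0𝔽)))
      ≡⟨ length-filter-∑ (λ x → ¬? (h x Fin.≟ 0𝔽)) (points n) ⟨
    length (support h)  ∎
    where
    open ℕ.≤-Reasoning
    differ : ∀ x → f x ≢ g x → h x ≢ 0𝔽
    differ x f≢g h≡0 = f≢g (trans (sym
        (trans (cong (λ z → f x ⊕ ⊖ z) h≡0) (trans (cong (f x ⊕_) F.⊖0≡0) (F.⊕-identityʳ (f x)))))
            (f-h≗g x))

  accepts? : ∀ {n k} d e (f : Func n) (Ps : Vec (Func n) k) → Dec ((f · ∏ Ps) ∈F 𝒫 n (d + e * k))
  accepts? {n} {k} d e f Ps = (f · ∏ Ps) ∈F? 𝒫 n (d + e * k)

  accepts⇒Deg : ∀ {n k d e} {f : Func n} (Ps : Vec (Func n) k) → (f · ∏ Ps) ∈F 𝒫 n (d + e * k) →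
      Deg (d + k * e) (f · ∏ Ps)
  accepts⇒Deg {n} {k} {d} {e} Ps acc with g , g∈ , f∏≗g ← find acc =
    resp≗ (λ x → sym (f∏≗g x)) (Deg-≤ (ℕ.≤-reflexive (cong (d ℕ.+_) (ℕ.*-comm e k)))
        (Enumeration.sound (𝒫-enumeration n (d + e * k)) g∈))

-- Numerical estimates for the two bounds.

n<2^n : ∀ n → n < 2 ^ n
n<2^n zero    = s≤s z≤n
n<2^n (suc n) = ℕ.≤-trans (ℕ.+-mono-≤ (ℕ.m^n>0 2 n) (n<2^n n))
    (ℕ.≤-reflexive (cong (2 ^ n ℕ.+_) (sym (ℕ.+-identityʳ (2 ^ n)))))

-- The inequality 1 + b/p ≤ (1 + 1/p)^b, cleared of denominators.
bernoulli : ∀ p b → (p + b) * p ^ b ≤ p * suc p ^ b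
bernoulli p zero    = ℕ.≤-reflexive (cong (_* 1) (ℕ.+-identityʳ p))
bernoulli p (suc b) = begin
  (p + suc b) * (p * p ^ b)
    ≡⟨ solve 3 (λ p b z → (p :+ (con 1 :+ b)) :* (p :* z) := (p :* p :+ p :* b :+ p) :* z) refl p b
        (p ^ b) ⟩
  (p * p + p * b + p) * p ^ b  ≤⟨ ℕ.*-monoˡ-≤ (p ^ b) (ℕ.m≤m+n (p * p + p * b + p) b) ⟩
  (p * p + p * b + p + b) * p ^ b
    ≡⟨ solve 3 (λ p b z → (p :* p :+ p :* b :+ p :+ b) :* z := (con 1 :+ p) :* ((p :+ b) :* z)) refl p b
        (p ^ b) ⟩
  suc p * ((p + b) * p ^ b)  ≤⟨ ℕ.*-monoʳ-≤ (suc p) (bernoulli p b) ⟩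
  suc p * (p * suc p ^ b)
    ≡⟨ solve 2 (λ p z → (con 1 :+ p) :* (p :* z) := p :* ((con 1 :+ p) :* z)) refl p (suc p ^ b) ⟩
  p * (suc p * suc p ^ b)  ∎
  where
  open ℕ.≤-Reasoning
  open +-*-Solver

m<[1+m/n]*n : ∀ m n .{{_ : NonZero n}} → m < suc (m ℕ./ n) * n
m<[1+m/n]*n m n = ℕ.≤-trans (s≤s (ℕ.≤-reflexive (m≡m%n+[m/n]*n m n)))
    (ℕ.+-monoˡ-≤ (m ℕ./ n * n) (m%n<n m n))

m≤n/o : ∀ {m n} o .{{_ : NonZero o}} → m * o ≤ n → m ≤ n ℕ./ o
m≤n/o {m} {n} o mo≤n = subst (_≤ n ℕ./ o) (m*n/n≡m m o) (/-monoˡ-≤ o mo≤n)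

-- `E` stands for a common bound on the reciprocals of ε and δ, and 1/C becomes the constant c. The
-- exponent `C` adds the needs of both cases: its first summand serves the leading case, and 2 D the
-- flat one, where q^r ≤ ρ^D. The first summand of `r₀` forces e ≥ 4q(2 + k), hence t ≥ 2 + k; the
-- second forces ρ to be large.
module Exponents (q k E : ℕ) .{{_ : NonZero q}} .{{_ : NonZero k}} .{{_ : NonZero E}} (1<q : 1 < q) where
  open ℕ.≤-Reasoning

  -- B is large enough that (1 - q^-k)^B ≤ 1/q.
  P B D C r₀ : ℕ
  P = q ^ k ∸ 1
  B = q * suc P
  D = suc k * E
  C = q * (E * (4 * q * (3 + k))) + 2 * D
  r₀ = E * (4 * q * (2 + k)) + (B * suc (3 * B)) ^ D

  instance
    nonZero-B : NonZero B
    nonZero-B = ℕ.m*n≢0 q (suc P)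

  q^k≡1+P : q ^ k ≡ suc P
  q^k≡1+P = sym (ℕ.m+[n∸m]≡n (ℕ.m^n>0 q k))

  instance
    nonZero-D : NonZero D
    nonZero-D = ℕ.m*n≢0 (suc k) E

    nonZero-C : NonZero C
    nonZero-C = ℕ.>-nonZero (ℕ.<-≤-trans (ℕ.>-nonZero⁻¹ (2 * D) {{ℕ.m*n≢0 2 D}})
        (ℕ.m≤n+m (2 * D) (q * (E * (4 * q * (3 + k))))))

  0<P : 0 < P
  0<P = ℕ.m<n⇒0<n∸m (ℕ.≤-trans 1<q (ℕ.≤-trans (ℕ.≤-reflexive (sym (ℕ.*-identityʳ q)))
      (ℕ.^-monoʳ-≤ q (ℕ.>-nonZero⁻¹ k))))

  instance
    nonZero-P : NonZero P
    nonZero-P = ℕ.>-nonZero 0<P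

  q*P^B≤ : q * P ^ B ≤ suc P ^ B
  q*P^B≤ = ℕ.*-cancelˡ-≤ P (begin
    P * (q * P ^ B)  ≡⟨ ℕ.*-assoc P q (P ^ B) ⟨
    P * q * P ^ B  ≡⟨ cong (_* P ^ B) (ℕ.*-comm P q) ⟩
    q * P * P ^ B  ≤⟨ ℕ.*-monoˡ-≤ (P ^ B) (ℕ.≤-trans (ℕ.*-monoʳ-≤ q (ℕ.n≤1+n P)) (ℕ.m≤n+m B P)) ⟩
    (P + B) * P ^ B  ≤⟨ bernoulli P B ⟩
    P * suc P ^ B  ∎)

  q^m*P^ρ≤ : ∀ m ρ → m * B ≤ ρ → q ^ m * P ^ ρ ≤ suc P ^ ρ
  q^m*P^ρ≤ zero    ρ _    = ℕ.≤-trans (ℕ.≤-reflexive (ℕ.*-identityˡ (P ^ ρ))) (ℕ.^-monoˡ-≤ ρ (ℕ.n≤1+n P))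
  q^m*P^ρ≤ (suc m) ρ mB≤ρ = subst (λ ρ → q ^ suc m * P ^ ρ ≤ suc P ^ ρ)
      (ℕ.m+[n∸m]≡n (ℕ.≤-trans (ℕ.m≤m+n B (m * B)) mB≤ρ)) (begin
    q * q ^ m * P ^ (B + ρ′)  ≡⟨ cong (q * q ^ m *_) (ℕ.^-distribˡ-+-* P B ρ′) ⟩
    q * q ^ m * (P ^ B * P ^ ρ′)
      ≡⟨ solve 4 (λ a b c d → a :* b :* (c :* d) := a :* c :* (b :* d)) refl q (q ^ m) (P ^ B) (P ^ ρ′) ⟩
    q * P ^ B * (q ^ m * P ^ ρ′)
      ≤⟨ ℕ.*-mono-≤ q*P^B≤ (q^m*P^ρ≤ m ρ′
          (ℕ.+-cancelˡ-≤ B _ _ (ℕ.≤-trans mB≤ρ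
              (ℕ.≤-reflexive (sym (ℕ.m+[n∸m]≡n (ℕ.≤-trans (ℕ.m≤m+n B (m * B)) mB≤ρ))))))) ⟩
    suc P ^ B * suc P ^ ρ′  ≡⟨ ℕ.^-distribˡ-+-* (suc P) B ρ′ ⟨
    suc P ^ (B + ρ′)  ∎)
    where
    ρ′ = ρ ∸ B
    open +-*-Solver

  module _ {r e Δ : ℕ} (r₀≤r : r₀ ≤ r) (q^r≤ : q ^ r ≤ suc Δ ^ E) (r≤Ee : r ≤ E * e) (4ke≤r : 4 * (k * e) ≤ r) where

    -- `u` is the excess A - ke; dividing it by q makes t (q - 1) ≤ u.
    u t : ℕ
    u = e ℕ./ 4
    t = u ℕ./ q

    4q[2+k]≤e : 4 * q * (2 + k) ≤ e
    4q[2+k]≤e = ℕ.*-cancelˡ-≤ E (ℕ.≤-trans (ℕ.m≤m+n _ _) (ℕ.≤-trans r₀≤r r≤Ee))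

    [2+k]q≤u : (2 + k) * q ≤ u
    [2+k]q≤u = m≤n/o 4 (ℕ.≤-trans (ℕ.≤-reflexive
        (solve 2 (λ k q → (con 2 :+ k) :* q :* con 4 := con 4 :* q :* (con 2 :+ k)) refl k q)) 4q[2+k]≤e)
      where open +-*-Solver

    q≤u : q ≤ u
    q≤u = ℕ.≤-trans (ℕ.m≤m+n q _) [2+k]q≤u

    instance
      nonZero-u : NonZero u
      nonZero-u = ℕ.>-nonZero (ℕ.<-≤-trans (ℕ.<-trans (s≤s z≤n) 1<q) q≤u)

    1+pred-u≡u : suc (pred u) ≡ u
    1+pred-u≡u = ℕ.suc-pred u

    4u≤e : 4 * u ≤ e
    4u≤e = ℕ.≤-trans (ℕ.≤-reflexive (ℕ.*-comm 4 u)) (m/n*n≤m e 4)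

    pred-u<e : pred u < e
    pred-u<e = ℕ.≤-trans (ℕ.≤-reflexive 1+pred-u≡u) (ℕ.≤-trans (ℕ.m≤m+n u (3 * u)) 4u≤e)

    t≤u : t * (q ∸ 1) ≤ suc (pred u)
    t≤u = ℕ.≤-trans (ℕ.*-monoʳ-≤ t (ℕ.m∸n≤m q 1)) (ℕ.≤-trans (m/n*n≤m u q) (ℕ.≤-reflexive (sym 1+pred-u≡u)))

    -- Since q ≤ u, the left side is at most 3ke + 4u ≤ 3ke + e ≤ 4ke: the quarter in u matches the
    -- 4 in e ≤ r/(4k).
    slack : 3 * (k * e + suc (pred u)) + q ≤ r
    slack = begin
      3 * (k * e + suc (pred u)) + q  ≡⟨ cong (λ z → 3 * (k * e + z) + q) 1+pred-u≡u ⟩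
      3 * (k * e + u) + q  ≤⟨ ℕ.+-monoʳ-≤ (3 * (k * e + u)) q≤u ⟩
      3 * (k * e + u) + u
        ≡⟨ solve 2 (λ b u → con 3 :* (b :+ u) :+ u := con 3 :* b :+ con 4 :* u) refl (k * e) u ⟩
      3 * (k * e) + 4 * u  ≤⟨ ℕ.+-monoʳ-≤ (3 * (k * e)) (ℕ.≤-trans 4u≤e (ℕ.m≤n*m e k)) ⟩
      3 * (k * e) + k * e  ≡⟨ solve 1 (λ b → con 3 :* b :+ b := con 4 :* b) refl (k * e) ⟩
      4 * (k * e)  ≤⟨ 4ke≤r ⟩
      r  ∎
      where open +-*-Solver

    2+k≤t : 2 + k ≤ t
    2+k≤t = m≤n/o q [2+k]q≤u

    e≤4q[1+t] : e ≤ 4 * (q * suc t)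
    e≤4q[1+t] = begin
      e  ≤⟨ ℕ.<⇒≤ (m<[1+m/n]*n e 4) ⟩
      suc u * 4  ≤⟨ ℕ.*-monoˡ-≤ 4 (m<[1+m/n]*n u q) ⟩
      suc t * q * 4  ≡⟨ solve 2 (λ t q → t :* q :* con 4 := con 4 :* (q :* t)) refl (suc t) q ⟩
      4 * (q * suc t)  ∎
      where open +-*-Solver

    -- M = 2^s with s = t - (k + 1): then 2^t ≥ k + 1 + 2^s, which absorbs the factor k ≤ q^k and
    -- the 1 in `suc M`. As s still grows linearly with r, a fixed power of M reaches q^r.
    leading-exponent : ∀ {acc tot} → q ^ (2 ^ t) * acc ≤ k * tot →
        ∃[ M ] q ^ r ≤ M ^ C × q ^ suc M * acc ≤ tot
    leading-exponent {acc} {tot} bound = 2 ^ s , q^r≤M^C , ℕ.*-cancelˡ-≤ (q ^ k) {{ℕ.m^n≢0 q k}} (begin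
      q ^ k * (q ^ suc (2 ^ s) * acc)  ≡⟨ ℕ.*-assoc (q ^ k) (q ^ suc (2 ^ s)) acc ⟨
      q ^ k * q ^ suc (2 ^ s) * acc  ≡⟨ cong (_* acc) (ℕ.^-distribˡ-+-* q k (suc (2 ^ s))) ⟨
      q ^ (k + suc (2 ^ s)) * acc  ≤⟨ ℕ.*-monoˡ-≤ acc (ℕ.^-monoʳ-≤ q k+1+2^s≤2^t) ⟩
      q ^ (2 ^ t) * acc  ≤⟨ bound ⟩
      k * tot
        ≤⟨ ℕ.*-monoˡ-≤ tot (ℕ.<⇒≤ (ℕ.<-≤-trans (n<2^n k) (ℕ.^-monoˡ-≤ k 1<q))) ⟩
      q ^ k * tot  ∎)
      where
      open +-*-Solver
      s = t ∸ suc k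
      1+k+s≡t : suc k + s ≡ t
      1+k+s≡t = ℕ.m+[n∸m]≡n (ℕ.≤-trans (ℕ.n≤1+n (suc k)) 2+k≤t)
      1≤s : 1 ≤ s
      1≤s = ℕ.+-cancelˡ-≤ (suc k) 1 s (ℕ.≤-trans (ℕ.≤-reflexive (ℕ.+-comm (suc k) 1))
          (ℕ.≤-trans 2+k≤t (ℕ.≤-reflexive (sym 1+k+s≡t))))
      k+1+2^s≤2^t : k + suc (2 ^ s) ≤ 2 ^ t
      k+1+2^s≤2^t = begin
        k + suc (2 ^ s)  ≡⟨ ℕ.+-suc k (2 ^ s) ⟩
        suc k + 2 ^ s  ≤⟨ ℕ.+-monoˡ-≤ (2 ^ s) (ℕ.m≤m*n (suc k) (2 ^ s) {{ℕ.m^n≢0 2 s}}) ⟩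
        suc k * 2 ^ s + 2 ^ s  ≡⟨ ℕ.+-comm (suc k * 2 ^ s) (2 ^ s) ⟩
        suc (suc k) * 2 ^ s  ≤⟨ ℕ.*-monoˡ-≤ (2 ^ s) (n<2^n (suc k)) ⟩
        2 ^ suc k * 2 ^ s  ≡⟨ ℕ.^-distribˡ-+-* 2 (suc k) s ⟨
        2 ^ (suc k + s)  ≡⟨ cong (2 ^_) 1+k+s≡t ⟩
        2 ^ t  ∎
      1+t≤ : suc t ≤ (3 + k) * s
      1+t≤ = begin
        suc t  ≡⟨ cong suc 1+k+s≡t ⟨
        (2 + k) + s  ≤⟨ ℕ.+-monoˡ-≤ s (ℕ.m≤m*n (2 + k) s {{ℕ.>-nonZero 1≤s}}) ⟩
        (2 + k) * s + s  ≡⟨ ℕ.+-comm ((2 + k) * s) s ⟩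
        (3 + k) * s  ∎
      qr≤sC : q * r ≤ s * C
      qr≤sC = begin
        q * r  ≤⟨ ℕ.*-monoʳ-≤ q r≤Ee ⟩
        q * (E * e)  ≤⟨ ℕ.*-monoʳ-≤ q (ℕ.*-monoʳ-≤ E e≤4q[1+t]) ⟩
        q * (E * (4 * (q * suc t)))
          ≤⟨ ℕ.*-monoʳ-≤ q (ℕ.*-monoʳ-≤ E (ℕ.*-monoʳ-≤ 4 (ℕ.*-monoʳ-≤ q 1+t≤))) ⟩
        q * (E * (4 * (q * ((3 + k) * s))))
          ≡⟨ solve 4 (λ q E k s → q :* (E :* (con 4 :* (q :* ((con 3 :+ k) :* s)))) := s :*
              (q :* (E :* (con 4 :* q :* (con 3 :+ k))))) refl q E k s ⟩
        s * (q * (E * (4 * q * (3 + k))))  ≤⟨ ℕ.*-monoʳ-≤ s (ℕ.m≤m+n _ (2 * D)) ⟩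
        s * C  ∎
      q^r≤M^C : q ^ r ≤ (2 ^ s) ^ C
      q^r≤M^C = begin
        q ^ r  ≤⟨ ℕ.^-monoˡ-≤ r (ℕ.<⇒≤ (n<2^n q)) ⟩
        (2 ^ q) ^ r  ≡⟨ ℕ.^-*-assoc 2 q r ⟩
        2 ^ (q * r)  ≤⟨ ℕ.^-monoʳ-≤ 2 qr≤sC ⟩
        2 ^ (s * C)  ≡⟨ ℕ.^-*-assoc 2 s C ⟨
        (2 ^ s) ^ C  ∎

    -- Every B nodes contribute a factor 1/q, which gives m = ⌊ρ/B⌋ such factors and M = m - 1.
    flat-exponent : ∀ {acc tot} ρ → suc Δ ≤ ρ ^ suc k → (q ^ k) ^ ρ * acc ≤ (q ^ k ∸ 1) ^ ρ * tot →
      ∃[ M ] q ^ r ≤ M ^ C × q ^ suc M * acc ≤ tot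
    flat-exponent {acc} {tot} ρ Δ< bound = M , q^r≤M^C , ℕ.*-cancelˡ-≤ (P ^ ρ) {{ℕ.m^n≢0 P ρ}} (begin
      P ^ ρ * (q ^ suc M * acc)
        ≡⟨ solve 3 (λ a b c → a :* (b :* c) := b :* a :* c) refl (P ^ ρ) (q ^ suc M) acc ⟩
      q ^ suc M * P ^ ρ * acc  ≡⟨ cong (λ m → q ^ m * P ^ ρ * acc) 1+M≡m ⟩
      q ^ m * P ^ ρ * acc  ≤⟨ ℕ.*-monoˡ-≤ acc (q^m*P^ρ≤ m ρ (m/n*n≤m ρ B)) ⟩
      suc P ^ ρ * acc  ≡⟨ cong (λ z → z ^ ρ * acc) q^k≡1+P ⟨
      (q ^ k) ^ ρ * acc  ≤⟨ bound ⟩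
      P ^ ρ * tot  ∎)
      where
      open +-*-Solver
      m = ρ ℕ./ B
      M = pred m
      q^r≤ρ^D : q ^ r ≤ ρ ^ D
      q^r≤ρ^D = ℕ.≤-trans q^r≤ (ℕ.≤-trans (ℕ.^-monoˡ-≤ E Δ<) (ℕ.≤-reflexive (ℕ.^-*-assoc ρ (suc k) E)))
      -- Otherwise ρ is bounded independently of r, and q^r ≤ ρ^D ≤ r₀ ≤ r < q^r.
      3B<m : 3 * B < m
      3B<m with 3 * B ℕ.<? m
      ... | yes 3B<m = 3B<m
      ... | no  3B≮m = contradiction (begin-strict
        q ^ r  ≤⟨ q^r≤ρ^D ⟩
        ρ ^ D  ≤⟨ ℕ.^-monoˡ-≤ D (ℕ.<⇒≤ (m<[1+m/n]*n ρ B)) ⟩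
        (suc m * B) ^ D  ≤⟨ ℕ.^-monoˡ-≤ D (ℕ.*-monoˡ-≤ B (s≤s (ℕ.≮⇒≥ 3B≮m))) ⟩
        (suc (3 * B) * B) ^ D  ≡⟨ cong (_^ D) (ℕ.*-comm (suc (3 * B)) B) ⟩
        (B * suc (3 * B)) ^ D  ≤⟨ ℕ.≤-trans (ℕ.m≤n+m _ (E * (4 * q * (2 + k)))) r₀≤r ⟩
        r  <⟨ n<2^n r ⟩
        2 ^ r  ≤⟨ ℕ.^-monoˡ-≤ r 1<q ⟩
        q ^ r  ∎) (ℕ.<-irrefl refl)
      1+M≡m : suc M ≡ m
      1+M≡m = ℕ.suc-pred m {{ℕ.>-nonZero (ℕ.≤-trans (s≤s z≤n) 3B<m)}}
      3B≤M : 3 * B ≤ M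
      3B≤M = ℕ.≤-pred (ℕ.≤-trans 3B<m (ℕ.≤-reflexive (sym 1+M≡m)))
      1≤M : 1 ≤ M
      1≤M = ℕ.≤-trans (ℕ.≤-trans (ℕ.>-nonZero⁻¹ B) (ℕ.m≤m+n B (2 * B))) 3B≤M
      -- The factor B lost between ρ and M is recovered by squaring M, whence the 2 D in `C`.
      ρ≤M*M : ρ ≤ M * M
      ρ≤M*M = begin
        ρ  ≤⟨ ℕ.<⇒≤ (m<[1+m/n]*n ρ B) ⟩
        suc m * B  ≡⟨ cong (λ z → suc z * B) 1+M≡m ⟨
        (2 + M) * B  ≤⟨ ℕ.*-monoˡ-≤ B (ℕ.+-monoˡ-≤ M (ℕ.*-monoʳ-≤ 2 1≤M)) ⟩
        (2 * M + M) * B  ≡⟨ solve 2 (λ M B → (con 2 :* M :+ M) :* B := M :* (con 3 :* B)) refl M B ⟩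
        M * (3 * B)  ≤⟨ ℕ.*-monoʳ-≤ M 3B≤M ⟩
        M * M  ∎
      q^r≤M^C : q ^ r ≤ M ^ C
      q^r≤M^C = begin
        q ^ r  ≤⟨ q^r≤ρ^D ⟩
        ρ ^ D  ≤⟨ ℕ.^-monoˡ-≤ D ρ≤M*M ⟩
        (M * M) ^ D  ≡⟨ cong (λ z → (M * z) ^ D) (ℕ.*-identityʳ M) ⟨
        (M ^ 2) ^ D  ≡⟨ ℕ.^-*-assoc M 2 D ⟩
        M ^ (2 * D)
          ≤⟨ ℕ.^-monoʳ-≤ M {{ℕ.>-nonZero 1≤M}} (ℕ.m≤n+m (2 * D) (q * (E * (4 * q * (3 + k))))) ⟩
        M ^ C  ∎

    exponent : ∀ {acc tot} → (q ^ (2 ^ t) * acc ≤ k * tot) ⊎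
      (∃[ ρ ] suc Δ ≤ ρ ^ suc k × (q ^ k) ^ ρ * acc ≤ (q ^ k ∸ 1) ^ ρ * tot) →
      ∃[ M ] q ^ r ≤ M ^ C × q ^ suc M * acc ≤ tot
    exponent (inj₁ bound)            = leading-exponent bound
    exponent (inj₂ (ρ , Δ< , bound)) = flat-exponent ρ Δ< bound

-- Fractions, Dedekind cuts and the passage to probabilities.

toℚᵘ-/ : ∀ m n .{{_ : NonZero n}} → ℚ.toℚᵘ (+ m / n) ℚᵘ.≃ (+ m ℚᵘ./ n)
toℚᵘ-/ m (suc n) = ℚ.toℚᵘ-fromℚᵘ (ℚᵘ.mkℚᵘ (+ m) n)

/-<⁺ : ∀ {m n m′ n′} .{{_ : NonZero n}} .{{_ : NonZero n′}} → m * n′ < m′ * n → + m / n ℚ.< + m′ / n′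
/-<⁺ {m} {suc n} {m′} {suc n′} lt = ℚ.toℚᵘ-cancel-<
  (ℚᵘ.<-respˡ-≃ (ℚᵘ.≃-sym (toℚᵘ-/ m (suc n))) (ℚᵘ.<-respʳ-≃ (ℚᵘ.≃-sym (toℚᵘ-/ m′ (suc n′)))
    (ℚᵘ.*<* (subst₂ ℤ._<_ (ℤ.pos-* m (suc n′)) (ℤ.pos-* m′ (suc n)) (ℤ.+<+ lt)))))

/-<⁻ : ∀ {m n m′ n′} .{{_ : NonZero n}} .{{_ : NonZero n′}} → + m / n ℚ.< + m′ / n′ → m * n′ < m′ * n
/-<⁻ {m} {suc n} {m′} {suc n′} lt
  with ℚᵘ.*<* lt′ ← ℚᵘ.<-respˡ-≃ (toℚᵘ-/ m (suc n)) (ℚᵘ.<-respʳ-≃ (toℚᵘ-/ m′ (suc n′)) (ℚ.toℚᵘ-mono-< lt)) =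
  ℤ.drop‿+<+ (subst₂ ℤ._<_ (sym (ℤ.pos-* m (suc n′))) (sym (ℤ.pos-* m′ (suc n))) lt′)

/-≤⁺ : ∀ {m n m′ n′} .{{_ : NonZero n}} .{{_ : NonZero n′}} → m * n′ ≤ m′ * n → + m / n ℚ.≤ + m′ / n′
/-≤⁺ {m} {n} {m′} {n′} le = ℚ.≮⇒≥ λ gt → ℕ.≤⇒≯ le (/-<⁻ {m′} {n′} {m} {n} gt)

/-≤⁻ : ∀ {m n m′ n′} .{{_ : NonZero n}} .{{_ : NonZero n′}} → + m / n ℚ.≤ + m′ / n′ → m * n′ ≤ m′ * n
/-≤⁻ {m} {n} {m′} {n′} le = ℕ.≮⇒≥ λ gt → ℚ.<-irrefl refl (ℚ.<-≤-trans (/-<⁺ {m′} {n′} {m} {n} gt) le)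

/-* : ∀ m n m′ .{{_ : NonZero n}} → (+ m / n) ℚ.* (+ m′ / 1) ≡ + (m * m′) / n
/-* m (suc n) m′ = ℚ.toℚᵘ-injective (ℚᵘ.≃-trans (ℚ.toℚᵘ-homo-* (+ m / suc n) (+ m′ / 1))
  (ℚᵘ.≃-trans (ℚᵘ.*-cong (toℚᵘ-/ m (suc n)) (toℚᵘ-/ m′ 1))
    (ℚᵘ.≃-trans (ℚᵘ.*≡* (cong₂ ℤ._*_ (sym (ℤ.pos-* m m′)) (cong +_ (sym (ℕ.*-identityʳ (suc n))))))
        (ℚᵘ.≃-sym (toℚᵘ-/ (m * m′) (suc n))))))

↥↧-/ : ∀ m n .{{_ : NonZero n}} → ∃[ s ] ↥ (+ m / n) ≡ + s × s * n ≡ m * ↧ₙ (+ m / n)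
↥↧-/ m (suc n) with + m / suc n | toℚᵘ-/ m (suc n)
... | mkℚ (+ s) t c    | ℚᵘ.*≡* eq =
    s , refl , ℤ.+-injective (trans (ℤ.pos-* s (suc n)) (trans eq (sym (ℤ.pos-* m (suc t)))))
... | mkℚ -[1+ s ] t c | ℚᵘ.*≡* eq with () ← trans eq (sym (ℤ.pos-* m (suc t)))

integer : ∀ m → + m / 1 ≡ mkℚ (+ m) 0 (Coprime.sym (1-coprimeTo m))
integer m = ℚ.↥p/↧p≡p (mkℚ (+ m) 0 (Coprime.sym (1-coprimeTo m)))

0≤/ : ∀ m n .{{_ : NonZero n}} → 0ℚ ℚ.≤ + m / n
0≤/ m n = ℚ.nonNegative⁻¹ _ {{ℚ.normalize-nonNeg m n}}

/-^ : ∀ m t → (+ m / 1) ^ℚ t ≡ + (m ^ t) / 1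
/-^ m zero    = refl
/-^ m (suc t) = trans (cong ((+ m / 1) ℚ.*_) (/-^ m t)) (/-* m 1 (m ^ t))

/-^-≤ : ∀ m {y} → + m / 1 ℚ.≤ y → ∀ t → + (m ^ t) / 1 ℚ.≤ y ^ℚ t
/-^-≤ m m≤y zero        = ℚ.≤-refl
/-^-≤ m {y} m≤y (suc t) = begin
  + (m * m ^ t) / 1  ≡⟨ /-* m 1 (m ^ t) ⟨
  (+ m / 1) ℚ.* (+ (m ^ t) / 1)  ≤⟨ ℚ.*-monoˡ-≤-nonNeg (+ m / 1) {{ℚ.normalize-nonNeg m 1}}
      (/-^-≤ m m≤y t) ⟩
  (+ m / 1) ℚ.* y ^ℚ t
    ≤⟨ ℚ.*-monoʳ-≤-nonNeg (y ^ℚ t) {{ℚ.nonNegative (ℚ.≤-trans (0≤/ (m ^ t) 1) (/-^-≤ m m≤y t))}} m≤y ⟩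
  y ℚ.* y ^ℚ t  ∎
  where open ℚ.≤-Reasoning

1/∈ : ∀ {x} → fromℕ 0 <ᴿ x → ∃[ E ] Σ[ nz ∈ NonZero E ] x ∋ (_/_ (+ 1) E {{nz}})
1/∈ {x} (a , 0≤a , a∈) with b , a<b , b∈ ← ℝ.rounded x a∈ with b | ℚ.≤-<-trans (ℚ.≮⇒≥ 0≤a) a<b
... | b′@(mkℚ (+ suc s) t c) | _ =
    -- The denominator of b is t + 1 and its numerator is positive, so b ≥ 1/(t + 1) > 1/(t + 2).
    suc (suc t) , _ , ℝ.downward x (subst (+ 1 / suc (suc t) ℚ.<_) (ℚ.↥p/↧p≡p b′)
        (/-<⁺ {1} {suc (suc t)} {suc s} {suc t}
            (s≤s (ℕ.≤-trans (ℕ.≤-reflexive (cong suc (ℕ.+-identityʳ t))) (ℕ.m≤m+n (suc t) _))))) b∈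
... | mkℚ (+ zero) t c   | ℚ.*<* (ℤ.+<+ ())
... | mkℚ -[1+ s ] t c   | ℚ.*<* ()

-- Membership in the cut of a multiple needs a strict inequality, here r/(2E) < r/E; this is where
-- the factor 2 in front of E comes from.
scaled∋ : ∀ {x : ℝ} {E r} .{{_ : NonZero E}} .{{_ : NonZero (2 * E)}} .{{_ : NonZero r}} →
  x ∋ (+ 1 / E) → (x *ᴿ r) ∋ (+ r / (2 * E))
scaled∋ {x} {E} {r} 1/E∈ = + 1 / E , 1/E∈ , subst (+ r / (2 * E) ℚ.<_) (sym (/-* 1 E r))
  (/-<⁺ {r} {2 * E} {1 * r} {E} (subst (λ z → r * E < z * (2 * E)) (sym (ℕ.*-identityˡ r))
    (ℕ.*-monoʳ-< r (ℕ.m<m+n E (ℕ.≤-trans (ℕ.>-nonZero⁻¹ E) (ℕ.m≤m+n E 0))))))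

lower-bound⇒≤ : ∀ {x : ℝ} {E r e} .{{_ : NonZero E}} .{{_ : NonZero r}} →
  x ∋ (+ 1 / E) → (x *ᴿ r) ≤ᴿ fromℕ e → r ≤ 2 * E * e
lower-bound⇒≤ {x} {E} {r} {e} 1/E∈ xr≤e = ℕ.<⇒≤ (subst₂ _<_ (ℕ.*-identityʳ r) (ℕ.*-comm e (2 * E))
  (/-<⁻ {r} {2 * E} {e} {1} (xr≤e _ (scaled∋ {x} 1/E∈))))
  where instance _ = ℕ.m*n≢0 2 E

^-cancelˡ-< : ∀ {m n} t → m ^ t < n ^ t → m < n
^-cancelˡ-< t lt = ℕ.≰⇒> λ n≤m → ℕ.<⇒≱ lt (ℕ.^-monoˡ-≤ t n≤m)

^-^-comm : ∀ m i j → (m ^ i) ^ j ≡ (m ^ j) ^ i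
^-^-comm m i j = trans (ℕ.^-*-assoc m i j) (trans (cong (m ^_) (ℕ.*-comm i j)) (sym (ℕ.^-*-assoc m j i)))

module _ (q : ℕ) .{{_ : NonZero q}} (1<q : 1 < q) where

  -- If (1 + Δ)^(2E) were less than q^r, the rational 1 + Δ would witness that Δ lies in the cut on
  -- the left, and the hypothesis would give Δ < Δ.
  power-bound : ∀ {x : ℝ} {E r Δ} .{{_ : NonZero E}} .{{_ : NonZero r}} →
    x ∋ (+ 1 / E) → (q ^ᴿ (x *ᴿ r)) ≤ᴿ fromℕ Δ → q ^ r ≤ suc Δ ^ (2 * E)
  power-bound {x} {E} {r} {Δ} 1/E∈ q^xr≤Δ with q ^ r ℕ.≤? suc Δ ^ (2 * E)
  ... | yes le = le
  ... | no  ≰  = contradiction (q^xr≤Δ (+ Δ / 1)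
          (a , + suc Δ / 1 , scaled∋ {x} 1/E∈ , /-<⁺ {Δ} {1} {suc Δ} {1} (ℕ.≤-reflexive refl) , 0≤/
              (suc Δ) 1 , y^t≤q^s))
          (ℚ.<-irrefl refl)
    where
    instance _ = ℕ.m*n≢0 2 E
    a = + r / (2 * E)
    t = ↧ₙ a
    s = proj₁ (↥↧-/ r (2 * E))
    ↥a≡s : ↥ a ≡ + s
    ↥a≡s = proj₁ (proj₂ (↥↧-/ r (2 * E)))
    s*2E≡r*t : s * (2 * E) ≡ r * t
    s*2E≡r*t = proj₂ (proj₂ (↥↧-/ r (2 * E)))
    Δ^t≤q^s : suc Δ ^ t ≤ q ^ s
    Δ^t≤q^s = ℕ.≮⇒≥ λ q^s<Δ^t → ≰ (ℕ.<⇒≤ (^-cancelˡ-< t (begin-strict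
      (q ^ r) ^ t  ≡⟨ ℕ.^-*-assoc q r t ⟩
      q ^ (r * t)  ≡⟨ cong (q ^_) s*2E≡r*t ⟨
      q ^ (s * (2 * E))  ≡⟨ ℕ.^-*-assoc q s (2 * E) ⟨
      (q ^ s) ^ (2 * E)  <⟨ ℕ.^-monoˡ-< (2 * E) q^s<Δ^t ⟩
      (suc Δ ^ t) ^ (2 * E)  ≡⟨ ^-^-comm (suc Δ) t (2 * E) ⟩
      (suc Δ ^ (2 * E)) ^ t  ∎)))
      where open ℕ.≤-Reasoning
    y^t≤q^s : (+ suc Δ / 1) ^ℚ t ℚ.≤ q ^ℤ (↥ a)
    y^t≤q^s = subst₂ ℚ._≤_ (sym (/-^ (suc Δ) t)) (cong (λ i → q ^ℤ i) (sym ↥a≡s))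
      (/-≤⁺ {suc Δ ^ t} {1} {q ^ s} {1} (ℕ.*-monoˡ-≤ 1 Δ^t≤q^s))

  -- Membership would give α = s/t < r/C with M^t ≤ q^s. Its C-th power contradicts q^r ≤ M^C; for
  -- negative α already M ≥ 1 is violated.
  power-∌ : ∀ {C r M} .{{_ : NonZero C}} → 0 < M → q ^ r ≤ M ^ C →
      ¬ (q ^ᴿ (fromℚ (+ 1 / C) *ᴿ r)) ∋ (+ M / 1)
  power-∌ {C} {r} {M} 0<M q^r≤M^C (α , y , (β , β<1/C , α<βr) , M<y , _ , y^t≤q^α) =
      go α α<r/C (ℚ.≤-trans (/-^-≤ M (ℚ.<⇒≤ M<y) (↧ₙ α)) y^t≤q^α)
    where
    α<r/C : α ℚ.< + r / C
    α<r/C = ℚ.<-≤-trans α<βr (ℚ.≤-trans (ℚ.*-monoʳ-≤-nonNeg (+ r / 1) {{ℚ.normalize-nonNeg r 1}}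
        (ℚ.<⇒≤ β<1/C))
      (ℚ.≤-reflexive (trans (/-* 1 C r) (cong (λ z → + z / C) (ℕ.*-identityˡ r)))))
    go : ∀ α → α ℚ.< + r / C → ¬ + (M ^ ↧ₙ α) / 1 ℚ.≤ q ^ℤ (↥ α)
    go α@(mkℚ (+ s) t-1 _) α<r/C M^t≤q^s = ℕ.<-irrefl refl (begin-strict
      (M ^ t) ^ C
        ≤⟨ ℕ.^-monoˡ-≤ C (subst₂ _≤_ (ℕ.*-identityʳ (M ^ t)) (ℕ.*-identityʳ (q ^ s))
            (/-≤⁻ {M ^ t} {1} {q ^ s} {1} M^t≤q^s)) ⟩
      (q ^ s) ^ C  ≡⟨ ℕ.^-*-assoc q s C ⟩
      q ^ (s * C)
        <⟨ ℕ.^-monoʳ-< q 1<q (/-<⁻ {s} {t} {r} {C} (subst (ℚ._< + r / C) (sym (ℚ.↥p/↧p≡p α)) α<r/C)) ⟩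
      q ^ (r * t)  ≡⟨ ℕ.^-*-assoc q r t ⟨
      (q ^ r) ^ t  ≤⟨ ℕ.^-monoˡ-≤ t q^r≤M^C ⟩
      (M ^ C) ^ t  ≡⟨ ^-^-comm M C t ⟩
      (M ^ t) ^ C  ∎)
      where
      open ℕ.≤-Reasoning
      t = suc t-1
    go (mkℚ -[1+ s ] t-1 _) _ M^t≤q^s =
        ℕ.<⇒≱ (ℕ.<-≤-trans 1<q (ℕ.≤-trans (ℕ.m≤m*n q (q ^ s)) (ℕ.m≤n*m (q ^ suc s) (M ^ suc t-1))))
      (/-≤⁻ {M ^ suc t-1} {1} {1} {q ^ suc s} M^t≤q^s)
      where
      instance
        _ = ℕ.m^n≢0 q s
        _ = ℕ.m^n≢0 q (suc s)
        _ = ℕ.m^n≢0 M (suc t-1) {{ℕ.>-nonZero 0<M}}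

  Pr-≤ : ∀ {A : Set} {P : Pred A 0ℓ} (P? : Decidable P) xs M .{{_ : NonZero (q ^ M)}} →
    q ^ M * length (filter P? xs) ≤ length xs → Pr xs P? ℚ.≤ + 1 / (q ^ M)
  Pr-≤ P? []           M _  = 0≤/ 1 (q ^ M)
  Pr-≤ P? xs@(_ ∷ _) M le = /-≤⁺ {length (filter P? xs)} {length xs} {1} {q ^ M}
    (ℕ.≤-trans (ℕ.≤-reflexive (ℕ.*-comm (length (filter P? xs)) (q ^ M)))
        (ℕ.≤-trans le (ℕ.≤-reflexive (sym (ℕ.*-identityˡ (length xs))))))

  0≤Pr : ∀ {A : Set} {P : Pred A 0ℓ} (P? : Decidable P) xs → 0ℚ ℚ.≤ Pr xs P?
  0≤Pr P? []         = ℚ.≤-refl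
  0≤Pr P? xs@(_ ∷ _) = 0≤/ (length (filter P? xs)) (length xs)

  Pr-≤-power : ∀ {A : Set} {P : Pred A 0ℓ} (P? : Decidable P) xs {C r M} .{{_ : NonZero C}} →
      q ^ r ≤ M ^ C →
    q ^ suc M * length (filter P? xs) ≤ length xs →
        fromℚ (Pr xs P?) ≤ᴿ q ^ᴿ (-ᴿ (q ^ᴿ (fromℚ (+ 1 / C) *ᴿ r)))
  Pr-≤-power P? xs {C} {r} {zero} q^r≤ _ =
      contradiction (ℕ.<-≤-trans (ℕ.m^n>0 q r) (ℕ.≤-trans q^r≤ (ℕ.≤-reflexive (0^C C)))) λ ()
    where
    0^C : ∀ C .{{_ : NonZero C}} → 0 ^ C ≡ 0
    0^C (suc C) = refl
  Pr-≤-power P? xs {C} {r} {M@(suc M-1)} q^r≤ le z z<Pr =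
    -- The exponent -(1 + M) lies in the cut of -q^(r/C): the larger number demanded there is -M,
    -- and M is not below q^(r/C). This unit of room is why the bound was prepared with `suc M`.
    mkℚ -[1+ M ] 0 (Coprime.sym (1-coprimeTo (suc M))) , Pr xs P? ,
    (mkℚ -[1+ M-1 ] 0 (Coprime.sym (1-coprimeTo M)) , ℚ.*<* (ℤ.-<- (s≤s (ℕ.≤-refl))) ,
      λ ∋M → power-∌ {C} {r} {M} (s≤s z≤n) q^r≤ (subst (λ z → (q ^ᴿ (fromℚ (+ 1 / C) *ᴿ r)) ∋ z)
          (sym (integer M)) ∋M)) ,
    z<Pr , 0≤Pr P? xs , ℚ.≤-trans (ℚ.≤-reflexive (ℚ.*-identityʳ _)) (Pr-≤ P? xs (suc M) le)
    where
    instance _ = ℕ.m^n≢0 q (suc M)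

corollary1p6 : (q k : ℕ) .{{_ : NonZero q}} .{{_ : NonZero k}} (q-prime : Prime q)
    (ε δ : ℝ) → fromℕ 0 <ᴿ ε → ε <ᴿ fromℕ 1 → fromℕ 0 <ᴿ δ → δ <ᴿ fromℕ 1 →
    let open ReedMuller q in
    ∃[ c ] fromℕ 0 <ᴿ c × ∃[ r₀ ]
    ((n d r Δ e : ℕ)
    .{{_ : NonZero n}} .{{_ : NonZero d}} .{{_ : NonZero r}}
    .{{_ : NonZero Δ}} .{{_ : NonZero e}} →
    r ≥ r₀ →
    r + d ≡ (q ∸ 1) * n →
    q ^ᴿ (ε *ᴿ r) ≤ᴿ fromℕ Δ →
    fromℕ Δ ≤ᴿ q ^ᴿ fromℚ (_/_ (+ r) (4 * (q ∸ 1)) {{4[q-1]-nonZero q-prime}} ℚ.- + 2 / 1) →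
    δ *ᴿ r ≤ᴿ fromℕ e →
    + e / 1 ℚ.≤ _/_ (+ r) (4 * k) {{m*n≢0 4 k}} →
    (f : Func n) → Far Δ f (𝒫 n d) →
    fromℚ (Pr (tuples (𝒫 n e) k) (λ Ps → (f · ∏ Ps) ∈F? 𝒫 n (d + e * k)))
    ≤ᴿ q ^ᴿ (-ᴿ (q ^ᴿ (c *ᴿ r))))
corollary1p6 q k q-prime ε δ 0<ε _ 0<δ _ with 1/∈ {ε} 0<ε | 1/∈ {δ} 0<δ
... | E₁ , E₁≢0 , 1/E₁∈ | E₂ , E₂≢0 , 1/E₂∈ =
    fromℚ (+ 1 / C) , (+ 0 / 1 , ℚ.<-irrefl refl , /-<⁺ {0} {1} {1} {C} (s≤s z≤n)) , r₀ , bound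
  where
  open ReedMuller q
  instance
    _ = E₁≢0
    _ = E₂≢0
    E≢0 : NonZero (2 * E₁ * (2 * E₂))
    E≢0 = m*n≢0 (2 * E₁) (2 * E₂) {{m*n≢0 2 E₁}} {{m*n≢0 2 E₂}}
  -- The product dominates both 2 E₁ and 2 E₂, the bounds obtained from ε and from δ.
  E = 2 * E₁ * (2 * E₂)
  1<q = ℕ.nonTrivial⇒n>1 q {{prime⇒nonTrivial q-prime}}
  open Exponents q k E 1<q
  bound : (n d r Δ e : ℕ)
    .{{_ : NonZero n}} .{{_ : NonZero d}} .{{_ : NonZero r}}
    .{{_ : NonZero Δ}} .{{_ : NonZero e}} →
    r ≥ r₀ →
    r + d ≡ (q ∸ 1) * n →
    q ^ᴿ (ε *ᴿ r) ≤ᴿ fromℕ Δ →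
    fromℕ Δ ≤ᴿ q ^ᴿ fromℚ (_/_ (+ r) (4 * (q ∸ 1)) {{4[q-1]-nonZero q-prime}} ℚ.- + 2 / 1) →
    δ *ᴿ r ≤ᴿ fromℕ e →
    + e / 1 ℚ.≤ _/_ (+ r) (4 * k) {{m*n≢0 4 k}} →
    (f : Func n) → Far Δ f (𝒫 n d) →
    fromℚ (Pr (tuples (𝒫 n e) k) (λ Ps → (f · ∏ Ps) ∈F? 𝒫 n (d + e * k)))
    ≤ᴿ q ^ᴿ (-ᴿ (q ^ᴿ (fromℚ (+ 1 / C) *ᴿ r)))
  bound n d r Δ e r≥r₀ r+d≡ q^εr≤Δ _ δr≤e e≤r/4k f far =
    Pr-≤-power q 1<q (accepts? d e f) (tuples (𝒫 n e) k) {C} {r} {proj₁ exp} (proj₁ (proj₂ exp))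
        (proj₂ (proj₂ exp))
    where
    open ReedMullerCode q q-prime using (accepts?; accepts⇒Deg; 𝒫-enumeration; far⇒support)
    open ProductTest (Residues.primeField q q-prime) using (acceptance-count)
    q^r≤ : q ^ r ≤ (1 + Δ) ^ E
    q^r≤ = ℕ.≤-trans (power-bound q 1<q {ε} {E₁} {r} {Δ} 1/E₁∈ q^εr≤Δ)
        (ℕ.^-monoʳ-≤ (1 + Δ) (ℕ.m≤m*n (2 * E₁) (2 * E₂) {{m*n≢0 2 E₂}}))
    r≤Ee : r ≤ E * e
    r≤Ee = ℕ.≤-trans (lower-bound⇒≤ {δ} {E₂} {r} {e} 1/E₂∈ δr≤e)
        (ℕ.*-monoˡ-≤ e (ℕ.m≤n*m (2 * E₂) (2 * E₁) {{m*n≢0 2 E₁}}))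
    4ke≤r : 4 * (k * e) ≤ r
    4ke≤r = subst₂ _≤_ (trans (ℕ.*-comm e (4 * k)) (ℕ.*-assoc 4 k e)) (ℕ.*-identityʳ r)
        (/-≤⁻ {e} {1} {r} {4 * k} {{_}} {{m*n≢0 4 k}} e≤r/4k)
    exp = exponent r≥r₀ q^r≤ r≤Ee 4ke≤r (acceptance-count {e = e} {k} {Δ} {t = t r≥r₀ q^r≤ r≤Ee 4ke≤r} f
        (𝒫-enumeration n e) r+d≡
      (pred-u<e r≥r₀ q^r≤ r≤Ee 4ke≤r) (t≤u r≥r₀ q^r≤ r≤Ee 4ke≤r) (slack r≥r₀ q^r≤ r≤Ee 4ke≤r)
      (far⇒support far) (accepts? d e f) (λ {Ps} → accepts⇒Deg {f = f} Ps))
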